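{- Let $p\ge 3$ be a prime and let $(a_n)_{n\ge0}$ be a sequence of elements of $\mathbf{Q}_p$ satisfying $a_n=ra_{n-1}+sa_{n-2}$ ($n\ge2$) for some $r,s\in\mathbf{Q}_p$, given by $a_n=c_1\lambda_1^n+c_2\lambda_2^n$ for nonzero $c_1,c_2,\lambda_1,\lambda_2$ which all lie in $\mathbf{Q}_p$ or all lie in some unramified quadratic extension $\mathbf{Q}_p(\sqrt d)$ of $\mathbf{Q}_p$. Suppose $|\lambda_1|_p=|\lambda_2|_p>0$ and $\lambda_2/\lambda_1$ is not a root of unity. Let $l$ be the order of $\lambda_2/\lambda_1$ modulo $p$ and $k=\nu_p\big((\lambda_2/\lambda_1)^l-1\big)$. Let $K$ be the Kepler set of $(a_n)$ and let $\Lambda$ be the closure of $\{(\lambda_2/\lambda_1)^n: n\in\mathbf{N}\}$. <ol> <li>If $-c_1/c_2\notin\Lambda$, then $$K=\bigsqcup_{i=0}^{l-1}\left(\frac{a_{i+1}}{a_i}+p^{\nu_p(c_1/c_2)+\nu_p(\lambda_2-\lambda_1)-2\nu_p\left(c_1/c_2+(\lambda_2/\lambda_1)^i\right)+k}\mathbf{Z}_p\right).$$</li> <li>If $-c_1/c_2\in\Lambda$ and $l=1$, then $K=\mathbf{Q}_p\setminus\left(\frac{\lambda_1+\lambda_2}{2}+p^{1+\nu_p(\lambda_2)}\mathbf{Z}_p\right)$.</li> <li>If $-c_1/c_2\in\Lambda$, $l\ge2$, and $s\in\{0,1,\dots,l-1\}$ is defined by $(\lambda_2/\lambda_1)^s\equiv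 -c_1/c_2 \pmod{p^k}$, then $$K=\bigsqcup_{i=0,\,i\ne s}^{l-1}\left(\frac{a_{i+1}}{a_i}+p^{\nu_p(\lambda_2-\lambda_1)+k}\mathbf{Z}_p\right)\ \bigsqcup\ \left(\mathbf{Q}_p\setminus p^{\nu_p(\lambda_2)+1-k}\mathbf{Z}_p\right).$$</li> </ol>
   Context: The Kepler set of a sequence $(a_n)_{n\ge0}$ in $\mathbf{Q}_p$ is the closure in $\mathbf{Q}_p$ of $\{a_{n+1}/a_n : n\ge0,\ a_n\ne0\}$. $\nu_p$ denotes the $p$-adic valuation on $\mathbf{Q}_p$ and its unique extension to $\mathbf{Q}_p(\sqrt d)$ with $\nu_p(p)=1$; $|x|_p=p^{ -\nu_p(x)}$. The unramified quadratic extension is $\mathbf{Q}_p(\sqrt d)$ with $d\in\mathbf{Z}_p^*$ a non-square; its ring of integers is $\mathbf{Z}_p[\sqrt d]$. For $x,y$ in the ring of integers and $m\ge1$, $x\equiv y\pmod{p^m}$ means $x-y\in p^m$ times the ring of integers. For a unit $u$ of the ring of integers, the order of $u$ modulo $p$ is the least $l\ge1$ with $u^l\equiv1\pmod p$. The closure $\Lambda$ is taken in the field containing $\lambda_1,\lambda_2$; $\bigsqcup$ denotes disjoint union. -}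

module Defs where

open import Algebra.Apartness.Bundles using (HeytingField; HeytingCommutativeRing)
open import Algebra.Bundles using (CommutativeRing; Semiring)
import Algebra.Consequences.Setoid as Consequences
import Algebra.Definitions.RawSemiring as RawSemiringDefs
import Algebra.Definitions.RawMagma as RawMagmaDefs
import Algebra.Properties.Magma.Divisibility as MagmaDivisibility
import Algebra.Properties.Ring as RingProperties
import Algebra.Properties.Semiring.Exp as Exp
import Algebra.Apartness.Properties.HeytingCommutativeRing as HeytingProperties
import Algebra.Solver.Ring.NaturalCoefficients.Default as SemiringSolver
open import Algebra.Definitions using (Invertible)
open import Algebra.Structures using (IsCommutativeRing)
open import Data.Empty using (⊥-elim)
open import Data.Integer.Base as ℤ using (ℤ; +_; -[1+_])
open import Data.Nat.Base as ℕ using (ℕ; zero; suc)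
import Data.Integer.Properties as ℤProps
open import Data.Integer.Tactic.RingSolver using (solve-∀)
open import Data.Nat.Coprimality using (coprime-Bézout)
import Data.Nat.Divisibility as ℕ∣
open import Data.Nat.GCD using (module Bézout)
open import Data.Nat.Primality using (Prime; euclidsLemma; prime⇒irreducible; prime⇒nonZero)
import Data.Nat.Properties as ℕₚ
open import Data.Product.Base using (Σ; ∃; _×_; _,_; proj₁; proj₂)
open import Data.Sum.Base using (_⊎_; inj₁; inj₂)
open import Data.Rational.Base as ℚ using (ℚ)
open import Level using (0ℓ)
open import Relation.Binary.PropositionalEquality as ≡ using (_≡_; _≢_)
open import Relation.Binary.Bundles using (Setoid)
open import Relation.Binary.Structures using (IsEquivalence)
import Relation.Binary.Reasoning.Setoid as SetoidReasoning
open import Relation.Unary using (Pred; _⊥_)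
open import Relation.Nullary using (¬_; Dec; yes; no)
open import Relation.Nullary.Decidable using (decidable-stable; map′; _×-dec_)

-- A discrete valuation ring with a chosen uniformizer; separatedness is
-- stated through divisibility because ≈ need not be decidable.
record DVR : Set₁ where
  field
    commutativeRing : CommutativeRing 0ℓ 0ℓ
  open CommutativeRing commutativeRing public
  open Exp semiring public
  open RawSemiringDefs (Semiring.rawSemiring semiring) public using (_∣_)
  field
    π         : Carrier
    π-cancel  : ∀ x y → x * π ≈ y * π → x ≈ y
    π∣?       : ∀ x → Dec (π ∣ x)
    π∤1       : ¬ (π ∣ 1#)
    π∤⇒unit   : ∀ x → ¬ (π ∣ x) → x ∣ 1#
    separated : ∀ x → (∀ n → π ^ n ∣ x) → x ≈ 0#

  -- Some power of π does not divide x: the positive form of x ≉ 0#, whose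
  -- negation gives x ≈ 0# by separated.
  NonZero : Carrier → Set
  NonZero x = ∃ λ n → ¬ (π ^ n ∣ x)

-- The field of fractions of O, as O[1/π]: every nonzero element of O is
-- a unit times a power of π.  The element a /π^ e is a·π⁻ᵉ.
module FractionField (O : DVR) where
  private
    module O = DVR O
    open O using (π; _^_; _∣_)
    open RawMagmaDefs (Semiring.*-rawMagma O.semiring) using (_,_)
    open MagmaDivisibility O.*-magma using (∣ʳ-respˡ-≈)
    open SemiringSolver O.commutativeSemiring using (solve; _:=_; _:+_; _:*_)
    open RingProperties O.ring using (-‿distribˡ-*; -0#≈0#; -‿involutive; -‿+-comm)

  infix 5 _/π^_
  record Frac : Set where
    no-eta-equality
    pattern
    constructor _/π^_
    field
      num : O.Carrier
      exp : ℕ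
  open Frac public

  infix  4 _≈_ _#_
  infixl 6 _+_ _-_
  infixl 7 _*_
  infix  8 -_

  record _≈_ (x y : Frac) : Set where
    constructor cross
    field
      uncross : num x O.* π ^ exp y O.≈ num y O.* π ^ exp x
  open _≈_ public

  _+_ _*_ : Frac → Frac → Frac
  (a /π^ e) + (b /π^ f) = (a O.* π ^ f O.+ b O.* π ^ e) /π^ (e ℕ.+ f)
  (a /π^ e) * (b /π^ f) = (a O.* b) /π^ (e ℕ.+ f)

  -_ : Frac → Frac
  - (a /π^ e) = (O.- a) /π^ e

  _-_ : Frac → Frac → Frac
  x - y = x + - y

  0# 1# : Frac
  0# = O.0# /π^ 0
  1# = O.1# /π^ 0

  record _#_ (x y : Frac) : Set where
    constructor apart
    field
      nonZero : O.NonZero (num (x - y))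
  open _#_ public

  fromO : O.Carrier → Frac
  fromO a = a /π^ 0

  open SetoidReasoning O.setoid

  ^-split : ∀ m n → π ^ (m ℕ.+ n) O.≈ π ^ m O.* π ^ n
  ^-split = O.^-homo-* π

  ^-cancel : ∀ n x y → x O.* π ^ n O.≈ y O.* π ^ n → x O.≈ y
  ^-cancel zero    x y eq = O.trans (O.sym (O.*-identityʳ x)) (O.trans eq (O.*-identityʳ y))
  ^-cancel (suc n) x y eq = ^-cancel n x y (O.π-cancel _ _ (begin
    x O.* π ^ n O.* π     ≈⟨ solve 3 (λ x y z → x :* y :* z := x :* (z :* y)) O.refl x (π ^ n) π ⟩
    x O.* (π O.* π ^ n)   ≈⟨ eq ⟩
    y O.* (π O.* π ^ n)   ≈⟨ solve 3 (λ x y z → x :* y :* z := x :* (z :* y)) O.refl y (π ^ n) π ⟨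
    y O.* π ^ n O.* π     ∎))

  private
    mk≈ : ∀ {a b e f} → a O.≈ b → e ≡ f → (a /π^ e) ≈ (b /π^ f)
    mk≈ eq ≡.refl = cross (O.*-congʳ eq)

    ≈-refl : ∀ {x} → x ≈ x
    ≈-refl = cross O.refl

    ≈-sym : ∀ {x y} → x ≈ y → y ≈ x
    ≈-sym (cross eq) = cross (O.sym eq)

    ≈-trans : ∀ {x y z} → x ≈ y → y ≈ z → x ≈ z
    ≈-trans {a /π^ e} {b /π^ f} {c /π^ g} (cross x≈y) (cross y≈z) = cross (^-cancel f _ _ (begin
      a O.* π ^ g O.* π ^ f   ≈⟨ swap a (π ^ g) (π ^ f) ⟩
      a O.* π ^ f O.* π ^ g   ≈⟨ O.*-congʳ x≈y ⟩
      b O.* π ^ e O.* π ^ g   ≈⟨ swap b (π ^ e) (π ^ g) ⟩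
      b O.* π ^ g O.* π ^ e   ≈⟨ O.*-congʳ y≈z ⟩
      c O.* π ^ f O.* π ^ e   ≈⟨ swap c (π ^ f) (π ^ e) ⟩
      c O.* π ^ e O.* π ^ f   ∎))
      where
      swap : ∀ x y z → x O.* y O.* z O.≈ x O.* z O.* y
      swap = solve 3 (λ x y z → x :* y :* z := x :* z :* y) O.refl

    +-cong : ∀ {x y u v} → x ≈ y → u ≈ v → (x + u) ≈ (y + v)
    +-cong {a /π^ e} {b /π^ f} {c /π^ g} {d /π^ h} (cross x≈y) (cross u≈v) = cross (begin
      (a O.* π ^ g O.+ c O.* π ^ e) O.* π ^ (f ℕ.+ h)
        ≈⟨ O.*-congˡ (^-split f h) ⟩
      (a O.* π ^ g O.+ c O.* π ^ e) O.* (π ^ f O.* π ^ h)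
        ≈⟨ solve 6 (λ a c e f g h → (a :* g :+ c :* e) :* (f :* h) := a :* f :* (g :* h) :+ c :* h :* (e :* f)) O.refl
             a c (π ^ e) (π ^ f) (π ^ g) (π ^ h) ⟩
      a O.* π ^ f O.* (π ^ g O.* π ^ h) O.+ c O.* π ^ h O.* (π ^ e O.* π ^ f)
        ≈⟨ O.+-cong (O.*-congʳ x≈y) (O.*-congʳ u≈v) ⟩
      b O.* π ^ e O.* (π ^ g O.* π ^ h) O.+ d O.* π ^ g O.* (π ^ e O.* π ^ f)
        ≈⟨ solve 6 (λ b d e f g h → b :* e :* (g :* h) :+ d :* g :* (e :* f) := (b :* h :+ d :* f) :* (e :* g)) O.refl
             b d (π ^ e) (π ^ f) (π ^ g) (π ^ h) ⟩
      (b O.* π ^ h O.+ d O.* π ^ f) O.* (π ^ e O.* π ^ g)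
        ≈⟨ O.*-congˡ (^-split e g) ⟨
      (b O.* π ^ h O.+ d O.* π ^ f) O.* π ^ (e ℕ.+ g) ∎)

    *-cong : ∀ {x y u v} → x ≈ y → u ≈ v → (x * u) ≈ (y * v)
    *-cong {a /π^ e} {b /π^ f} {c /π^ g} {d /π^ h} (cross x≈y) (cross u≈v) = cross (begin
      a O.* c O.* π ^ (f ℕ.+ h)          ≈⟨ O.*-congˡ (^-split f h) ⟩
      a O.* c O.* (π ^ f O.* π ^ h)      ≈⟨ exchange a c (π ^ f) (π ^ h) ⟩
      a O.* π ^ f O.* (c O.* π ^ h)      ≈⟨ O.*-cong x≈y u≈v ⟩
      b O.* π ^ e O.* (d O.* π ^ g)      ≈⟨ exchange b (π ^ e) d (π ^ g) ⟩
      b O.* d O.* (π ^ e O.* π ^ g)      ≈⟨ O.*-congˡ (^-split e g) ⟨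
      b O.* d O.* π ^ (e ℕ.+ g)          ∎)
      where
      exchange : ∀ x y z w → x O.* y O.* (z O.* w) O.≈ x O.* z O.* (y O.* w)
      exchange = solve 4 (λ x y z w → x :* y :* (z :* w) := x :* z :* (y :* w)) O.refl

    -‿cong : ∀ {x y} → x ≈ y → (- x) ≈ (- y)
    -‿cong {a /π^ e} {b /π^ f} (cross x≈y) =
      cross (O.trans (O.sym (-‿distribˡ-* a _)) (O.trans (O.-‿cong x≈y) (-‿distribˡ-* b _)))

    +-assoc : ∀ x y z → ((x + y) + z) ≈ (x + (y + z))
    +-assoc (a /π^ e) (b /π^ f) (c /π^ g) = mk≈ (begin
      (a O.* π ^ f O.+ b O.* π ^ e) O.* π ^ g O.+ c O.* π ^ (e ℕ.+ f)
        ≈⟨ O.+-congˡ (O.*-congˡ (^-split e f)) ⟩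
      (a O.* π ^ f O.+ b O.* π ^ e) O.* π ^ g O.+ c O.* (π ^ e O.* π ^ f)
        ≈⟨ solve 6 (λ a b c e f g → (a :* f :+ b :* e) :* g :+ c :* (e :* f) := a :* (f :* g) :+ (b :* g :+ c :* f) :* e) O.refl
             a b c (π ^ e) (π ^ f) (π ^ g) ⟩
      a O.* (π ^ f O.* π ^ g) O.+ (b O.* π ^ g O.+ c O.* π ^ f) O.* π ^ e
        ≈⟨ O.+-congʳ (O.*-congˡ (^-split f g)) ⟨
      a O.* π ^ (f ℕ.+ g) O.+ (b O.* π ^ g O.+ c O.* π ^ f) O.* π ^ e ∎)
      (ℕₚ.+-assoc e f g)

    +-comm : ∀ x y → (x + y) ≈ (y + x)
    +-comm (a /π^ e) (b /π^ f) = mk≈ (O.+-comm _ _) (ℕₚ.+-comm e f)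

    +-identityˡ : ∀ x → (0# + x) ≈ x
    +-identityˡ (a /π^ e) = mk≈ (begin
      O.0# O.* π ^ e O.+ a O.* O.1#  ≈⟨ O.+-cong (O.zeroˡ _) (O.*-identityʳ a) ⟩
      O.0# O.+ a                     ≈⟨ O.+-identityˡ a ⟩
      a                              ∎) ≡.refl

    -‿inverseˡ : ∀ x → (- x + x) ≈ 0#
    -‿inverseˡ (a /π^ e) = cross (O.trans (O.*-congʳ (begin
      (O.- a) O.* π ^ e O.+ a O.* π ^ e  ≈⟨ O.distribʳ _ _ _ ⟨
      ((O.- a) O.+ a) O.* π ^ e          ≈⟨ O.*-congʳ (O.-‿inverseˡ a) ⟩
      O.0# O.* π ^ e                     ≈⟨ O.zeroˡ _ ⟩
      O.0#                               ∎)) (O.trans (O.zeroˡ _) (O.sym (O.zeroˡ _))))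

    *-assoc : ∀ x y z → ((x * y) * z) ≈ (x * (y * z))
    *-assoc (a /π^ e) (b /π^ f) (c /π^ g) = mk≈ (O.*-assoc a b c) (ℕₚ.+-assoc e f g)

    *-comm : ∀ x y → (x * y) ≈ (y * x)
    *-comm (a /π^ e) (b /π^ f) = mk≈ (O.*-comm a b) (ℕₚ.+-comm e f)

    *-identityˡ : ∀ x → (1# * x) ≈ x
    *-identityˡ (a /π^ e) = mk≈ (O.*-identityˡ a) ≡.refl

    distribˡ : ∀ x y z → (x * (y + z)) ≈ (x * y + x * z)
    distribˡ (a /π^ e) (b /π^ f) (c /π^ g) = cross (begin
      a O.* (b O.* π ^ g O.+ c O.* π ^ f) O.* π ^ ((e ℕ.+ f) ℕ.+ (e ℕ.+ g))
        ≈⟨ O.*-congˡ (O.trans (^-split (e ℕ.+ f) (e ℕ.+ g)) (O.*-cong (^-split e f) (^-split e g))) ⟩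
      a O.* (b O.* π ^ g O.+ c O.* π ^ f) O.* ((π ^ e O.* π ^ f) O.* (π ^ e O.* π ^ g))
        ≈⟨ solve 6 (λ a b c e f g → a :* (b :* g :+ c :* f) :* ((e :* f) :* (e :* g))
                                  := ((a :* b) :* (e :* g) :+ (a :* c) :* (e :* f)) :* (e :* (f :* g))) O.refl
             a b c (π ^ e) (π ^ f) (π ^ g) ⟩
      ((a O.* b) O.* (π ^ e O.* π ^ g) O.+ (a O.* c) O.* (π ^ e O.* π ^ f)) O.* (π ^ e O.* (π ^ f O.* π ^ g))
        ≈⟨ O.*-cong (O.+-cong (O.*-congˡ (^-split e g)) (O.*-congˡ (^-split e f)))
                    (O.trans (^-split e (f ℕ.+ g)) (O.*-congˡ (^-split f g))) ⟨
      ((a O.* b) O.* π ^ (e ℕ.+ g) O.+ (a O.* c) O.* π ^ (e ℕ.+ f)) O.* π ^ (e ℕ.+ (f ℕ.+ g)) ∎)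

    isEquivalence : IsEquivalence _≈_
    isEquivalence = record { refl = ≈-refl ; sym = ≈-sym ; trans = ≈-trans }

    setoid : Setoid 0ℓ 0ℓ
    setoid = record { isEquivalence = isEquivalence }

    module C = Consequences setoid

  isCommutativeRing : IsCommutativeRing _≈_ _+_ _*_ -_ 0# 1#
  isCommutativeRing = record
    { isRing = record
      { +-isAbelianGroup = record
        { isGroup = record
          { isMonoid = record
            { isSemigroup = record
              { isMagma = record
                { isEquivalence = isEquivalence
                ; ∙-cong = +-cong }
              ; assoc = +-assoc }
            ; identity = C.comm∧idˡ⇒id +-comm +-identityˡ }
          ; inverse = C.comm∧invˡ⇒inv +-comm -‿inverseˡ
          ; ⁻¹-cong = -‿cong }
        ; comm = +-comm }
      ; *-cong = *-cong
      ; *-assoc = *-assoc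
      ; *-identity = C.comm∧idˡ⇒id *-comm *-identityˡ
      ; distrib = C.comm∧distrˡ⇒distr +-cong *-comm distribˡ }
    ; *-comm = *-comm }

  ∣-resp : ∀ {d x y} → x O.≈ y → d ∣ x → d ∣ y
  ∣-resp x≈y (q , eq) = q , O.trans eq x≈y

  ∣-*ʳ : ∀ {d x} y → d ∣ x → d ∣ x O.* y
  ∣-*ʳ {d} {x} y (q , eq) = q O.* y , (begin
    q O.* y O.* d    ≈⟨ solve 3 (λ q y d → q :* y :* d := q :* d :* y) O.refl q y d ⟩
    q O.* d O.* y    ≈⟨ O.*-congʳ eq ⟩
    x O.* y          ∎)

  ∣-+ : ∀ {d x y} → d ∣ x → d ∣ y → d ∣ x O.+ y
  ∣-+ (q , eq) (r , eq′) = q O.+ r , O.trans (O.distribʳ _ q r) (O.+-cong eq eq′)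

  ∣-neg : ∀ {d x} → d ∣ x → d ∣ O.- x
  ∣-neg {d} (q , eq) = O.- q , O.trans (O.sym (-‿distribˡ-* q d)) (O.-‿cong eq)

  ^∣0 : ∀ n → π ^ n ∣ O.0#
  ^∣0 n = O.0# , O.zeroˡ _

  ^∣-cancel : ∀ n f {x} → π ^ (n ℕ.+ f) ∣ x O.* π ^ f → π ^ n ∣ x
  ^∣-cancel n f {x} (q , eq) = q , ^-cancel f _ _ (begin
    q O.* π ^ n O.* π ^ f      ≈⟨ O.*-assoc _ _ _ ⟩
    q O.* (π ^ n O.* π ^ f)    ≈⟨ O.*-congˡ (^-split n f) ⟨
    q O.* π ^ (n ℕ.+ f)        ≈⟨ eq ⟩
    x O.* π ^ f                ∎)

  π^∣? : ∀ n x → Dec (π ^ n ∣ x)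
  π^∣? zero x = yes (x , O.*-identityʳ x)
  π^∣? (suc n) x with O.π∣? x
  ... | no ¬π∣x = no λ { (q , eq) → ¬π∣x (q O.* π ^ n , (begin
    q O.* π ^ n O.* π    ≈⟨ solve 3 (λ x y z → x :* y :* z := x :* (z :* y)) O.refl q (π ^ n) π ⟩
    q O.* (π O.* π ^ n)  ≈⟨ eq ⟩
    x                    ∎)) }
  ... | yes (q , eq) with π^∣? n q
  ...   | yes (r , eq′) = yes (r , (begin
    r O.* (π O.* π ^ n)  ≈⟨ solve 3 (λ x y z → x :* (z :* y) := x :* y :* z) O.refl r (π ^ n) π ⟩
    r O.* π ^ n O.* π    ≈⟨ O.*-congʳ eq′ ⟩
    q O.* π              ≈⟨ eq ⟩
    x                    ∎))
  ...   | no ¬π^n∣q = no λ { (r , eq′) → ¬π^n∣q (r , O.π-cancel _ _ (begin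
    r O.* π ^ n O.* π    ≈⟨ solve 3 (λ x y z → x :* y :* z := x :* (z :* y)) O.refl r (π ^ n) π ⟩
    r O.* (π O.* π ^ n)  ≈⟨ eq′ ⟩
    x                    ≈⟨ eq ⟨
    q O.* π              ∎)) }

  nonZero-resp : ∀ {x y} → x O.≈ y → O.NonZero x → O.NonZero y
  nonZero-resp x≈y (n , h) = n , λ d → h (∣-resp (O.sym x≈y) d)

  record Factorisation (a : O.Carrier) : Set where
    field
      order     : ℕ
      unit      : O.Carrier
      isUnit    : ¬ (π ∣ unit)
      factorise : unit O.* π ^ order O.≈ a

  factorisation : ∀ a → O.NonZero a → Factorisation a
  factorisation a (n , h) = go n a h
    where
    go : ∀ n a → ¬ (π ^ n ∣ a) → Factorisation a
    go zero a h = ⊥-elim (h (a , O.*-identityʳ a))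
    go (suc n) a h with O.π∣? a
    ... | no ¬π∣a = record
      { order = 0 ; unit = a ; isUnit = ¬π∣a ; factorise = O.*-identityʳ a }
    ... | yes (q , eq) = record
      { order = suc order ; unit = unit ; isUnit = isUnit
      ; factorise = begin
          unit O.* (π O.* π ^ order)  ≈⟨ assoc unit (π ^ order) π ⟩
          unit O.* π ^ order O.* π    ≈⟨ O.*-congʳ factorise ⟩
          q O.* π                     ≈⟨ eq ⟩
          a                           ∎ }
      where
      assoc : ∀ x y z → x O.* (z O.* y) O.≈ x O.* y O.* z
      assoc = solve 3 (λ x y z → x :* (z :* y) := x :* y :* z) O.refl
      π^n∤q : ¬ (π ^ n ∣ q)
      π^n∤q (r , eq′) = h (r , (begin
        r O.* (π O.* π ^ n)  ≈⟨ assoc r (π ^ n) π ⟩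
        r O.* π ^ n O.* π    ≈⟨ O.*-congʳ eq′ ⟩
        q O.* π              ≈⟨ eq ⟩
        a                    ∎))
      open Factorisation (go n q π^n∤q)

  nonZero⇒invertible : ∀ x → O.NonZero (num x) → Invertible _≈_ 1# _*_ x
  nonZero⇒invertible (a /π^ e) a≠0 = y , yx≈1 , ≈-trans (*-comm (a /π^ e) y) yx≈1
    where
    open Factorisation (factorisation a a≠0)
    inv : unit ∣ O.1#
    inv = O.π∤⇒unit unit isUnit
    w : O.Carrier
    w = RawMagmaDefs._∣ʳ_.quotient inv
    y : Frac
    y = (w O.* π ^ e) /π^ order
    yx≈1 : (y * (a /π^ e)) ≈ 1#
    yx≈1 = cross (begin
      w O.* π ^ e O.* a O.* O.1#              ≈⟨ O.*-identityʳ _ ⟩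
      w O.* π ^ e O.* a                       ≈⟨ O.*-congˡ factorise ⟨
      w O.* π ^ e O.* (unit O.* π ^ order)    ≈⟨ solve 4 (λ w e u v → w :* e :* (u :* v) := w :* u :* (v :* e)) O.refl
                                                   w (π ^ e) unit (π ^ order) ⟩
      w O.* unit O.* (π ^ order O.* π ^ e)    ≈⟨ O.*-cong (RawMagmaDefs._∣ʳ_.equality inv) (O.sym (^-split order e)) ⟩
      O.1# O.* π ^ (order ℕ.+ e)              ∎)

  leftInvertible⇒nonZero : ∀ x y → (y * x) ≈ 1# → O.NonZero (num x)
  leftInvertible⇒nonZero (a /π^ e) (b /π^ f) (cross eq) = suc (f ℕ.+ e) , λ { (r , eq′) →
    O.π∤1 (b O.* r , ^-cancel (f ℕ.+ e) _ _ (begin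
      b O.* r O.* π O.* π ^ (f ℕ.+ e)      ≈⟨ solve 4 (λ b r p q → b :* r :* p :* q := b :* (r :* (p :* q))) O.refl
                                                b r π (π ^ (f ℕ.+ e)) ⟩
      b O.* (r O.* (π O.* π ^ (f ℕ.+ e)))  ≈⟨ O.*-congˡ eq′ ⟩
      b O.* a                              ≈⟨ O.*-identityʳ _ ⟨
      b O.* a O.* O.1#                     ≈⟨ eq ⟩
      O.1# O.* π ^ (f ℕ.+ e)               ∎)) }

  diff-≈ : ∀ {x y} → x ≈ y → num (x - y) O.≈ O.0#
  diff-≈ {a /π^ e} {b /π^ f} (cross eq) = begin
    a O.* π ^ f O.+ (O.- b) O.* π ^ e      ≈⟨ O.+-cong eq (O.sym (-‿distribˡ-* b _)) ⟩
    b O.* π ^ e O.+ O.- (b O.* π ^ e)      ≈⟨ O.-‿inverseʳ _ ⟩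
    O.0#                                   ∎

  diff-≈⁻¹ : ∀ x y → num (x - y) O.≈ O.0# → x ≈ y
  diff-≈⁻¹ (a /π^ e) (b /π^ f) eq = cross (begin
    a O.* π ^ f                                            ≈⟨ O.+-identityʳ _ ⟨
    a O.* π ^ f O.+ O.0#                                   ≈⟨ O.+-congˡ (O.-‿inverseˡ _) ⟨
    a O.* π ^ f O.+ (O.- (b O.* π ^ e) O.+ b O.* π ^ e)    ≈⟨ O.+-assoc _ _ _ ⟨
    a O.* π ^ f O.+ O.- (b O.* π ^ e) O.+ b O.* π ^ e      ≈⟨ O.+-congʳ (O.+-congˡ (-‿distribˡ-* b _)) ⟩
    a O.* π ^ f O.+ (O.- b) O.* π ^ e O.+ b O.* π ^ e      ≈⟨ O.+-congʳ eq ⟩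
    O.0# O.+ b O.* π ^ e                                   ≈⟨ O.+-identityˡ _ ⟩
    b O.* π ^ e                                            ∎)

  diff-swap : ∀ x y → O.- num (y - x) O.≈ num (x - y)
  diff-swap (a /π^ e) (b /π^ f) = begin
    O.- (b O.* π ^ e O.+ (O.- a) O.* π ^ f)          ≈⟨ -‿+-comm _ _ ⟨
    O.- (b O.* π ^ e) O.+ O.- ((O.- a) O.* π ^ f)    ≈⟨ O.+-cong (-‿distribˡ-* b _) (O.trans (O.-‿cong (O.sym (-‿distribˡ-* a _))) (-‿involutive _)) ⟩
    (O.- b) O.* π ^ e O.+ a O.* π ^ f                ≈⟨ O.+-comm _ _ ⟩
    a O.* π ^ f O.+ (O.- b) O.* π ^ e                ∎

  diff-split : ∀ x y z → num (x - z) O.* π ^ exp y O.+ num (z - y) O.* π ^ exp x O.≈ num (x - y) O.* π ^ exp z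
  diff-split (a /π^ e) (b /π^ f) (c /π^ g) = begin
    (a O.* G O.+ (O.- c) O.* E) O.* F O.+ (c O.* F O.+ (O.- b) O.* G) O.* E
      ≈⟨ solve 7 (λ a b c d e f g → (a :* g :+ d :* e) :* f :+ (c :* f :+ b :* g) :* e
                                  := (a :* f :+ b :* e) :* g :+ (c :+ d) :* (e :* f)) O.refl
           a (O.- b) c (O.- c) E F G ⟩
    (a O.* F O.+ (O.- b) O.* E) O.* G O.+ (c O.+ O.- c) O.* (E O.* F)
      ≈⟨ O.+-congˡ (O.trans (O.*-congʳ (O.-‿inverseʳ c)) (O.zeroˡ _)) ⟩
    (a O.* F O.+ (O.- b) O.* E) O.* G O.+ O.0#
      ≈⟨ O.+-identityʳ _ ⟩
    (a O.* F O.+ (O.- b) O.* E) O.* G ∎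
    where
    E F G : O.Carrier
    E = π ^ e
    F = π ^ f
    G = π ^ g

  #-cotrans : ∀ {x y} → x # y → ∀ z → x # z ⊎ z # y
  #-cotrans {x} {y} (apart (n , h)) z with π^∣? (n ℕ.+ exp z) (num (x - z))
  ... | no ¬d = inj₁ (apart (n ℕ.+ exp z , ¬d))
  ... | yes d = inj₂ (apart (n ℕ.+ exp z , λ d′ → h (^∣-cancel n (exp z)
    (∣-resp (diff-split x y z) (∣-+ (∣-*ʳ (π ^ exp y) d) (∣-*ʳ (π ^ exp x) d′))))))

  #-irrefl : ∀ {x y} → x ≈ y → ¬ (x # y)
  #-irrefl x≈y (apart (n , h)) = h (∣-resp (O.sym (diff-≈ x≈y)) (^∣0 n))

  #-sym : ∀ {x y} → x # y → y # x
  #-sym {x} {y} (apart (n , h)) = apart (n , λ d → h (∣-resp (diff-swap x y) (∣-neg d)))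

  #-tight : ∀ x y → ¬ (x # y) → x ≈ y
  #-tight x y ¬x#y = diff-≈⁻¹ x y (O.separated _ λ n → decidable-stable (π^∣? n _) λ h → ¬x#y (apart (n , h)))

  heytingField : HeytingField 0ℓ 0ℓ 0ℓ
  heytingField = record
    { Carrier = Frac ; _≈_ = _≈_ ; _#_ = _#_
    ; _+_ = _+_ ; _*_ = _*_ ; -_ = -_ ; 0# = 0# ; 1# = 1#
    ; isHeytingField = record
      { isHeytingCommutativeRing = record
        { isCommutativeRing = isCommutativeRing
        ; isApartnessRelation = record { irrefl = #-irrefl ; sym = #-sym ; cotrans = #-cotrans }
        ; #⇒invertible = λ {x} {y} x#y → nonZero⇒invertible (x - y) (nonZero x#y)
        ; invertible⇒# = λ {x} {y} (z , zx≈1 , _) → apart (leftInvertible⇒nonZero (x - y) z zx≈1) }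
      ; tight = λ x y → #-tight x y , #-irrefl } }

  num-0 : ∀ x → num (x - 0#) O.≈ num x
  num-0 (a /π^ e) = begin
    a O.* O.1# O.+ (O.- O.0#) O.* π ^ e  ≈⟨ O.+-cong (O.*-identityʳ a) (O.trans (O.*-congʳ -0#≈0#) (O.zeroˡ _)) ⟩
    a O.+ O.0#                           ≈⟨ O.+-identityʳ a ⟩
    a                                    ∎

  num-nonZero : ∀ x → x # 0# → O.NonZero (num x)
  num-nonZero x (apart h) = nonZero-resp (num-0 x) h

  -- The valuation normalised by ν(π) = 1.
  ν : ∀ x → x # 0# → ℤ
  ν x x#0 = + Factorisation.order (factorisation (num x) (num-nonZero x x#0)) ℤ.- + exp x

  infix 9 _⁻¹⟨_⟩
  _⁻¹⟨_⟩ : ∀ x → x # 0# → Frac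
  x ⁻¹⟨ x#0 ⟩ = proj₁ (nonZero⇒invertible x (num-nonZero x x#0))

  infixl 7 _/_⟨_⟩
  _/_⟨_⟩ : ∀ x y → y # 0# → Frac
  x / y ⟨ y#0 ⟩ = x * y ⁻¹⟨ y#0 ⟩

  ⁻¹-inverseˡ : ∀ {x} (x#0 : x # 0#) → x ⁻¹⟨ x#0 ⟩ * x ≈ 1#
  ⁻¹-inverseˡ {x} x#0 = proj₁ (proj₂ (nonZero⇒invertible x (num-nonZero x x#0)))

  #0-intro : ∀ {x} → O.NonZero (num x) → x # 0#
  #0-intro {x} h = apart (nonZero-resp (O.sym (num-0 x)) h)

  #⇒-#0 : ∀ {x y} → x # y → x - y # 0#
  #⇒-#0 (apart h) = #0-intro h

  ⁻¹-#0 : ∀ {x} (x#0 : x # 0#) → x ⁻¹⟨ x#0 ⟩ # 0#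
  ⁻¹-#0 {x} x#0 = #0-intro (leftInvertible⇒nonZero _ x (≈-trans (*-comm x _) (⁻¹-inverseˡ x#0)))

  π∤⇒#0 : ∀ {x} → ¬ (π ∣ num x) → x # 0#
  π∤⇒#0 h = #0-intro (1 , λ d → h (∣ʳ-respˡ-≈ (O.*-identityʳ π) d))

  π^_ : ℤ → Frac
  π^ (+ n)    = (π ^ n) /π^ 0
  π^ -[1+ n ] = O.1# /π^ suc n

module ValuedField (O : DVR) where
  private
    module O = DVR O
  open FractionField O public

  open HeytingField heytingField public using (heytingCommutativeRing)
  open HeytingCommutativeRing heytingCommutativeRing public using (commutativeRing)

  private
    open MagmaDivisibility O.*-magma using (∣ʳ-respʳ-≈)
    module R = CommutativeRing commutativeRing
    open HeytingProperties heytingCommutativeRing using (x#0y#0→xy#0; #-congʳ)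
    open RingProperties R.ring using (-‿distribˡ-*)
    open SetoidReasoning R.setoid

  open Exp R.semiring public using (_^_)

  2# : Frac
  2# = 1# + 1#

  2#0 : ¬ (O.π O.∣ O.1# O.+ O.1#) → 2# # 0#
  2#0 h = π∤⇒#0 λ d → h (∣ʳ-respʳ-≈ (O.+-cong (O.*-identityʳ O.1#) (O.*-identityʳ O.1#)) d)

  -- Coset c m is c + πᵐO.
  Coset : Frac → ℤ → Pred Frac 0ℓ
  Coset c m x = ∃ λ z → x ≈ c + π^ m * fromO z

  infix 4 _≡_[modπ^_]
  _≡_[modπ^_] : Frac → Frac → ℤ → Set
  x ≡ y [modπ^ m ] = ∃ λ z → x - y ≈ π^ m * fromO z

  -- The balls y + πᵐO with m ∈ ℕ form a neighbourhood basis of y.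
  Closure : Pred Frac 0ℓ → Pred Frac 0ℓ
  Closure S x = ∀ (m : ℕ) → ∃ λ y → S y × x ≡ y [modπ^ + m ]

  Powers : Frac → Pred Frac 0ℓ
  Powers u x = ∃ λ n → x ≈ u ^ n

  Ratios : (ℕ → Frac) → Pred Frac 0ℓ
  Ratios a x = ∃ λ n → Σ (a n # 0#) λ aₙ#0 → x ≈ a (suc n) / a n ⟨ aₙ#0 ⟩

  KeplerSet : (ℕ → Frac) → Pred Frac 0ℓ
  KeplerSet a = Closure (Ratios a)

  record OrderModπ (u : Frac) (l : ℕ) : Set where
    field
      positive : 1 ℕ.≤ l
      power    : u ^ l ≡ 1# [modπ^ + 1 ]
      minimal  : ∀ j → 1 ℕ.≤ j → j ℕ.< l → ¬ (u ^ j ≡ 1# [modπ^ + 1 ])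

  -- uⁿ ≠ 1 for all n ≥ 1, where ≠ is the apartness of the field.
  NotRootOfUnity : Frac → Set
  NotRootOfUnity u = ∀ n → 1 ℕ.≤ n → u ^ n # 1#

  /-*-cancel : ∀ x {y} (y#0 : y # 0#) → (x / y ⟨ y#0 ⟩) * y ≈ x
  /-*-cancel x {y} y#0 = begin
    (x / y ⟨ y#0 ⟩) * y      ≈⟨ R.*-assoc _ _ _ ⟩
    x * (_ * y)              ≈⟨ R.*-congˡ (⁻¹-inverseˡ y#0) ⟩
    x * 1#                   ≈⟨ R.*-identityʳ x ⟩
    x                        ∎

  /-#0 : ∀ {x y} → x # 0# → (y#0 : y # 0#) → x / y ⟨ y#0 ⟩ # 0#
  /-#0 {x} {y} x#0 y#0 = x#0y#0→xy#0 x#0 (⁻¹-#0 y#0)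

  ratio⇒-#0 : ∀ {v w} (w#0 : w # 0#) → NotRootOfUnity (v / w ⟨ w#0 ⟩) → v - w # 0#
  ratio⇒-#0 {v} {w} w#0 h = #-congʳ (begin
    (u ^ 1 - 1#) * w         ≈⟨ R.*-congʳ (R.+-congʳ (R.*-identityʳ u)) ⟩
    (u - 1#) * w             ≈⟨ R.distribʳ w u (- 1#) ⟩
    u * w + (- 1#) * w       ≈⟨ R.+-cong (/-*-cancel v w#0) (R.trans (R.sym (-‿distribˡ-* 1# w)) (R.-‿cong (R.*-identityˡ w))) ⟩
    v - w                    ∎)
    (x#0y#0→xy#0 (#⇒-#0 (h 1 (ℕ.s≤s ℕ.z≤n))) w#0)
    where
    u : Frac
    u = v / w ⟨ w#0 ⟩

DisjointFamily : {A : Set} {J : Pred ℕ 0ℓ} → (Σ ℕ J → Pred A 0ℓ) → Set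
DisjointFamily P = ∀ i j → proj₁ i ≢ proj₁ j → P i ⊥ P j

-- R[X]/(X² − d), where a +√d b stands for a + b√d.
module QuadraticExtension (R : CommutativeRing 0ℓ 0ℓ) (d : CommutativeRing.Carrier R) where
  private
    module R = CommutativeRing R
    open SemiringSolver R.commutativeSemiring using (solve; _:=_; _:+_; _:*_)

  infix 5 _+√d_
  record Quad : Set where
    constructor _+√d_
    field
      re im : R.Carrier
  open Quad public

  infix 4 _≈_
  record _≈_ (x y : Quad) : Set where
    constructor mk≈
    field
      re≈ : re x R.≈ re y
      im≈ : im x R.≈ im y
  open _≈_ public

  commutativeRing : CommutativeRing 0ℓ 0ℓ
  commutativeRing = record
    { Carrier = Quad
    ; _≈_ = _≈_
    ; _+_ = λ (a +√d b) (a′ +√d b′) → a R.+ a′ +√d b R.+ b′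
    ; _*_ = λ (a +√d b) (a′ +√d b′) → a R.* a′ R.+ d R.* (b R.* b′) +√d a R.* b′ R.+ b R.* a′
    ; -_ = λ (a +√d b) → R.- a +√d R.- b
    ; 0# = R.0# +√d R.0#
    ; 1# = R.1# +√d R.0#
    ; isCommutativeRing = record
      { isRing = record
        { +-isAbelianGroup = record
          { isGroup = record
            { isMonoid = record
              { isSemigroup = record
                { isMagma = record
                  { isEquivalence = record
                    { refl = mk≈ R.refl R.refl
                    ; sym = λ (mk≈ h k) → mk≈ (R.sym h) (R.sym k)
                    ; trans = λ (mk≈ h k) (mk≈ h′ k′) → mk≈ (R.trans h h′) (R.trans k k′) }
                  ; ∙-cong = λ (mk≈ h k) (mk≈ h′ k′) → mk≈ (R.+-cong h h′) (R.+-cong k k′) }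
                ; assoc = λ _ _ _ → mk≈ (R.+-assoc _ _ _) (R.+-assoc _ _ _) }
              ; identity = (λ _ → mk≈ (R.+-identityˡ _) (R.+-identityˡ _))
                         , (λ _ → mk≈ (R.+-identityʳ _) (R.+-identityʳ _)) }
            ; inverse = (λ _ → mk≈ (R.-‿inverseˡ _) (R.-‿inverseˡ _))
                      , (λ _ → mk≈ (R.-‿inverseʳ _) (R.-‿inverseʳ _))
            ; ⁻¹-cong = λ (mk≈ h k) → mk≈ (R.-‿cong h) (R.-‿cong k) }
          ; comm = λ _ _ → mk≈ (R.+-comm _ _) (R.+-comm _ _) }
        ; *-cong = λ (mk≈ h k) (mk≈ h′ k′) → mk≈
            (R.+-cong (R.*-cong h h′) (R.*-congˡ (R.*-cong k k′)))
            (R.+-cong (R.*-cong h k′) (R.*-cong k h′))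
        ; *-assoc = λ (a +√d b) (a′ +√d b′) (a″ +√d b″) → mk≈
            (solve 7 (λ d a b a′ b′ a″ b″ →
                (a :* a′ :+ d :* (b :* b′)) :* a″ :+ d :* ((a :* b′ :+ b :* a′) :* b″)
              := a :* (a′ :* a″ :+ d :* (b′ :* b″)) :+ d :* (b :* (a′ :* b″ :+ b′ :* a″)))
              R.refl d a b a′ b′ a″ b″)
            (solve 7 (λ d a b a′ b′ a″ b″ →
                (a :* a′ :+ d :* (b :* b′)) :* b″ :+ (a :* b′ :+ b :* a′) :* a″
              := a :* (a′ :* b″ :+ b′ :* a″) :+ b :* (a′ :* a″ :+ d :* (b′ :* b″)))
              R.refl d a b a′ b′ a″ b″)
        ; *-identity = (λ x → 1-identityˡ x) , (λ x → mk≈-trans (comm x _) (1-identityˡ x))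
        ; distrib =
            (λ (a +√d b) (a′ +√d b′) (a″ +√d b″) → mk≈
              (solve 7 (λ d a b a′ b′ a″ b″ → a :* (a′ :+ a″) :+ d :* (b :* (b′ :+ b″))
                := (a :* a′ :+ d :* (b :* b′)) :+ (a :* a″ :+ d :* (b :* b″))) R.refl d a b a′ b′ a″ b″)
              (solve 6 (λ a b a′ b′ a″ b″ → a :* (b′ :+ b″) :+ b :* (a′ :+ a″)
                := (a :* b′ :+ b :* a′) :+ (a :* b″ :+ b :* a″)) R.refl a b a′ b′ a″ b″))
          , (λ (a +√d b) (a′ +√d b′) (a″ +√d b″) → mk≈
              (solve 7 (λ d a b a′ b′ a″ b″ → (a′ :+ a″) :* a :+ d :* ((b′ :+ b″) :* b)
                := (a′ :* a :+ d :* (b′ :* b)) :+ (a″ :* a :+ d :* (b″ :* b))) R.refl d a b a′ b′ a″ b″)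
              (solve 6 (λ a b a′ b′ a″ b″ → (a′ :+ a″) :* b :+ (b′ :+ b″) :* a
                := (a′ :* b :+ b′ :* a) :+ (a″ :* b :+ b″ :* a)) R.refl a b a′ b′ a″ b″)) }
      ; *-comm = comm } }
    where
    _·_ : Quad → Quad → Quad
    (a +√d b) · (a′ +√d b′) = a R.* a′ R.+ d R.* (b R.* b′) +√d a R.* b′ R.+ b R.* a′
    mk≈-trans : ∀ {x y z} → x ≈ y → y ≈ z → x ≈ z
    mk≈-trans (mk≈ h k) (mk≈ h′ k′) = mk≈ (R.trans h h′) (R.trans k k′)
    comm : ∀ x y → (x · y) ≈ (y · x)
    comm (a +√d b) (a′ +√d b′) = mk≈
      (solve 5 (λ d a b a′ b′ → a :* a′ :+ d :* (b :* b′) := a′ :* a :+ d :* (b′ :* b)) R.refl d a b a′ b′)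
      (solve 4 (λ a b a′ b′ → a :* b′ :+ b :* a′ := a′ :* b :+ b′ :* a) R.refl a b a′ b′)
    1-identityˡ : ∀ x → ((R.1# +√d R.0#) · x) ≈ x
    1-identityˡ (a +√d b) = mk≈
      (R.trans (R.+-cong (R.*-identityˡ a) (R.trans (R.*-congˡ (R.zeroˡ b)) (R.zeroʳ d))) (R.+-identityʳ a))
      (R.trans (R.+-cong (R.*-identityˡ b) (R.zeroˡ a)) (R.+-identityʳ b))

-- π divides the norm of x + y√d only if it divides x and y; R[√d] is then
-- again a discrete valuation ring with uniformizer π.
Inert : (R : DVR) → DVR.Carrier R → Set
Inert R d = ∀ x y → π ∣ x * x + d * (- y * y) → π ∣ x × π ∣ y
  where open DVR R

module _ (R : DVR) (d : DVR.Carrier R) (inert : Inert R d) where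
  private
    module R = DVR R
    module Q = QuadraticExtension R.commutativeRing d
    module QR where
      open CommutativeRing Q.commutativeRing public
      open Exp semiring public
      open RawSemiringDefs (Semiring.rawSemiring semiring) public using (_∣_)
    open RawMagmaDefs (CommutativeRing.*-rawMagma R.commutativeRing) using (_,_)
    open RawMagmaDefs (CommutativeRing.*-rawMagma Q.commutativeRing) using () renaming (_,_ to _,,_)
    open Q using (_+√d_; re; im; mk≈; re≈; im≈)
    open SetoidReasoning R.setoid

    c : R.Carrier → Q.Quad
    c a = a +√d R.0#

    times : ∀ q a → (q QR.* c a) QR.≈ ((re q R.* a) +√d (im q R.* a))
    times q a = mk≈
      (R.trans (R.+-congˡ (R.trans (R.*-congˡ (R.zeroʳ _)) (R.zeroʳ d))) (R.+-identityʳ _))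
      (R.trans (R.+-congʳ (R.zeroʳ _)) (R.+-identityˡ _))

    c^ : ∀ n → (c R.π QR.^ n) QR.≈ c (R.π R.^ n)
    c^ zero = QR.refl
    c^ (suc n) = QR.trans (QR.*-congˡ (c^ n)) (QR.trans (times (c R.π) (R.π R.^ n)) (mk≈ R.refl (R.zeroˡ _)))

    ∣-re : ∀ {a x} → c a QR.∣ x → a R.∣ re x
    ∣-re (q ,, eq) = re q , R.trans (R.sym (re≈ (times q _))) (re≈ eq)

    ∣-im : ∀ {a x} → c a QR.∣ x → a R.∣ im x
    ∣-im (q ,, eq) = im q , R.trans (R.sym (im≈ (times q _))) (im≈ eq)

    ∣-pair : ∀ {a x} → a R.∣ re x → a R.∣ im x → c a QR.∣ x
    ∣-pair (q , eq) (r , eq′) = (q +√d r) ,, QR.trans (times (q +√d r) _) (mk≈ eq eq′)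

    norm : Q.Quad → R.Carrier
    norm x = re x R.* re x R.+ d R.* (R.- im x R.* im x)

    norm∣1 : ∀ x → norm x R.∣ R.1# → x QR.∣ QR.1#
    norm∣1 x (n , eq) = (n R.* re x +√d n R.* (R.- im x)) ,, mk≈
      (R.trans (solve 5 (λ n a b b′ d → n :* a :* a :+ d :* (n :* b′ :* b) := n :* (a :* a :+ d :* (b′ :* b))) R.refl
                  n (re x) (im x) (R.- im x) d) eq)
      (begin
        n R.* re x R.* im x R.+ n R.* (R.- im x) R.* re x
          ≈⟨ solve 4 (λ n a b b′ → n :* a :* b :+ n :* b′ :* a := n :* a :* (b :+ b′)) R.refl n (re x) (im x) (R.- im x) ⟩
        n R.* re x R.* (im x R.+ R.- im x)  ≈⟨ R.*-congˡ (R.-‿inverseʳ _) ⟩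
        n R.* re x R.* R.0#                 ≈⟨ R.zeroʳ _ ⟩
        R.0#                                ∎)
      where open SemiringSolver R.commutativeSemiring using (solve; _:=_; _:+_; _:*_)

  quadraticDVR : DVR
  quadraticDVR = record
    { commutativeRing = Q.commutativeRing
    ; π = c R.π
    ; π-cancel = λ x y eq → let eq′ = QR.trans (QR.sym (times x R.π)) (QR.trans eq (times y R.π)) in
        mk≈ (R.π-cancel _ _ (re≈ eq′)) (R.π-cancel _ _ (im≈ eq′))
    ; π∣? = λ x → map′ (λ (h , k) → ∣-pair h k) (λ h → ∣-re h , ∣-im h) (R.π∣? (re x) ×-dec R.π∣? (im x))
    ; π∤1 = λ h → R.π∤1 (∣-re h)
    ; π∤⇒unit = λ x h → norm∣1 x (R.π∤⇒unit (norm x) λ k →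
        let (a , b) = inert (re x) (im x) k in h (∣-pair a b))
    ; separated = λ x h → let h′ = λ n → ∣ʳ-respˡ-≈ (c^ n) (h n) in
        mk≈ (R.separated _ (λ n → ∣-re (h′ n))) (R.separated _ (λ n → ∣-im (h′ n))) }
    where open MagmaDivisibility (CommutativeRing.*-magma Q.commutativeRing) using (∣ʳ-respˡ-≈)

  π∣⇒π∣re : ∀ {x} → let open DVR quadraticDVR in π ∣ x → R.π R.∣ QuadraticExtension.re x
  π∣⇒π∣re = ∣-re

module PAdic (p : ℕ) (p-prime : Prime p) (p≥3 : 3 ℕ.≤ p) where

  open ≡ using (cong; cong₂; module ≡-Reasoning)
  private
    module Integers where
      open import Data.Integer.Base public using (_+_; _*_; _-_; -_; _^_; 0ℤ; 1ℤ)
      open import Data.Integer.Divisibility.Signed public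
    open Integers

  P : ℤ
  P = + p

  instance
    P-nonZero : ℤ.NonZero P
    P-nonZero = prime⇒nonZero p-prime

  ∣-subst : ∀ {d a b} → a ≡ b → d ∣ a → d ∣ b
  ∣-subst ≡.refl d∣a = d∣a

  P^-down : ∀ n {a} → P ^ suc n ∣ a → P ^ n ∣ a
  P^-down n d = ∣-trans (∣n⇒∣m*n P ∣-refl) d

  P^1 : ∀ {a} → P ∣ a → P ^ 1 ∣ a
  P^1 = ∣-trans (∣-reflexive (ℤProps.*-identityʳ P))

  P^⇒P : ∀ n {a} → P ^ suc n ∣ a → P ∣ a
  P^⇒P n d = ∣-trans (∣m⇒∣m*n (P ^ n) ∣-refl) d

  -- the error term gains a factor of p at each step of an iteration
  raise : ∀ n {a b} → P ∣ a → P ^ suc n ∣ b → P ^ suc (suc n) ∣ a * b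
  raise n {a} d e = ∣-trans (*-monoˡ-∣ (P ^ suc n) d) (*-monoʳ-∣ a e)

  P-split : ∀ a b → P ∣ a * b → P ∣ a ⊎ P ∣ b
  P-split a b d with euclidsLemma ℤ.∣ a ∣ ℤ.∣ b ∣ p-prime (≡.subst (p ℕ∣.∣_) (ℤProps.abs-* a b) (∣⇒∣ᵤ d))
  ... | inj₁ e = inj₁ (∣ᵤ⇒∣ e)
  ... | inj₂ e = inj₂ (∣ᵤ⇒∣ e)

  P∤small : ∀ n → .{{ℕ.NonZero n}} → n ℕ.< p → ¬ (P ∣ + n)
  P∤small n n<p d = ℕₚ.<⇒≱ n<p (ℕ∣.∣⇒≤ (∣⇒∣ᵤ d))

  ∤⇒coprime : ∀ n → ¬ (p ℕ∣.∣ n) → ∀ {i} → i ℕ∣.∣ p → i ℕ∣.∣ n → i ≡ 1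
  ∤⇒coprime n p∤n i∣p i∣n with prime⇒irreducible p-prime i∣p
  ... | inj₁ i≡1 = i≡1
  ... | inj₂ ≡.refl = ⊥-elim (p∤n i∣n)

  inverse-abs : ∀ n → ¬ (p ℕ∣.∣ n) → ∃ λ v → P ∣ 1ℤ - + n * v
  inverse-abs n p∤n with coprime-Bézout {p} {n} (λ (i∣p , i∣n) → ∤⇒coprime n p∤n i∣p i∣n)
  ... | Bézout.+- x y eq = - + y , divides (+ x) (begin
    1ℤ - + n * (- + y)     ≡⟨ lemma (+ n) (+ y) ⟩
    1ℤ + + y * + n         ≡⟨ cong (λ z → 1ℤ + z) (ℤProps.pos-* y n) ⟨
    + (1 ℕ.+ y ℕ.* n)      ≡⟨ cong (λ z → + z) eq ⟩
    + (x ℕ.* p)            ≡⟨ ℤProps.pos-* x p ⟩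
    + x * P                ∎)
    where
    open ≡-Reasoning
    lemma : ∀ n y → 1ℤ - n * (- y) ≡ 1ℤ + y * n
    lemma = solve-∀
  ... | Bézout.-+ x y eq = + y , divides (- + x) (begin
    1ℤ - + n * + y             ≡⟨ cong (λ z → 1ℤ - z) (ℤProps.*-comm (+ n) (+ y)) ⟩
    1ℤ - + y * + n             ≡⟨ cong (λ z → 1ℤ - z) (ℤProps.pos-* y n) ⟨
    1ℤ - + (y ℕ.* n)           ≡⟨ cong (λ z → 1ℤ - + z) eq ⟨
    1ℤ - (1ℤ + + (x ℕ.* p))    ≡⟨ cong (λ z → 1ℤ - (1ℤ + z)) (ℤProps.pos-* x p) ⟩
    1ℤ - (1ℤ + + x * P)        ≡⟨ lemma (+ x) P ⟩
    - + x * P                  ∎)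
    where
    open ≡-Reasoning
    lemma : ∀ x p → 1ℤ - (1ℤ + x * p) ≡ - x * p
    lemma = solve-∀

  inverse-mod : ∀ a → ¬ (P ∣ a) → ∃ λ v → P ∣ 1ℤ - a * v
  inverse-mod (+ n) P∤a = inverse-abs n λ d → P∤a (∣ᵤ⇒∣ d)
  inverse-mod -[1+ n ] P∤a with inverse-abs (suc n) (λ d → P∤a (∣ᵤ⇒∣ d))
  ... | v , d = - v , ∣-subst (cong (λ z → 1ℤ - z) (lemma (+ suc n) v)) d
    where
    lemma : ∀ a v → a * v ≡ - a * (- v)
    lemma = solve-∀

  -- A p-adic integer is a coherent sequence of residues; residues are
  -- represented by integers and compared modulo pⁿ.
  record PAdicInteger : Set where
    field
      residue  : ℕ → ℤ
      coherent : ∀ n → P ^ n ∣ residue (suc n) - residue n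
  open PAdicInteger

  record _≋_ (x y : PAdicInteger) : Set where
    constructor congruent
    field
      congruence : ∀ n → P ^ n ∣ residue x n - residue y n
  open _≋_

  addℤ mulℤ : PAdicInteger → PAdicInteger → PAdicInteger
  addℤ x y = record
    { residue = λ n → residue x n + residue y n
    ; coherent = λ n → ∣-subst (lemma (residue x (suc n)) (residue x n) (residue y (suc n)) (residue y n))
        (∣m∣n⇒∣m+n (coherent x n) (coherent y n)) }
    where
    lemma : ∀ a b c d → (a - b) + (c - d) ≡ a + c - (b + d)
    lemma = solve-∀

  mul-lemma : ∀ a b c d → (a - b) * c + b * (c - d) ≡ a * c - b * d
  mul-lemma = solve-∀

  ∣-mul : ∀ {m a b c d} → m ∣ a - b → m ∣ c - d → m ∣ a * c - b * d
  ∣-mul {m} {a} {b} {c} {d} e f =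
    ∣-subst (mul-lemma a b c d) (∣m∣n⇒∣m+n (∣m⇒∣m*n c e) (∣n⇒∣m*n b f))

  mulℤ x y = record
    { residue = λ n → residue x n * residue y n
    ; coherent = λ n → ∣-mul {a = residue x (suc n)} {residue x n} {residue y (suc n)} (coherent x n) (coherent y n) }

  neg-lemma : ∀ a b → - (a - b) ≡ - a - (- b)
  neg-lemma = solve-∀

  negℤ : PAdicInteger → PAdicInteger
  negℤ x = record
    { residue = λ n → - residue x n
    ; coherent = λ n → ∣-subst (neg-lemma (residue x (suc n)) (residue x n)) (∣m⇒∣-m (coherent x n)) }

  self : ∀ {d a b} → a ≡ b → d ∣ a - b
  self {d} {a} ≡.refl = ∣-subst (≡.sym (ℤProps.+-inverseʳ a)) (divides 0ℤ ≡.refl)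

  constant : ℤ → PAdicInteger
  constant a = record { residue = λ _ → a ; coherent = λ n → self {P ^ n} {a} ≡.refl }

  pointwise : ∀ {x y} → (∀ n → residue x n ≡ residue y n) → x ≋ y
  pointwise eq = congruent λ n → self {P ^ n} (eq n)

  ≈-sym : ∀ {x y} → x ≋ y → y ≋ x
  ≈-sym {x} {y} (congruent h) = congruent λ n → ∣-subst (lemma (residue x n) (residue y n)) (∣m⇒∣-m (h n))
    where
    lemma : ∀ a b → - (a - b) ≡ b - a
    lemma = solve-∀

  ≈-trans : ∀ {x y z} → x ≋ y → y ≋ z → x ≋ z
  ≈-trans {x} {y} {z} (congruent h) (congruent k) = congruent λ n →
    ∣-subst (lemma (residue x n) (residue y n) (residue z n)) (∣m∣n⇒∣m+n (h n) (k n))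
    where
    lemma : ∀ a b c → a - b + (b - c) ≡ a - c
    lemma = solve-∀

  add-cong : ∀ {x y u v} → x ≋ y → u ≋ v → addℤ x u ≋ addℤ y v
  add-cong {x} {y} {u} {v} (congruent h) (congruent k) = congruent λ n →
    ∣-subst (lemma (residue x n) (residue y n) (residue u n) (residue v n)) (∣m∣n⇒∣m+n (h n) (k n))
    where
    lemma : ∀ a b c d → (a - b) + (c - d) ≡ a + c - (b + d)
    lemma = solve-∀

  ℤₚ-ring : CommutativeRing 0ℓ 0ℓ
  ℤₚ-ring = record
    { Carrier = PAdicInteger ; _≈_ = _≋_ ; _+_ = addℤ ; _*_ = mulℤ ; -_ = negℤ ; 0# = constant 0ℤ ; 1# = constant 1ℤ
    ; isCommutativeRing = record
      { isRing = record
        { +-isAbelianGroup = record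
          { isGroup = record
            { isMonoid = record
              { isSemigroup = record
                { isMagma = record
                  { isEquivalence = record { refl = pointwise λ _ → ≡.refl ; sym = ≈-sym ; trans = ≈-trans }
                  ; ∙-cong = add-cong }
                ; assoc = λ x y z → pointwise λ n → ℤProps.+-assoc (residue x n) (residue y n) (residue z n) }
              ; identity = (λ x → pointwise λ n → ℤProps.+-identityˡ (residue x n))
                         , (λ x → pointwise λ n → ℤProps.+-identityʳ (residue x n)) }
            ; inverse = (λ x → pointwise λ n → ℤProps.+-inverseˡ (residue x n))
                      , (λ x → pointwise λ n → ℤProps.+-inverseʳ (residue x n))
            ; ⁻¹-cong = λ {x} {y} (congruent h) → congruent λ n →
                ∣-subst (neg-lemma (residue x n) (residue y n)) (∣m⇒∣-m (h n)) }
          ; comm = λ x y → pointwise λ n → ℤProps.+-comm (residue x n) (residue y n) }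
        ; *-cong = λ {x} {y} {u} {v} (congruent h) (congruent k) → congruent λ n →
            ∣-mul {a = residue x n} {residue y n} {residue u n} (h n) (k n)
        ; *-assoc = λ x y z → pointwise λ n → ℤProps.*-assoc (residue x n) (residue y n) (residue z n)
        ; *-identity = (λ x → pointwise λ n → ℤProps.*-identityˡ (residue x n))
                     , (λ x → pointwise λ n → ℤProps.*-identityʳ (residue x n))
        ; distrib = (λ x y z → pointwise λ n → ℤProps.*-distribˡ-+ (residue x n) (residue y n) (residue z n))
                  , (λ x y z → pointwise λ n → ℤProps.*-distribʳ-+ (residue x n) (residue y n) (residue z n)) }
      ; *-comm = λ x y → pointwise λ n → ℤProps.*-comm (residue x n) (residue y n) } }

  module Z where
    open CommutativeRing ℤₚ-ring public
    open Exp semiring public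
    open RawSemiringDefs (Semiring.rawSemiring semiring) public using (_∣_)
  open RawMagmaDefs (CommutativeRing.*-rawMagma ℤₚ-ring) using (_,_)

  ϖ : PAdicInteger
  ϖ = constant P

  ϖ^ : ∀ n k → residue (ϖ Z.^ n) k ≡ P ^ n
  ϖ^ zero k = ≡.refl
  ϖ^ (suc n) k = cong (P *_) (ϖ^ n k)

  -- all residues from the first on agree modulo p
  mod-p : ∀ x n → P ∣ residue x (suc n) - residue x 1
  mod-p x zero = self {P} {residue x 1} ≡.refl
  mod-p x (suc n) = ∣-subst (lemma (residue x (suc (suc n))) (residue x (suc n)) (residue x 1))
    (∣m∣n⇒∣m+n (P^⇒P n (coherent x (suc n))) (mod-p x n))
    where
    lemma : ∀ a b c → a - b + (b - c) ≡ a - c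
    lemma = solve-∀

  cancel-sub : ∀ {d a b} → d ∣ a - b → d ∣ b → d ∣ a
  cancel-sub {d} {a} {b} e f = ∣-subst (lemma a b) (∣m∣n⇒∣m+n e f)
    where
    lemma : ∀ a b → a - b + b ≡ a
    lemma = solve-∀

  cancel-sub′ : ∀ {d a b} → d ∣ a - b → d ∣ a → d ∣ b
  cancel-sub′ {d} {a} {b} e f = ∣-subst (lemma a b) (∣m∣n⇒∣m-n f e)
    where
    lemma : ∀ a b → a - (a - b) ≡ b
    lemma = solve-∀

  ϖ∣⇒P∣ : ∀ {x} → ϖ Z.∣ x → P ∣ residue x 1
  ϖ∣⇒P∣ {x} (q , congruent eq) = cancel-sub′ (P^⇒P 0 (eq 1)) (divides (residue q 1) ≡.refl)

  P∣⇒ϖ∣ : ∀ {x} → P ∣ residue x 1 → ϖ Z.∣ x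
  P∣⇒ϖ∣ {x} d = quot , congruent λ n →
    ∣-subst (cong (_- residue x n) (_∣_.equality (P∣x n))) (coherent x n)
    where
    P∣x : ∀ n → P ∣ residue x (suc n)
    P∣x n = cancel-sub (mod-p x n) d
    q : ℕ → ℤ
    q n = _∣_.quotient (P∣x n)
    quot : PAdicInteger
    quot = record
      { residue = q
      ; coherent = λ n → *-cancelˡ-∣ P (∣-subst (begin
          residue x (suc (suc n)) - residue x (suc n)
            ≡⟨ cong₂ _-_ (_∣_.equality (P∣x (suc n))) (_∣_.equality (P∣x n)) ⟩
          q (suc n) * P - q n * P
            ≡⟨ factor (q (suc n)) (q n) P ⟩
          P * (q (suc n) - q n) ∎) (coherent x (suc n))) }
      where
      open ≡-Reasoning
      factor : ∀ a b p → a * p - b * p ≡ p * (a - b)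
      factor = solve-∀

  invert : ∀ x → ¬ (P ∣ residue x 1) → x Z.∣ Z.1#
  invert x P∤x = y , congruent λ n → ∣-subst (begin
      - (1ℤ - residue x (suc n) * v n) - (residue x (suc n) - residue x n) * v n
        ≡⟨ lemma (residue x (suc n)) (residue x n) (v n) ⟩
      v n * residue x n - 1ℤ ∎)
    (∣m∣n⇒∣m-n (∣m⇒∣-m (P^-down n (proj₂ (approx n)))) (∣m⇒∣m*n (v n) (coherent x n)))
    where
    open ≡-Reasoning
    lemma : ∀ a b v → - (1ℤ - a * v) - (a - b) * v ≡ v * b - 1ℤ
    lemma = solve-∀
    lemma₂ : ∀ w x v → (1ℤ - w * v) - (x - w) * v ≡ 1ℤ - x * v
    lemma₂ = solve-∀
    lemma₃ : ∀ x v → (1ℤ - x * v) * (1ℤ - x * v) ≡ 1ℤ - x * (v + v * (1ℤ - x * v))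
    lemma₃ = solve-∀
    lemma₄ : ∀ v e → v * e ≡ v + v * e - v
    lemma₄ = solve-∀
    next : ∀ n v → P ^ suc n ∣ 1ℤ - residue x (suc n) * v → P ^ suc n ∣ 1ℤ - residue x (suc (suc n)) * v
    next n v d = ∣-subst (lemma₂ (residue x (suc n)) (residue x (suc (suc n))) v)
      (∣m∣n⇒∣m-n d (∣m⇒∣m*n v (coherent x (suc n))))
    approx : ∀ n → ∃ λ v → P ^ suc n ∣ 1ℤ - residue x (suc n) * v
    approx zero with inverse-mod (residue x 1) P∤x
    ... | v , d = v , P^1 d
    approx (suc n) with approx n
    ... | v , d = v + v * (1ℤ - residue x (suc (suc n)) * v)
                , ∣-subst (lemma₃ (residue x (suc (suc n))) v) (raise n (P^⇒P n (next n v d)) (next n v d))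
    v : ℕ → ℤ
    v n = proj₁ (approx n)
    y : PAdicInteger
    y = record
      { residue = v
      ; coherent = λ n → ∣-subst (lemma₄ (v n) (1ℤ - residue x (suc (suc n)) * v n))
          (∣n⇒∣m*n (v n) (P^-down n (next n (v n) (proj₂ (approx n))))) }

  P∤2 : ¬ (P ∣ + 2)
  P∤2 = P∤small 2 p≥3

  P∤1 : ¬ (P ∣ 1ℤ)
  P∤1 = P∤small 1 (ℕₚ.<-trans (ℕ.s≤s (ℕ.s≤s ℕ.z≤n)) p≥3)

  ℤₚ : DVR
  ℤₚ = record
    { commutativeRing = ℤₚ-ring
    ; π = ϖ
    ; π-cancel = λ x y (congruent eq) → congruent λ n → cancel x y n (eq (suc n))
    ; π∣? = λ x → map′ P∣⇒ϖ∣ ϖ∣⇒P∣ (P ∣? residue x 1)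
    ; π∤1 = λ d → P∤1 (ϖ∣⇒P∣ d)
    ; π∤⇒unit = λ x ϖ∤x → invert x λ d → ϖ∤x (P∣⇒ϖ∣ d)
    ; separated = λ x h → congruent λ n → separate x n (h n) }
    where
    cancel : ∀ x y n → P ^ suc n ∣ residue x (suc n) * P - residue y (suc n) * P → P ^ n ∣ residue x n - residue y n
    cancel x y n d = ∣-subst (lemma₂ (residue x (suc n)) (residue x n) (residue y (suc n)) (residue y n))
      (∣m∣n⇒∣m+n (∣m∣n⇒∣m-n (*-cancelˡ-∣ P (∣-subst (lemma₁ (residue x (suc n)) (residue y (suc n)) P) d)) (coherent x n))
                 (coherent y n))
      where
      lemma₁ : ∀ a b p → a * p - b * p ≡ p * (a - b)
      lemma₁ = solve-∀
      lemma₂ : ∀ a b c d → (a - c) - (a - b) + (c - d) ≡ b - d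
      lemma₂ = solve-∀
    separate : ∀ x n → ϖ Z.^ n Z.∣ x → P ^ n ∣ residue x n - 0ℤ
    separate x n (q , congruent eq) = ∣-subst (≡.sym (ℤProps.+-identityʳ (residue x n)))
      (cancel-sub′ (eq n) (divides (residue q n) (cong (residue q n *_) (ϖ^ n n))))

  NonSquare : PAdicInteger → Set
  NonSquare d = ¬ ∃ λ y → (y Z.* y) ≋ d

  hensel : ∀ d z → ¬ (P ∣ residue d 1) → P ∣ z * z - residue d 1 → ∃ λ y → (y Z.* y) ≋ d
  hensel d z₀ P∤d P∣z₀²-d = y , congruent λ n → ∣-subst (lemma₃ (z n * z n) (D (suc n)) (D n))
    (∣m∣n⇒∣m+n (P^-down n (proj₁ (proj₂ (approx n)))) (coherent d n))
    where
    D : ℕ → ℤ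
    D = residue d
    lemma₁ : ∀ z d v → (1ℤ - + 2 * z * v) * (z * z - d) + v * v * ((z * z - d) * (z * z - d))
                       ≡ (z - (z * z - d) * v) * (z - (z * z - d) * v) - d
    lemma₁ = solve-∀
    lemma₂ : ∀ z e v → (1ℤ - + 2 * z * v) + + 2 * v * v * e ≡ 1ℤ - + 2 * (z - e * v) * v
    lemma₂ = solve-∀
    lemma₃ : ∀ s d′ d → (s - d′) + (d′ - d) ≡ s - d
    lemma₃ = solve-∀
    lemma₄ : ∀ z e v → - v * e ≡ (z - e * v) - z
    lemma₄ = solve-∀
    lemma₅ : ∀ s d′ d → (s - d) - (d′ - d) ≡ s - d′
    lemma₅ = solve-∀
    P∤z₀ : ¬ (P ∣ z₀)
    P∤z₀ P∣z₀ = P∤d (cancel-sub′ P∣z₀²-d (∣n⇒∣m*n z₀ P∣z₀))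
    P∤2z₀ : ¬ (P ∣ + 2 * z₀)
    P∤2z₀ P∣2z₀ with P-split (+ 2) z₀ P∣2z₀
    ... | inj₁ P∣2 = P∤2 P∣2
    ... | inj₂ P∣z₀ = P∤z₀ P∣z₀
    v : ℤ
    v = proj₁ (inverse-mod (+ 2 * z₀) P∤2z₀)
    error : ∀ n z → P ^ suc n ∣ z * z - D (suc n) → P ^ suc n ∣ z * z - D (suc (suc n))
    error n z e = ∣-subst (lemma₅ (z * z) (D (suc (suc n))) (D (suc n))) (∣m∣n⇒∣m-n e (coherent d (suc n)))
    approx : ∀ n → ∃ λ z → P ^ suc n ∣ z * z - D (suc n) × P ∣ 1ℤ - + 2 * z * v
    approx zero = z₀ , P^1 P∣z₀²-d , proj₂ (inverse-mod (+ 2 * z₀) P∤2z₀)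
    approx (suc n) with approx n
    ... | z , e , h = z - (z * z - D (suc (suc n))) * v
                    , ∣-subst (lemma₁ z (D (suc (suc n))) v)
                        (∣m∣n⇒∣m+n (raise n h e′) (∣n⇒∣m*n (v * v) (raise n (P^⇒P n e′) e′)))
                    , ∣-subst (lemma₂ z (z * z - D (suc (suc n))) v)
                        (∣m∣n⇒∣m+n h (∣n⇒∣m*n (+ 2 * v * v) (P^⇒P n e′)))
      where
      e′ : P ^ suc n ∣ z * z - D (suc (suc n))
      e′ = error n z e
    z : ℕ → ℤ
    z n = proj₁ (approx n)
    y : PAdicInteger
    y = record
      { residue = z
      ; coherent = λ n → ∣-subst (lemma₄ (z n) (z n * z n - D (suc (suc n))) v)
          (∣n⇒∣m*n (- v) (P^-down n (error n (z n) (proj₁ (proj₂ (approx n)))))) }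

  norm-mod-p : ∀ d → d Z.∣ Z.1# → NonSquare d → ∀ x y → P ∣ x * x + residue d 1 * (- y * y) → P ∣ x × P ∣ y
  norm-mod-p d (d⁻¹ , congruent eq) nonSquare x y P∣N with P ∣? y
  ... | yes P∣y = P∣x , P∣y
    where
    P∣x : P ∣ x
    P∣x with P-split x x (∣m+n∣n⇒∣m P∣N (∣n⇒∣m*n (residue d 1) (∣n⇒∣m*n (- y) P∣y)))
    ... | inj₁ h = h
    ... | inj₂ h = h
  ... | no P∤y = ⊥-elim (nonSquare (hensel d (x * v) P∤d (∣-subst (lemma x y (residue d 1) v)
          (∣m∣n⇒∣m-n (∣n⇒∣m*n (v * v) P∣N) (∣n⇒∣m*n (residue d 1 * (1ℤ + y * v)) P∣1-yv)))))
    where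
    v : ℤ
    v = proj₁ (inverse-mod y P∤y)
    P∣1-yv : P ∣ 1ℤ - y * v
    P∣1-yv = proj₂ (inverse-mod y P∤y)
    lemma : ∀ x y d v → v * v * (x * x + d * (- y * y)) - d * (1ℤ + y * v) * (1ℤ - y * v) ≡ x * v * (x * v) - d
    lemma = solve-∀
    P∤d : ¬ (P ∣ residue d 1)
    P∤d P∣d = P∤1 (cancel-sub′ (P^⇒P 0 (eq 1)) (∣n⇒∣m*n (residue d⁻¹ 1) P∣d))

  inert : ∀ d → d Z.∣ Z.1# → NonSquare d → Inert ℤₚ d
  inert d d-unit d-nonSquare x y h =
    let (k , l) = norm-mod-p d d-unit d-nonSquare (residue x 1) (residue y 1) (ϖ∣⇒P∣ h) in P∣⇒ϖ∣ k , P∣⇒ϖ∣ l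

  ℤₚ[√_] : ∀ d → d Z.∣ Z.1# → NonSquare d → DVR
  ℤₚ[√ d ] d-unit d-nonSquare = quadraticDVR ℤₚ d (inert d d-unit d-nonSquare)

  -- ℚₚ, or the unramified quadratic extension ℚₚ(√d) with d a non-square
  -- unit, given through the rings of integers ℤₚ and ℤₚ[√d].  Both have
  -- uniformizer p, so ν on ℚₚ(√d) extends ν on ℚₚ.
  data Ambient : Set where
    base      : Ambient
    quadratic : ∀ d → d Z.∣ Z.1# → NonSquare d → Ambient

  integers : Ambient → DVR
  integers base = ℤₚ
  integers (quadratic d d-unit d-nonSquare) = ℤₚ[√ d ] d-unit d-nonSquare

  module ℚₚ = ValuedField ℤₚ

  p^_ : ℤ → ℚ
  p^ (+ n)    = + (p ℕ.^ n) ℚ./ 1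
  p^ -[1+ n ] = (1ℤ ℚ./ (p ℕ.^ suc n)) {{ℕₚ.m^n≢0 p (suc n) {{prime⇒nonZero p-prime}}}}

  module Field (A : Ambient) where
    open ValuedField (integers A) public

    embedℤ : ∀ A → PAdicInteger → DVR.Carrier (integers A)
    embedℤ base x = x
    embedℤ (quadratic _ _ _) x = x QuadraticExtension.+√d Z.0#

    π∤2 : ∀ A → let module O = DVR (integers A) in ¬ (O.π O.∣ O.1# O.+ O.1#)
    π∤2 base h = P∤2 (ϖ∣⇒P∣ h)
    π∤2 (quadratic d d-unit d-nonSquare) h =
      P∤2 (ϖ∣⇒P∣ (π∣⇒π∣re ℤₚ d (inert d d-unit d-nonSquare) h))

    ι : ℚₚ.Frac → Frac
    ι (a /π^ e) = embedℤ A a /π^ e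

    2≠0 : 2# # 0#
    2≠0 = 2#0 (π∤2 A)

    ∣_∣⟨_⟩ : ∀ x → x # 0# → ℚ
    ∣ x ∣⟨ x#0 ⟩ = p^ (ℤ.- ν x x#0)

{-# OPTIONS --safe #-}

-- The ratios are aₙ₊₁/aₙ = λ₁ (t + uⁿ⁺¹)/(t + uⁿ), a Möbius function of uⁿ.  A
-- difference of two values of a Möbius function is a product, so within a class
-- n = i + l j, where the denominators have constant valuation, the ratios have
-- differences of valuation const + ν(uˡ⁽ʲ⁻ʲ′⁾ − 1) = const + k + νₚ(j − j′).  As
-- the aₙ lie in ℚₚ, whose residue field has only p elements, the pigeonhole
-- principle then shows that the class fills a whole ball of ℚₚ; this needs no
-- description of Λ, and treats ℚₚ and ℚₚ(√d) alike.
--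
-- In a class with t + uⁱ ≡ 0 mod pᵏ the denominators vary.  There the same
-- argument applies to aₙ/(aₙ₊₁ − h aₙ) with h = (λ₁ + λ₂)/2 and shows that these
-- fill a ball around 0, so that aₙ₊₁/aₙ fills the outside of a ball around h.
-- It follows that −t ∈ Λ if and only if there is such a class.

module Submission where

open import Defs
open import Data.Integer.Base as ℤ using (+_)
open import Data.Nat.Base as ℕ using (ℕ; suc; _≤_; _<_)
open import Data.Nat.Primality using (Prime)
open import Data.Product using (Σ; ∃; ∃!; _×_; _,_)
open import Data.Rational.Base as ℚ using (0ℚ)
open import Relation.Binary.PropositionalEquality using (_≡_; _≢_)
open import Relation.Unary using (_∈_; _∉_; _≐_; _∪_; _⊥_; ⋃; ∁)

open import Algebra.Bundles using (CommutativeRing; RawRing; Semiring)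
import Algebra.Definitions.RawMagma as RawMagmaDefs
import Algebra.Properties.CommutativeSemiring.Exp as CommutativeExp
import Algebra.Properties.Ring as RingProperties
import Algebra.Properties.Semiring.Exp as Exp
import Algebra.Properties.Semiring.Mult as UnoptimisedMult
import Algebra.Properties.Semiring.Mult.TCOptimised as Mult
import Algebra.Solver.Ring as RingSolver
open import Algebra.Solver.Ring.AlmostCommutativeRing using (_-Raw-AlmostCommutative⟶_; fromCommutativeRing)
import Algebra.Solver.Ring.NaturalCoefficients.Default as SemiringSolver
open import Data.Empty using (⊥-elim)
open import Data.Fin.Base as Fin using (Fin)
import Data.Fin.Properties as Finₚ
open import Data.Integer.Base using (ℤ; -[1+_])
open import Data.Integer.Divisibility.Signed as ℤ∣ using (divides)
import Data.Integer.DivMod as ℤDivMod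
import Data.Integer.Properties as ℤProps
open import Data.Integer.Tactic.RingSolver using (solve-∀)
open import Data.Maybe.Base using (Maybe; just; nothing)
open import Data.Nat.Base using (zero)
open import Data.Nat.Coprimality using (coprime-Bézout)
import Data.Nat.Divisibility as ℕ∣
import Data.Nat.DivMod as ℕDivMod
open import Data.Nat.GCD using (module Bézout)
open import Data.Nat.Primality using (euclidsLemma; prime⇒nonZero)
import Data.Nat.Properties as ℕₚ
import Data.Nat.Tactic.RingSolver as ℕSolver
open import Data.Product using (proj₁; proj₂)
import Data.Sign.Base as Sign
open import Data.Sum.Base using (_⊎_; inj₁; inj₂)
open import Level using (0ℓ)
open import Relation.Binary.Definitions using (tri<; tri≈; tri>)
import Relation.Binary.PropositionalEquality as ≡
import Relation.Binary.Reasoning.Setoid as SetoidReasoning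
open import Relation.Nullary using (¬_; yes; no)

-- The Möbius function w ↦ λ₁ (t + u w)/(t + w) has its pole at w = -t and takes the value h at w =
-- t. In a class near the pole uⁿ is congruent to -t, so uⁿ - t is a unit because p is odd; hence
-- the valuation of aₙ₊₁ - h aₙ depends on n only through λ₁ⁿ. The point h lies in ℚₚ because 2h =
-- r, although t and the λᵢ need not lie there. Two fields are therefore kept apart: valuations are
-- computed in the field of the λᵢ and pulled back, while residues are counted in ℚₚ, since the
-- residue field of ℚₚ(√d) has p² elements, too many for the pigeonhole argument. Of the valuation
-- of uˡʲ - 1 two consequences are used: it is at least k, and if it is at least k + m, then pᵐ
-- divides j. Oddness of p enters here as well, through p dividing the binomial coefficient C(p, 2).
-- Equality in ℚₚ is not decidable, but divisibility by a fixed power of p is. So each t + uⁱ can be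
-- tested modulo pᵏ, and -t ∉ Λ, a mere negation, still yields an exact valuation for every t + uⁱ.

-- Ring solver with integer coefficients, which admits subtraction.

module IntegerCoefficients (R : CommutativeRing 0ℓ 0ℓ) where
  open CommutativeRing R
  open Mult semiring public using () renaming (_×_ to _·_)
  open Mult semiring using (1+×; ×-homo-+; ×1-homo-*)
  private
    open RingProperties ring using (-‿distribˡ-*; -‿distribʳ-*; -‿involutive; -‿+-comm; -0#≈0#)
    open SetoidReasoning setoid

    ⟦_⟧ : ℤ → Carrier
    ⟦ + n ⟧      = n · 1#
    ⟦ -[1+ n ] ⟧ = - (suc n · 1#)

    ⟦⊖⟧ : ∀ m n → ⟦ m ℤ.⊖ n ⟧ ≈ m · 1# - n · 1#
    ⟦⊖⟧ m zero = sym (trans (+-congˡ -0#≈0#) (+-identityʳ _))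
    ⟦⊖⟧ zero (suc n) = sym (+-identityˡ _)
    ⟦⊖⟧ (suc m) (suc n) = begin
      ⟦ suc m ℤ.⊖ suc n ⟧                      ≡⟨ ≡.cong ⟦_⟧ (ℤProps.[1+m]⊖[1+n]≡m⊖n m n) ⟩
      ⟦ m ℤ.⊖ n ⟧                              ≈⟨ ⟦⊖⟧ m n ⟩
      m · 1# - n · 1#                          ≈⟨ +-identityʳ _ ⟨
      m · 1# - n · 1# + 0#                     ≈⟨ +-congˡ (-‿inverseʳ 1#) ⟨
      m · 1# - n · 1# + (1# - 1#)              ≈⟨ solve 4 (λ a b c d → a :+ b :+ (c :+ d) := (c :+ a) :+ (d :+ b)) refl _ _ _ _ ⟩
      (1# + m · 1#) + (- 1# - n · 1#)          ≈⟨ +-cong (sym (1+× m 1#)) (-‿+-comm _ _) ⟩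
      suc m · 1# - (1# + n · 1#)               ≈⟨ +-congˡ (-‿cong (1+× n 1#)) ⟨
      suc m · 1# - suc n · 1#                  ∎
      where open SemiringSolver commutativeSemiring using (solve; _:=_; _:+_)

    +-homo : ∀ i j → ⟦ i ℤ.+ j ⟧ ≈ ⟦ i ⟧ + ⟦ j ⟧
    +-homo (+ m)    (+ n)    = ×-homo-+ 1# m n
    +-homo (+ m)    -[1+ n ] = ⟦⊖⟧ m (suc n)
    +-homo -[1+ m ] (+ n)    = trans (⟦⊖⟧ n (suc m)) (+-comm _ _)
    +-homo -[1+ m ] -[1+ n ] = begin
      - (suc (suc (m ℕ.+ n)) · 1#)     ≡⟨ ≡.cong (λ k → - (suc k · 1#)) (ℕₚ.+-suc m n) ⟨
      - ((suc m ℕ.+ suc n) · 1#)       ≈⟨ -‿cong (×-homo-+ 1# (suc m) (suc n)) ⟩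
      - (suc m · 1# + suc n · 1#)      ≈⟨ -‿+-comm _ _ ⟨
      - (suc m · 1#) - suc n · 1#      ∎

    ⟦-◃⟧ : ∀ n → ⟦ Sign.- ℤ.◃ n ⟧ ≈ - (n · 1#)
    ⟦-◃⟧ zero    = sym -0#≈0#
    ⟦-◃⟧ (suc n) = refl

    *-homo : ∀ i j → ⟦ i ℤ.* j ⟧ ≈ ⟦ i ⟧ * ⟦ j ⟧
    *-homo (+ m) (+ n) = begin
      ⟦ + m ℤ.* + n ⟧            ≡⟨ ≡.cong ⟦_⟧ (ℤProps.pos-* m n) ⟨
      (m ℕ.* n) · 1#             ≈⟨ ×1-homo-* m n ⟩
      (m · 1#) * (n · 1#)        ∎
    *-homo (+ m) -[1+ n ] = begin
      ⟦ Sign.- ℤ.◃ m ℕ.* suc n ⟧    ≈⟨ ⟦-◃⟧ (m ℕ.* suc n) ⟩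
      - ((m ℕ.* suc n) · 1#)        ≈⟨ -‿cong (×1-homo-* m (suc n)) ⟩
      - ((m · 1#) * (suc n · 1#))   ≈⟨ -‿distribʳ-* _ _ ⟩
      (m · 1#) * - (suc n · 1#)     ∎
    *-homo -[1+ m ] (+ n) = begin
      ⟦ Sign.- ℤ.◃ suc m ℕ.* n ⟧    ≈⟨ ⟦-◃⟧ (suc m ℕ.* n) ⟩
      - ((suc m ℕ.* n) · 1#)        ≈⟨ -‿cong (×1-homo-* (suc m) n) ⟩
      - ((suc m · 1#) * (n · 1#))   ≈⟨ -‿distribˡ-* _ _ ⟩
      - (suc m · 1#) * (n · 1#)     ∎
    *-homo -[1+ m ] -[1+ n ] = begin
      (suc m ℕ.* suc n) · 1#               ≈⟨ ×1-homo-* (suc m) (suc n) ⟩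
      (suc m · 1#) * (suc n · 1#)          ≈⟨ -‿involutive _ ⟨
      - - ((suc m · 1#) * (suc n · 1#))    ≈⟨ -‿cong (-‿distribˡ-* _ _) ⟩
      - (- (suc m · 1#) * (suc n · 1#))    ≈⟨ -‿distribʳ-* _ _ ⟩
      - (suc m · 1#) * - (suc n · 1#)      ∎

    -‿homo : ∀ i → ⟦ ℤ.- i ⟧ ≈ - ⟦ i ⟧
    -‿homo (+ zero)  = sym -0#≈0#
    -‿homo (+ suc n) = refl
    -‿homo -[1+ n ]  = sym (-‿involutive _)

    ℤ-rawRing : RawRing 0ℓ 0ℓ
    ℤ-rawRing = record
      { Carrier = ℤ ; _≈_ = _≡_ ; _+_ = ℤ._+_ ; _*_ = ℤ._*_ ; -_ = ℤ.-_ ; 0# = + 0 ; 1# = + 1 }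

    homomorphism : ℤ-rawRing -Raw-AlmostCommutative⟶ fromCommutativeRing R
    homomorphism = record
      { ⟦_⟧ = ⟦_⟧ ; +-homo = +-homo ; *-homo = *-homo ; -‿homo = -‿homo ; 0-homo = refl ; 1-homo = refl }

    _coeff≟_ : ∀ i j → Maybe (⟦ i ⟧ ≈ ⟦ j ⟧)
    i coeff≟ j with i ℤProps.≟ j
    ... | yes i≡j = just (reflexive (≡.cong ⟦_⟧ i≡j))
    ... | no  _   = nothing

  open RingSolver ℤ-rawRing (fromCommutativeRing R) homomorphism _coeff≟_ public
    using (solve; _:=_; _:+_; _:*_; _:-_; :-_; con)

-- Inequalities between integer exponents.

≤⇒+ : ∀ {m n} → m ℤ.≤ n → ∃ λ d → n ≡ m ℤ.+ + d
≤⇒+ {m} {n} m≤n = ℤ.∣ n ℤ.- m ∣ , (begin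
  n                       ≡⟨ cancel m n ⟨
  m ℤ.+ (n ℤ.- m)         ≡⟨ ≡.cong (λ d → m ℤ.+ d) (ℤProps.0≤i⇒+∣i∣≡i (ℤProps.i≤j⇒0≤j-i m≤n)) ⟨
  m ℤ.+ + ℤ.∣ n ℤ.- m ∣   ∎)
  where
  open ≡.≡-Reasoning
  cancel : ∀ m n → m ℤ.+ (n ℤ.- m) ≡ n
  cancel = solve-∀

-- Moving terms across an inequality becomes an identity between two differences, which `solve-∀`
-- can prove.
shift-≤ : ∀ {a b c d} → d ℤ.- c ≡ b ℤ.- a → c ℤ.≤ d → a ℤ.≤ b
shift-≤ eq c≤d = ℤProps.0≤i-j⇒j≤i (≡.subst (+ 0 ℤ.≤_) eq (ℤProps.i≤j⇒0≤j-i c≤d))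

<⇒+1≤ : ∀ {m n} → m ℤ.< n → m ℤ.+ + 1 ℤ.≤ n
<⇒+1≤ {m} m<n = ≡.subst (ℤ._≤ _) (ℤProps.+-comm (+ 1) m) (ℤProps.i<j⇒suc[i]≤j m<n)

≤+ : ∀ {m n} d → n ≡ m ℤ.+ + d → m ℤ.≤ n
≤+ d ≡.refl = ℤProps.i≤i+j _ (+ d)

i≤+∣i∣ : ∀ i → i ℤ.≤ + ℤ.∣ i ∣
i≤+∣i∣ (+ n)    = ℤProps.≤-refl
i≤+∣i∣ -[1+ n ] = ℤ.-≤+

-- Discretely valued fields.

-- The predicate is a parameter, so that exact valuations can be stated both within the fields of
-- `DiscretelyValuedField` and for fractions, before that record is assembled.
record Exactly {A : Set} (_∈π^_ : A → ℤ → Set) (x : A) (m : ℤ) : Set where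
  constructor exactly
  field
    ∼⇒∈ : x ∈π^ m
    ∼-∉ : ¬ (x ∈π^ (m ℤ.+ + 1))
open Exactly public

-- The valuation enters through the predicates ν(x) ≥ m, written x ∈π^ m, and
-- ν(x) = m, written x ∼π^ m, so that ν(0) = ∞ needs no separate treatment.
record DiscretelyValuedField : Set₁ where
  infix 4 _∈π^_ _∼π^_
  field
    commutativeRing : CommutativeRing 0ℓ 0ℓ
  open CommutativeRing commutativeRing public
  field
    _∈π^_    : Carrier → ℤ → Set
    ∈-resp-≈ : ∀ {x y m} → x ≈ y → x ∈π^ m → y ∈π^ m
    ∈-mono   : ∀ {x m n} → n ℤ.≤ m → x ∈π^ m → x ∈π^ n
    ∈-0      : ∀ {m} → 0# ∈π^ m
    ∈-+      : ∀ {x y m} → x ∈π^ m → y ∈π^ m → x + y ∈π^ m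
    ∈-neg    : ∀ {x m} → x ∈π^ m → - x ∈π^ m
    ∈-*      : ∀ {x y m n} → x ∈π^ m → y ∈π^ n → x * y ∈π^ m ℤ.+ n

  _∼π^_ : Carrier → ℤ → Set
  _∼π^_ = Exactly _∈π^_

  field
    ∼-1        : 1# ∼π^ + 0
    ∼-*        : ∀ {x y m n} → x ∼π^ m → y ∼π^ n → x * y ∼π^ m ℤ.+ n
    locate     : ∀ x m → x ∈π^ m ⊎ ∃ λ n → n ℤ.< m × x ∼π^ n
    invertible : ∀ {x m} → x ∼π^ m → ∃ λ y → y * x ≈ 1#

  open Exp semiring public using (_^_; ^-homo-*; ^-assocʳ; ^-congˡ; ^-congʳ)
  open IntegerCoefficients commutativeRing public using (solve; _:=_; _:+_; _:*_; _:-_; :-_; con)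

  ∈-cast : ∀ {x m n} → m ≡ n → x ∈π^ m → x ∈π^ n
  ∈-cast {x} = ≡.subst (x ∈π^_)

  ∈-weaken : ∀ {x m n} d → m ≡ n ℤ.+ + d → x ∈π^ m → x ∈π^ n
  ∈-weaken d eq = ∈-mono (≤+ d eq)

  ∈-sub : ∀ {x y m} → x ∈π^ m → y ∈π^ m → x - y ∈π^ m
  ∈-sub h k = ∈-+ h (∈-neg k)

  ∈-swap : ∀ {x y m} → x - y ∈π^ m → y - x ∈π^ m
  ∈-swap {x} {y} h = ∈-resp-≈ (solve 2 (λ x y → :- (x :- y) := y :- x) refl x y) (∈-neg h)

  ∈-trans : ∀ {x y z m} → x - y ∈π^ m → y - z ∈π^ m → x - z ∈π^ m
  ∈-trans {x} {y} {z} h k = ∈-resp-≈ (solve 3 (λ x y z → (x :- y) :+ (y :- z) := x :- z) refl x y z) (∈-+ h k)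

  ∈-near : ∀ {x y m} → x - y ∈π^ m → y ∈π^ m → x ∈π^ m
  ∈-near {x} {y} h k = ∈-resp-≈ (solve 2 (λ x y → (x :- y) :+ y := x) refl x y) (∈-+ h k)

  ∼-resp-≈ : ∀ {x y m} → x ≈ y → x ∼π^ m → y ∼π^ m
  ∼-resp-≈ x≈y (exactly h k) = exactly (∈-resp-≈ x≈y h) (λ y∈ → k (∈-resp-≈ (sym x≈y) y∈))

  ∼-cast : ∀ {x m n} → m ≡ n → x ∼π^ m → x ∼π^ n
  ∼-cast {x} = ≡.subst (x ∼π^_)

  -‿involutive : ∀ x → - - x ≈ x
  -‿involutive = solve 1 (λ x → :- :- x := x) refl

  ∼-neg : ∀ {x m} → x ∼π^ m → - x ∼π^ m
  ∼-neg {x} (exactly h k) = exactly (∈-neg h) (λ -x∈ → k (∈-resp-≈ (-‿involutive x) (∈-neg -x∈)))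

  ∼-^ : ∀ {x m} n → x ∼π^ m → x ^ n ∼π^ + n ℤ.* m
  ∼-^ {m = m} zero h = ∼-cast (≡.sym (ℤProps.*-zeroˡ m)) ∼-1
  ∼-^ {m = m} (suc n) h = ∼-cast (≡.sym (ℤProps.suc-* (+ n) m)) (∼-* h (∼-^ n h))

  ∼-^0 : ∀ {x} n → x ∼π^ + 0 → x ^ n ∼π^ + 0
  ∼-^0 n h = ∼-cast (ℤProps.*-zeroʳ (+ n)) (∼-^ n h)

  ∼⇒≤ : ∀ {x m n} → x ∼π^ m → x ∈π^ n → n ℤ.≤ m
  ∼⇒≤ {m = m} {n} h k with n ℤProps.≤? m
  ... | yes n≤m = n≤m
  ... | no  n≰m = ⊥-elim (∼-∉ h (∈-mono (<⇒+1≤ (ℤProps.≰⇒> n≰m)) k))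

  ∼-unique : ∀ {x m n} → x ∼π^ m → x ∼π^ n → m ≡ n
  ∼-unique h k = ℤProps.≤-antisym (∼⇒≤ k (∼⇒∈ h)) (∼⇒≤ h (∼⇒∈ k))

  ∼-+ : ∀ {x y m} → x ∼π^ m → y ∈π^ m ℤ.+ + 1 → x + y ∼π^ m
  ∼-+ {x} {y} {m} (exactly h k) y∈ = exactly (∈-+ h (∈-weaken 1 ≡.refl y∈))
    (λ x+y∈ → k (∈-resp-≈ (solve 2 (λ x y → x :+ y :- y := x) refl x y) (∈-sub x+y∈ y∈)))

  ∈-cancel : ∀ {x y m n} → x ∼π^ m → x * y ∈π^ m ℤ.+ n → y ∈π^ n
  ∈-cancel {x} {y} {m} {n} h k with locate y n
  ... | inj₁ y∈ = y∈
  ... | inj₂ (j , j<n , y∼j) = ⊥-elim (ℤProps.<⇒≱ j<n (shift-≤ (cancel m n j) (∼⇒≤ (∼-* h y∼j) k)))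
    where
    cancel : ∀ m n j → m ℤ.+ j ℤ.- (m ℤ.+ n) ≡ j ℤ.- n
    cancel = solve-∀

  ∼-cancel : ∀ {x y m n} → x ∼π^ m → x * y ∼π^ m ℤ.+ n → y ∼π^ n
  ∼-cancel {m = m} {n} h k = exactly (∈-cancel h (∼⇒∈ k))
    (λ y∈ → ∼-∉ k (∈-cast (≡.sym (ℤProps.+-assoc m n (+ 1))) (∈-* (∼⇒∈ h) y∈)))

  *-cancelˡ : ∀ {x y z m} → x ∼π^ m → x * y ≈ x * z → y ≈ z
  *-cancelˡ {x} {y} {z} h eq with invertible h
  ... | (x⁻¹ , inv) = trans (sym (*-identityˡ y)) (trans (*-congʳ (sym inv)) (trans (*-assoc x⁻¹ x y)
    (trans (*-congˡ eq) (trans (sym (*-assoc x⁻¹ x z)) (trans (*-congʳ inv) (*-identityˡ z))))))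

-- Lifting the exponent for odd p.

-- The binomial coefficient C(n, 2), by Pascal's rule, which matches the induction in `binomial`.
triangle : ℕ → ℕ
triangle zero    = 0
triangle (suc n) = n ℕ.+ triangle n

n+2*triangle : ∀ n → n ℕ.+ 2 ℕ.* triangle n ≡ n ℕ.* n
n+2*triangle zero    = ≡.refl
n+2*triangle (suc n) = ≡.trans (expand n (triangle n)) (≡.trans (≡.cong (ℕ._+ (n ℕ.+ suc n)) (n+2*triangle n)) (square n))
  where
  expand : ∀ n t → suc n ℕ.+ 2 ℕ.* (n ℕ.+ t) ≡ n ℕ.+ 2 ℕ.* t ℕ.+ (n ℕ.+ suc n)
  expand = ℕSolver.solve-∀
  square : ∀ n → n ℕ.* n ℕ.+ (n ℕ.+ suc n) ≡ suc n ℕ.* suc n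
  square = ℕSolver.solve-∀

-- Since p + 2 C(p, 2) = p², p divides 2 C(p, 2), and it does not divide 2.
p∣triangle : ∀ p → Prime p → 3 ℕ.≤ p → p ℕ∣.∣ triangle p
p∣triangle p p-prime p≥3 with euclidsLemma 2 (triangle p) p-prime
  (ℕ∣.∣m+n∣m⇒∣n (≡.subst (p ℕ∣.∣_) (≡.sym (n+2*triangle p)) (ℕ∣.m∣m*n p)) ℕ∣.∣-refl)
... | inj₁ p∣2 = ⊥-elim (ℕₚ.<⇒≱ p≥3 (ℕ∣.∣⇒≤ p∣2))
... | inj₂ d   = d

module LiftingTheExponent (V : DiscretelyValuedField) where
  open DiscretelyValuedField V
  open IntegerCoefficients commutativeRing using (_·_)
  open Mult semiring using (1+×; ×-homo-+; ×1-homo-*)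
  open SetoidReasoning setoid

  ·1∈ : ∀ n → n · 1# ∈π^ + 0
  ·1∈ zero    = ∈-0
  ·1∈ (suc n) = ∈-resp-≈ (sym (1+× n 1#)) (∈-+ (∼⇒∈ ∼-1) (·1∈ n))

  -- Second order would not be enough: for exponent p the term in x² needs the factor p of C(p, 2),
  -- so it has to be explicit. From x³ on, integrality of the remainder suffices.
  binomial : ∀ x → x ∈π^ + 0 → ∀ n →
    ∃ λ r → r ∈π^ + 0 × (1# + x) ^ n ≈ 1# + (n · 1#) * x + (triangle n · 1#) * (x * x) + x * x * x * r
  binomial x x∈ zero = 0# , ∈-0 , solve 1 (λ x → con (+ 1) :=
    con (+ 1) :+ con (+ 0) :* x :+ con (+ 0) :* (x :* x) :+ x :* x :* x :* con (+ 0)) refl x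
  binomial x x∈ (suc n) with binomial x x∈ n
  ... | r , r∈ , eq = triangle n · 1# + r + x * r , ∈-+ (∈-+ (·1∈ (triangle n)) r∈) (∈-* x∈ r∈) , (begin
    (1# + x) * (1# + x) ^ n
      ≈⟨ *-congˡ eq ⟩
    (1# + x) * (1# + (n · 1#) * x + (triangle n · 1#) * (x * x) + x * x * x * r)
      ≈⟨ solve 4 (λ x n t r → (con (+ 1) :+ x) :* (con (+ 1) :+ n :* x :+ t :* (x :* x) :+ x :* x :* x :* r)
           := con (+ 1) :+ (con (+ 1) :+ n) :* x :+ (n :+ t) :* (x :* x) :+ x :* x :* x :* (t :+ r :+ x :* r)) refl
           x (n · 1#) (triangle n · 1#) r ⟩
    1# + (1# + n · 1#) * x + (n · 1# + triangle n · 1#) * (x * x) + x * x * x * (triangle n · 1# + r + x * r)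
      ≈⟨ +-congʳ (+-cong (+-congˡ (*-congʳ (1+× n 1#))) (*-congʳ (×-homo-+ 1# n (triangle n)))) ⟨
    1# + (suc n · 1#) * x + (triangle (suc n) · 1#) * (x * x) + x * x * x * (triangle n · 1# + r + x * r) ∎)

  module _ (p : ℕ) (p-prime : Prime p) (p≥3 : 3 ℕ.≤ p) (p-uniformizer : p · 1# ∼π^ + 1) where

    ∣⇒·1∈ : ∀ {n} → p ℕ∣.∣ n → n · 1# ∈π^ + 1
    ∣⇒·1∈ (ℕ∣.divides q ≡.refl) = ∈-resp-≈ (sym (×1-homo-* q p)) (∈-* (·1∈ q) (∼⇒∈ p-uniformizer))

    private
      ·1∈-* : ∀ k {m} → m · 1# ∈π^ + 1 → (k ℕ.* m) · 1# ∈π^ + 1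
      ·1∈-* k {m} h = ∈-resp-≈ (sym (×1-homo-* k m)) (∈-* (·1∈ k) h)

      consecutive : ∀ {a b} → a · 1# ∈π^ + 1 → b · 1# ∈π^ + 1 → ¬ (1 ℕ.+ b ≡ a)
      consecutive {b = b} h k ≡.refl = ∼-∉ ∼-1 (∈-resp-≈ (trans (+-congʳ (1+× b 1#))
        (solve 1 (λ b → con (+ 1) :+ b :- b := con (+ 1)) refl (b · 1#))) (∈-sub h k))

    -- If p did not divide n, Bézout would give consecutive integers both lying in the maximal
    -- ideal, and 1 with them.
    ·1∈⇒∣ : ∀ n → n · 1# ∈π^ + 1 → p ℕ∣.∣ n
    ·1∈⇒∣ n n∈ with p ℕ∣.∣? n
    ... | yes p∣n = p∣n
    ... | no  p∤n with coprime-Bézout {p} {n} (λ (i∣p , i∣n) → PAdic.∤⇒coprime p p-prime p≥3 n p∤n i∣p i∣n)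
    ...   | Bézout.+- x y eq = ⊥-elim (consecutive (·1∈-* x (∼⇒∈ p-uniformizer)) (·1∈-* y n∈) eq)
    ...   | Bézout.-+ x y eq = ⊥-elim (consecutive (·1∈-* y n∈) (·1∈-* x (∼⇒∈ p-uniformizer)) eq)

    private
      integral : ∀ {x k} → x ∼π^ + suc k → x ∈π^ + 0
      integral {k = k} h = ∈-weaken (suc k) ≡.refl (∼⇒∈ h)

    -- (1 + x)ⁿ − 1 = n x + O(x²)
    ^-1∈⇒∣ : ∀ {x k} → x ∼π^ + suc k → ∀ n → (1# + x) ^ n - 1# ∈π^ + suc k ℤ.+ + 1 → p ℕ∣.∣ n
    ^-1∈⇒∣ {x} {k} h n h′ with binomial x (integral h) n
    ... | r , r∈ , eq = ·1∈⇒∣ n (∈-cancel h (∈-resp-≈ (begin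
      (1# + x) ^ n - 1# - x * x * (triangle n · 1# + x * r)   ≈⟨ +-congʳ (+-congʳ eq) ⟩
      1# + (n · 1#) * x + (triangle n · 1#) * (x * x) + x * x * x * r - 1# - x * x * (triangle n · 1# + x * r)
        ≈⟨ solve 4 (λ x n t r → con (+ 1) :+ n :* x :+ t :* (x :* x) :+ x :* x :* x :* r :- con (+ 1) :- x :* x :* (t :+ x :* r)
             := x :* n) refl
             x (n · 1#) (triangle n · 1#) r ⟩
      x * (n · 1#) ∎) (∈-sub h′ (∈-weaken k (exponent (+ k)) (∈-* (∈-* (∼⇒∈ h) (∼⇒∈ h)) (∈-+ (·1∈ (triangle n)) (∈-* (integral h) r∈)))))))
      where
      exponent : ∀ k → (+ 1 ℤ.+ k) ℤ.+ (+ 1 ℤ.+ k) ℤ.+ + 0 ≡ (+ 1 ℤ.+ k) ℤ.+ + 1 ℤ.+ k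
      exponent = solve-∀

    -- The linear term p x has valuation exactly k + 2, and the others at least k + 3: C(p, 2) x²
    -- because p divides C(p, 2), which is decisive when k = 0, and the cubic term because 3 (k + 1)
    -- ≥ k + 3.
    ^p-1∼ : ∀ {x k} → x ∼π^ + suc k → (1# + x) ^ p - 1# ∼π^ + suc (suc k)
    ^p-1∼ {x} {k} h with binomial x (integral h) p
    ... | r , r∈ , eq = ∼-resp-≈ (sym (begin
      (1# + x) ^ p - 1#   ≈⟨ +-congʳ eq ⟩
      1# + (p · 1#) * x + (triangle p · 1#) * (x * x) + x * x * x * r - 1#
        ≈⟨ solve 4 (λ x n t r → con (+ 1) :+ n :* x :+ t :* (x :* x) :+ x :* x :* x :* r :- con (+ 1)
             := n :* x :+ (t :* (x :* x) :+ x :* x :* x :* r)) refl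
             x (p · 1#) (triangle p · 1#) r ⟩
      (p · 1#) * x + ((triangle p · 1#) * (x * x) + x * x * x * r) ∎))
      (∼-+ (∼-* p-uniformizer h) (∈-+
        (∈-weaken k (exponent₁ (+ k)) (∈-* (∣⇒·1∈ (p∣triangle p p-prime p≥3)) (∈-* (∼⇒∈ h) (∼⇒∈ h))))
        (∈-weaken (k ℕ.+ k) (exponent₂ (+ k)) (∈-* (∈-* (∈-* (∼⇒∈ h) (∼⇒∈ h)) (∼⇒∈ h)) r∈))))
      where
      exponent₁ : ∀ k → + 1 ℤ.+ ((+ 1 ℤ.+ k) ℤ.+ (+ 1 ℤ.+ k)) ≡ + 1 ℤ.+ (+ 1 ℤ.+ k) ℤ.+ + 1 ℤ.+ k
      exponent₁ = solve-∀
      exponent₂ : ∀ k → (+ 1 ℤ.+ k) ℤ.+ (+ 1 ℤ.+ k) ℤ.+ (+ 1 ℤ.+ k) ℤ.+ + 0 ≡ + 1 ℤ.+ (+ 1 ℤ.+ k) ℤ.+ + 1 ℤ.+ (k ℤ.+ k)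
      exponent₂ = solve-∀

    -- Induction on m: to first order p divides d, so d = q p, and w may be replaced by wᵖ. This
    -- raises the exponent of w - 1 by exactly one and leaves m - 1 for q.
    lifting-exponent : ∀ m {w k} d → w - 1# ∼π^ + suc k → w ^ d - 1# ∈π^ + suc k ℤ.+ + m → p ℕ.^ m ℕ∣.∣ d
    lifting-exponent zero    d h h′ = ℕ∣.1∣ d
    lifting-exponent (suc m) {w} {k} d h h′ =
      split d h′ (^-1∈⇒∣ h d (∈-weaken m (exponent (+ k) (+ m)) (∈-resp-≈ (+-congʳ (^-congˡ d w≈)) h′)))
      where
      w≈ : w ≈ 1# + (w - 1#)
      w≈ = solve 1 (λ w → w := con (+ 1) :+ (w :- con (+ 1))) refl w
      exponent : ∀ k m → (+ 1 ℤ.+ k) ℤ.+ (+ 1 ℤ.+ m) ≡ (+ 1 ℤ.+ k) ℤ.+ + 1 ℤ.+ m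
      exponent = solve-∀
      exponent′ : ∀ k m → (+ 1 ℤ.+ k) ℤ.+ (+ 1 ℤ.+ m) ≡ (+ 2 ℤ.+ k) ℤ.+ m
      exponent′ = solve-∀
      split : ∀ d → w ^ d - 1# ∈π^ + suc k ℤ.+ + suc m → p ℕ∣.∣ d → p ℕ.^ suc m ℕ∣.∣ d
      split _ h′ (ℕ∣.divides q ≡.refl) = ≡.subst (p ℕ.* p ℕ.^ m ℕ∣.∣_) (ℕₚ.*-comm p q) (ℕ∣.*-monoʳ-∣ p
        (lifting-exponent m q (∼-resp-≈ (+-congʳ (^-congˡ p (sym w≈))) (^p-1∼ h))
          (∈-resp-≈ (+-congʳ (trans (^-congʳ w (ℕₚ.*-comm q p)) (sym (^-assocʳ w p q))))
            (∈-cast (exponent′ (+ k) (+ m)) h′))))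

-- Embeddings of valued fields and the pigeonhole principle.

record ValuedEmbedding (K F : DiscretelyValuedField) : Set where
  private
    module K = DiscretelyValuedField K
    module F = DiscretelyValuedField F
  field
    ι      : K.Carrier → F.Carrier
    ι-cong : ∀ {x y} → x K.≈ y → ι x F.≈ ι y
    ι-+    : ∀ x y → ι (x K.+ y) F.≈ ι x F.+ ι y
    ι-*    : ∀ x y → ι (x K.* y) F.≈ ι x F.* ι y
    ι-neg  : ∀ x → ι (K.- x) F.≈ F.- ι x
    ι-1    : ι K.1# F.≈ F.1#
    ι-∈    : ∀ {x m} → x K.∈π^ m → ι x F.∈π^ m
    ι-∈⁻¹  : ∀ {x m} → ι x F.∈π^ m → x K.∈π^ m

  ι-sub : ∀ x y → ι (x K.- y) F.≈ ι x F.- ι y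
  ι-sub x y = F.trans (ι-+ x (K.- y)) (F.+-congˡ (ι-neg y))

  ι-∼ : ∀ {x m} → x K.∼π^ m → ι x F.∼π^ m
  ι-∼ (exactly h k) = exactly (ι-∈ h) (λ ιx∈ → k (ι-∈⁻¹ ιx∈))

  ι-∼⁻¹ : ∀ {x m} → ι x F.∼π^ m → x K.∼π^ m
  ι-∼⁻¹ (exactly h k) = exactly (ι-∈⁻¹ h) (λ x∈ → k (ι-∈ x∈))

-- The residue field has at most p elements, so that πᵐ/πᵐ⁺ⁿ has at most pⁿ.
FiniteResidues : DiscretelyValuedField → ℕ → Set
FiniteResidues K p = ∀ M m → ∃ λ (class : ∀ x → x ∈π^ M → Fin (p ℕ.^ m)) →
  ∀ {x y} (x∈ : x ∈π^ M) (y∈ : y ∈π^ M) → class x x∈ ≡ class y y∈ → x - y ∈π^ M ℤ.+ + m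
  where open DiscretelyValuedField K

module _ (K : DiscretelyValuedField) (p : ℕ) (residues : FiniteResidues K p) where
  open DiscretelyValuedField K

  -- A map from ℕ that is p-adically expanding, up to the scale M, takes pᵐ
  -- incongruent values on 0, …, pᵐ − 1; these exhaust the residues.
  expanding-dense : ∀ (G : ℕ → Carrier) M → (∀ j → G j - G 0 ∈π^ M) →
    (∀ j d m → G (d ℕ.+ j) - G j ∈π^ M ℤ.+ + m → p ℕ.^ m ℕ∣.∣ d) →
    ∀ x → x - G 0 ∈π^ M → ∀ m → ∃ λ j → x - G j ∈π^ M ℤ.+ + m
  expanding-dense G M G∈ expanding x x∈ m with residues M m
  ... | class , class-injective with Finₚ.pigeonhole (ℕₚ.n<1+n (p ℕ.^ m)) f
    where
    f : Fin (suc (p ℕ.^ m)) → Fin (p ℕ.^ m)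
    -- One point more than there are residue classes: x itself, besides the pᵐ values of G.
    f Fin.zero    = class (x - G 0) x∈
    f (Fin.suc j) = class (G (Fin.toℕ j) - G 0) (G∈ (Fin.toℕ j))
  ... | Fin.zero , Fin.suc j , _ , eq = Fin.toℕ j ,
    ∈-resp-≈ (cancel x (G (Fin.toℕ j)) (G 0)) (class-injective x∈ (G∈ (Fin.toℕ j)) eq)
    where
    cancel : ∀ a b c → a - c - (b - c) ≈ a - b
    cancel = solve 3 (λ a b c → a :- c :- (b :- c) := a :- b) refl
  -- Two values of G cannot collide: pᵐ would divide b - a, which lies strictly between 0 and pᵐ.
  ... | Fin.suc i , Fin.suc j , ℕ.s≤s i<j , eq = ⊥-elim (ℕₚ.<⇒≱ (Finₚ.toℕ<n j)
    (ℕₚ.≤-trans (ℕ∣.∣⇒≤ {{ℕ.>-nonZero (ℕₚ.m<n⇒0<n∸m i<j)}} (expanding a (b ℕ.∸ a) m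
      (∈-swap (∈-resp-≈ (trans (cancel (G a) (G b) (G 0)) (+-congˡ (-‿cong (reflexive (≡.cong G (≡.sym (ℕₚ.m∸n+n≡m (ℕₚ.<⇒≤ i<j))))))))
        (class-injective (G∈ a) (G∈ b) eq)))))
      (ℕₚ.m∸n≤m b a)))
    where
    a b : ℕ
    a = Fin.toℕ i
    b = Fin.toℕ j
    cancel : ∀ a b c → a - c - (b - c) ≈ a - b
    cancel = solve 3 (λ a b c → a :- c :- (b :- c) := a :- b) refl

-- Kepler sets over an abstract pair of valued fields.

module LinearRecurrence
  (K F : DiscretelyValuedField) (embedding : ValuedEmbedding K F)
  (p : ℕ) (p-prime : Prime p) (p≥3 : 3 ℕ.≤ p)
  (residues : FiniteResidues K p)
  where

  private module K = DiscretelyValuedField K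
  open DiscretelyValuedField F
  open ValuedEmbedding embedding
  open Mult semiring using () renaming (_×_ to _·_)
  open SetoidReasoning setoid

  -- The powers of u and their classes modulo l.

  module Orbit
    (p-uniformizer : p · 1# ∼π^ + 1)
    (u : Carrier) (u∼ : u ∼π^ + 0)
    (l : ℕ) (l≥1 : 1 ℕ.≤ l) (uˡ-1∈ : u ^ l - 1# ∈π^ + 1)
    (minimal : ∀ j → 1 ℕ.≤ j → j ℕ.< l → ¬ (u ^ j - 1# ∈π^ + 1))
    (k : ℤ) (uˡ-1∼ : u ^ l - 1# ∼π^ k)
    where

    k≥1 : + 1 ℤ.≤ k
    k≥1 = ∼⇒≤ uˡ-1∼ uˡ-1∈

    ^∼ : ∀ n → u ^ n ∼π^ + 0
    ^∼ n = ∼-^0 n u∼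

    ^-expand : ∀ n j → u ^ (n ℕ.+ l ℕ.* j) - u ^ n ≈ u ^ n * ((u ^ l) ^ j - 1#)
    ^-expand n j = trans (+-congʳ (trans (^-homo-* u n (l ℕ.* j)) (*-congˡ (sym (^-assocʳ u l j)))))
      (solve 2 (λ a b → a :* b :- a := a :* (b :- con (+ 1))) refl (u ^ n) ((u ^ l) ^ j))

    power∈ : ∀ j → (u ^ l) ^ j - 1# ∈π^ k
    power∈ zero    = ∈-resp-≈ (sym (-‿inverseʳ 1#)) ∈-0
    power∈ (suc j) = ∈-resp-≈ (solve 2 (λ w x → w :* (x :- con (+ 1)) :+ (w :- con (+ 1)) := w :* x :- con (+ 1)) refl
        (u ^ l) ((u ^ l) ^ j))
      (∈-+ (∈-cast (ℤProps.+-identityˡ k) (∈-* (∼⇒∈ (^∼ l)) (power∈ j))) (∼⇒∈ uˡ-1∼))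

    periodic : ∀ n j → u ^ (n ℕ.+ l ℕ.* j) - u ^ n ∈π^ k
    periodic n j = ∈-resp-≈ (sym (^-expand n j)) (∈-cast (ℤProps.+-identityˡ k) (∈-* (∼⇒∈ (^∼ n)) (power∈ j)))

    expanding : ∀ d m → (u ^ l) ^ d - 1# ∈π^ k ℤ.+ + m → p ℕ.^ m ℕ∣.∣ d
    expanding d m h = go (≤⇒+ k≥1)
      where
      go : (∃ λ k′ → k ≡ + 1 ℤ.+ + k′) → p ℕ.^ m ℕ∣.∣ d
      go (k′ , k≡) = LiftingTheExponent.lifting-exponent F p p-prime p≥3 p-uniformizer m {k = k′} d (∼-cast k≡ uˡ-1∼)
        (∈-cast (≡.cong (ℤ._+ + m) k≡) h)

    -- The difference is uⁱ (uʲ⁻ⁱ - 1), and minimality of `l` keeps the second factor out of the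
    -- maximal ideal.
    distinct-< : ∀ i j → i ℕ.< j → j ℕ.< l → u ^ j - u ^ i ∼π^ + 0
    distinct-< i j i<j j<l = exactly (∈-sub (∼⇒∈ (^∼ j)) (∼⇒∈ (^∼ i)))
      λ h → minimal (j ℕ.∸ i) (ℕₚ.m<n⇒0<n∸m i<j) (ℕₚ.≤-<-trans (ℕₚ.m∸n≤m j i) j<l)
        (∈-cancel (^∼ i) (∈-resp-≈ factor h))
      where
      factor : u ^ j - u ^ i ≈ u ^ i * (u ^ (j ℕ.∸ i) - 1#)
      factor = trans (+-congʳ (trans (^-congʳ u (≡.sym (ℕₚ.m+[n∸m]≡n (ℕₚ.<⇒≤ i<j)))) (^-homo-* u i (j ℕ.∸ i))))
        (solve 2 (λ a b → a :* b :- a := a :* (b :- con (+ 1))) refl (u ^ i) (u ^ (j ℕ.∸ i)))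

    distinct : ∀ {i j} → i ℕ.< l → j ℕ.< l → i ≢ j → u ^ j - u ^ i ∼π^ + 0
    distinct {i} {j} i<l j<l i≢j with ℕₚ.<-cmp i j
    ... | tri< i<j _ _ = distinct-< i j i<j j<l
    ... | tri≈ _ i≡j _ = ⊥-elim (i≢j i≡j)
    ... | tri> _ _ j<i = ∼-resp-≈ (solve 2 (λ x y → :- (x :- y) := y :- x) refl (u ^ i) (u ^ j)) (∼-neg (distinct-< j i j<i i<l))

    class : ∀ n → ∃ λ i → i ℕ.< l × ∃ λ j → n ≡ i ℕ.+ l ℕ.* j
    class n = n ℕDivMod.% l , ℕDivMod.m%n<n n l , n ℕDivMod./ l ,
      ≡.trans (ℕDivMod.m≡m%n+[m/n]*n n l) (≡.cong (n ℕDivMod.% l ℕ.+_) (ℕₚ.*-comm (n ℕDivMod./ l) l))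
      where
      instance
        l≢0 : ℕ.NonZero l
        l≢0 = ℕ.>-nonZero l≥1

    -- P n / Q n is a Möbius function of uⁿ with determinant E; its numerator and
    -- its denominator carry the scale λ₁ⁿ.
    module Moebius
      (λ₁ : Carrier) (ℓ : ℤ) (λ₁∼ : λ₁ ∼π^ ℓ)
      (P Q : ℕ → K.Carrier) (E : Carrier) (e : ℤ) (E∼ : E ∼π^ e)
      (determinant : ∀ n m → ι (P n) * ι (Q m) - ι (P m) * ι (Q n) ≈ (E * (λ₁ ^ n * λ₁ ^ m)) * (u ^ n - u ^ m))
      (i : ℕ) (f : ℤ) (Q∼ : ∀ j → ι (Q (i ℕ.+ l ℕ.* j)) ∼π^ f ℤ.+ + (i ℕ.+ l ℕ.* j) ℤ.* ℓ)
      (G : ℕ → K.Carrier) (G-ratio : ∀ j → G j K.* Q (i ℕ.+ l ℕ.* j) K.≈ P (i ℕ.+ l ℕ.* j))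
      (M : ℤ) (M≡ : M ≡ (e ℤ.- f ℤ.- f) ℤ.+ k)
      where

      private
        N : ℕ → ℕ
        N j = i ℕ.+ l ℕ.* j

        N-+ : ∀ d j → N (d ℕ.+ j) ≡ N j ℕ.+ l ℕ.* d
        N-+ d j = ≡.trans (≡.cong (i ℕ.+_) (≡.trans (ℕₚ.*-distribˡ-+ l d j) (ℕₚ.+-comm (l ℕ.* d) (l ℕ.* j))))
          (≡.sym (ℕₚ.+-assoc i (l ℕ.* j) (l ℕ.* d)))

        -- Clearing both denominators avoids division. The powers of λ₁ in `Q` and in the
        -- determinant then have equal valuations and cancel, so that a difference of values of G
        -- has valuation e - 2f plus that of (uˡ)ᵈ - 1.
        difference : ∀ d j → (ι (Q (N (d ℕ.+ j))) * ι (Q (N j))) * ι (G (d ℕ.+ j) K.- G j)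
          ≈ (E * (λ₁ ^ N (d ℕ.+ j) * λ₁ ^ N j) * u ^ N j) * ((u ^ l) ^ d - 1#)
        difference d j = begin
          (q′ * q) * ι (G (d ℕ.+ j) K.- G j)
            ≈⟨ *-congˡ (ι-sub _ _) ⟩
          (q′ * q) * (ι (G (d ℕ.+ j)) - ι (G j))
            ≈⟨ solve 4 (λ q′ q g′ g → (q′ :* q) :* (g′ :- g) := (g′ :* q′) :* q :- (g :* q) :* q′) refl q′ q _ _ ⟩
          (ι (G (d ℕ.+ j)) * q′) * q - (ι (G j) * q) * q′
            ≈⟨ +-cong (*-congʳ (ratio (d ℕ.+ j))) (-‿cong (*-congʳ (ratio j))) ⟩
          ι (P (N (d ℕ.+ j))) * q - ι (P (N j)) * q′
            ≈⟨ determinant (N (d ℕ.+ j)) (N j) ⟩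
          (E * (λ₁ ^ N (d ℕ.+ j) * λ₁ ^ N j)) * (u ^ N (d ℕ.+ j) - u ^ N j)
            ≈⟨ *-congˡ (trans (+-congʳ (^-congʳ u (N-+ d j))) (^-expand (N j) d)) ⟩
          (E * (λ₁ ^ N (d ℕ.+ j) * λ₁ ^ N j)) * (u ^ N j * ((u ^ l) ^ d - 1#))
            ≈⟨ *-assoc _ _ _ ⟨
          (E * (λ₁ ^ N (d ℕ.+ j) * λ₁ ^ N j) * u ^ N j) * ((u ^ l) ^ d - 1#) ∎
          where
          q′ q : Carrier
          q′ = ι (Q (N (d ℕ.+ j)))
          q  = ι (Q (N j))
          ratio : ∀ j → ι (G j) * ι (Q (N j)) ≈ ι (P (N j))
          ratio j = trans (sym (ι-* _ _)) (ι-cong (G-ratio j))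

        scale : ∀ n m → E * (λ₁ ^ n * λ₁ ^ m) * u ^ m ∼π^ e ℤ.+ (+ n ℤ.* ℓ ℤ.+ + m ℤ.* ℓ) ℤ.+ + 0
        scale n m = ∼-* (∼-* E∼ (∼-* (∼-^ n λ₁∼) (∼-^ m λ₁∼))) (^∼ m)

        exponents : ∀ x y → e ℤ.+ (x ℤ.+ y) ℤ.+ + 0 ℤ.+ k ≡ (f ℤ.+ x ℤ.+ (f ℤ.+ y)) ℤ.+ M
        exponents x y = ≡.trans (rearrange e f k x y) (≡.cong (λ M → (f ℤ.+ x ℤ.+ (f ℤ.+ y)) ℤ.+ M) (≡.sym M≡))
          where
          rearrange : ∀ e f k x y → e ℤ.+ (x ℤ.+ y) ℤ.+ + 0 ℤ.+ k ≡ (f ℤ.+ x ℤ.+ (f ℤ.+ y)) ℤ.+ ((e ℤ.- f ℤ.- f) ℤ.+ k)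
          rearrange = solve-∀

        exponents′ : ∀ m x y → (f ℤ.+ x ℤ.+ (f ℤ.+ y)) ℤ.+ (M ℤ.+ m) ≡ e ℤ.+ (x ℤ.+ y) ℤ.+ + 0 ℤ.+ (k ℤ.+ m)
        exponents′ m x y = ≡.trans (rearrange m (f ℤ.+ x ℤ.+ (f ℤ.+ y)) M) (≡.trans (≡.cong (ℤ._+ m) (≡.sym (exponents x y)))
          (ℤProps.+-assoc (e ℤ.+ (x ℤ.+ y) ℤ.+ + 0) k m))
          where
          rearrange : ∀ m x M → x ℤ.+ (M ℤ.+ m) ≡ x ℤ.+ M ℤ.+ m
          rearrange = solve-∀

      G-∈ : ∀ d j → G (d ℕ.+ j) K.- G j K.∈π^ M
      G-∈ d j = ι-∈⁻¹ (∈-cancel (∼-* (Q∼ (d ℕ.+ j)) (Q∼ j)) (∈-cast (exponents (+ N (d ℕ.+ j) ℤ.* ℓ) (+ N j ℤ.* ℓ))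
        (∈-resp-≈ (sym (difference d j)) (∈-* (∼⇒∈ (scale (N (d ℕ.+ j)) (N j))) (power∈ d)))))

      G-expanding : ∀ j d m → G (d ℕ.+ j) K.- G j K.∈π^ M ℤ.+ + m → p ℕ.^ m ℕ∣.∣ d
      G-expanding j d m h = expanding d m (∈-cancel (scale (N (d ℕ.+ j)) (N j))
        (∈-cast (exponents′ (+ m) (+ N (d ℕ.+ j) ℤ.* ℓ) (+ N j ℤ.* ℓ))
          (∈-resp-≈ (difference d j) (∈-* (∼⇒∈ (∼-* (Q∼ (d ℕ.+ j)) (Q∼ j))) (ι-∈ h)))))

      G-0∈ : ∀ j → G j K.- G 0 K.∈π^ M
      G-0∈ j = ≡.subst (λ n → G n K.- G 0 K.∈π^ M) (ℕₚ.+-identityʳ j) (G-∈ j 0)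

      G-dense : ∀ x → x K.- G 0 K.∈π^ M → ∀ m → ∃ λ j → x K.- G j K.∈π^ M ℤ.+ + m
      G-dense = expanding-dense K p residues G M G-0∈ G-expanding

    -- The sequence aₙ = c λ₁ⁿ (t + uⁿ) and its ratios.

    module Sequence
      (λ₁ : Carrier) (ℓ : ℤ) (λ₁∼ : λ₁ ∼π^ ℓ)
      (c : Carrier) (γ : ℤ) (c∼ : c ∼π^ γ)
      (t : Carrier) (τ : ℤ) (t∼ : t ∼π^ τ)
      (ε : ℤ) (u-1∼ : u - 1# ∼π^ ε)
      (a : ℕ → K.Carrier) (binet : ∀ n → ι (a n) ≈ c * λ₁ ^ n * (t + u ^ n))
      (r s : K.Carrier) (recurrence : ∀ n → a (2 ℕ.+ n) K.≈ r K.* a (1 ℕ.+ n) K.+ s K.* a n)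
      where

      δ : ℤ
      δ = ℓ ℤ.+ ε

      X : ℕ → Carrier
      X n = t + u ^ n

      radius : ℤ → ℤ
      radius x = ((τ ℤ.+ δ) ℤ.- + 2 ℤ.* x) ℤ.+ k

      radius-antitone : ∀ {x y} → x ℤ.≤ y → radius y ℤ.≤ radius x
      radius-antitone x≤y = ℤProps.+-monoˡ-≤ k (ℤProps.+-monoʳ-≤ (τ ℤ.+ δ) (ℤProps.neg-mono-≤ (ℤProps.*-monoˡ-≤-nonNeg (+ 2) x≤y)))

      -- c² times the determinant of the matrix of w ↦ λ₁ (t + u w)/(t + w).
      E : Carrier
      E = c * c * t * (λ₁ * (u - 1#))

      -- The valuation of t is left open here: in a near class it is known in the form + 0 and is
      -- used as such.
      E∼ : ∀ {τ} → t ∼π^ τ → E ∼π^ γ ℤ.+ γ ℤ.+ τ ℤ.+ δ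
      E∼ t∼ = ∼-* (∼-* (∼-* c∼ c∼) t∼) (∼-* λ₁∼ u-1∼)

      X-periodic : ∀ i j → X (i ℕ.+ l ℕ.* j) - X i ∈π^ k
      X-periodic i j = ∈-resp-≈ (solve 3 (λ t x y → y :- x := (t :+ y) :- (t :+ x)) refl t (u ^ i) (u ^ (i ℕ.+ l ℕ.* j))) (periodic i j)

      prefactor∼ : ∀ n → c * λ₁ ^ n ∼π^ γ ℤ.+ + n ℤ.* ℓ
      prefactor∼ n = ∼-* c∼ (∼-^ n λ₁∼)

      a∼ : ∀ n {x} → X n ∼π^ x → ι (a n) ∼π^ (γ ℤ.+ x) ℤ.+ + n ℤ.* ℓ
      a∼ n {x} h = ∼-cast (exponent γ x (+ n ℤ.* ℓ)) (∼-resp-≈ (sym (binet n)) (∼-* (prefactor∼ n) h))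
        where
        exponent : ∀ g x y → g ℤ.+ y ℤ.+ x ≡ g ℤ.+ x ℤ.+ y
        exponent = solve-∀

      determinant : ∀ n m → ι (a (suc n)) * ι (a m) - ι (a (suc m)) * ι (a n) ≈ (E * (λ₁ ^ n * λ₁ ^ m)) * (u ^ n - u ^ m)
      determinant n m = begin
        ι (a (suc n)) * ι (a m) - ι (a (suc m)) * ι (a n)
          ≈⟨ +-cong (*-cong (binet (suc n)) (binet m)) (-‿cong (*-cong (binet (suc m)) (binet n))) ⟩
        (c * (λ₁ * b) * (t + u * x)) * (c * b′ * (t + y)) - (c * (λ₁ * b′) * (t + u * y)) * (c * b * (t + x))
          ≈⟨ solve 8 (λ c v b b′ x y z w → (c :* (v :* b) :* x) :* (c :* b′ :* y) :- (c :* (v :* b′) :* z) :* (c :* b :* w)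
               := (c :* (v :* b)) :* (c :* b′) :* (x :* y :- z :* w)) refl c λ₁ b b′ (t + u * x) (t + y) (t + u * y) (t + x) ⟩
        (c * (λ₁ * b)) * (c * b′) * ((t + u * x) * (t + y) - (t + u * y) * (t + x))
          ≈⟨ *-congˡ (solve 4 (λ t u x y → (t :+ u :* x) :* (t :+ y) :- (t :+ u :* y) :* (t :+ x)
               := t :* (u :- con (+ 1)) :* (x :- y)) refl t u x y) ⟩
        (c * (λ₁ * b)) * (c * b′) * (t * (u - 1#) * (x - y))
          ≈⟨ solve 7 (λ c v b b′ t u d → (c :* (v :* b)) :* (c :* b′) :* (t :* u :* d) := (c :* c :* t :* (v :* u) :* (b :* b′)) :* d) refl
               c λ₁ b b′ t (u - 1#) (x - y) ⟩
        (E * (b * b′)) * (x - y) ∎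
        where
        b b′ x y : Carrier
        b = λ₁ ^ n
        b′ = λ₁ ^ m
        x = u ^ n
        y = u ^ m

      -- Eliminating s between the recurrences for a₂ and a₃.
      trace : ι r ≈ λ₁ * (1# + u)
      trace = *-cancelˡ (∼-* (∼-* (∼-* c∼ λ₁∼) (∼-* c∼ λ₁∼)) (∼-* (∼-* t∼ u-1∼) u-1∼)) (begin
        κ * (t * (u - 1#) * (u - 1#)) * ι r
          ≈⟨ *-congʳ (*-congˡ (solve 2 (λ t u → t :* (u :- con (+ 1)) :* (u :- con (+ 1))
               := (t :+ u :* u) :* (t :+ con (+ 1)) :- (t :+ u) :* (t :+ u)) refl t u)) ⟩
        κ * (X₂ * X₀ - X₁ * X₁) * ι r
          ≈⟨ solve 6 (λ c v x y z ρ → (c :* v) :* (c :* v) :* (z :* x :- y :* y) :* ρ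
               := ρ :* ((c :* (v :* v) :* z) :* (c :* x) :- (c :* v :* y) :* (c :* v :* y))) refl c λ₁ X₀ X₁ X₂ (ι r) ⟩
        ι r * (A₂ * A₀ - A₁ * A₁)
          ≈⟨ solve 5 (λ ρ σ x y z → ρ :* (z :* x :- y :* y) := (ρ :* z :+ σ :* y) :* x :- (ρ :* y :+ σ :* x) :* y) refl
               (ι r) (ι s) A₀ A₁ A₂ ⟩
        (ι r * A₂ + ι s * A₁) * A₀ - (ι r * A₁ + ι s * A₀) * A₁
          ≈⟨ +-cong (*-congʳ (step 1 a₁≈ a₂≈ a₃≈)) (-‿cong (*-congʳ (step 0 a₀≈ a₁≈ a₂≈))) ⟨
        A₃ * A₀ - A₂ * A₁
          ≈⟨ solve 6 (λ c v x y z w → (c :* (v :* (v :* v)) :* w) :* (c :* x) :- (c :* (v :* v) :* z) :* (c :* v :* y)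
               := (c :* v) :* (c :* v) :* (v :* (w :* x :- z :* y))) refl c λ₁ X₀ X₁ X₂ X₃ ⟩
        κ * (λ₁ * (X₃ * X₀ - X₂ * X₁))
          ≈⟨ *-congˡ (*-congˡ (solve 2 (λ t u → (t :+ u :* (u :* u)) :* (t :+ con (+ 1)) :- (t :+ u :* u) :* (t :+ u)
               := t :* (u :- con (+ 1)) :* (u :- con (+ 1)) :* (con (+ 1) :+ u)) refl t u)) ⟩
        κ * (λ₁ * (t * (u - 1#) * (u - 1#) * (1# + u)))
          ≈⟨ solve 4 (λ k v d w → k :* (v :* (d :* w)) := k :* d :* (v :* w)) refl κ λ₁ (t * (u - 1#) * (u - 1#)) (1# + u) ⟩
        κ * (t * (u - 1#) * (u - 1#)) * (λ₁ * (1# + u)) ∎)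
        where
        κ X₀ X₁ X₂ X₃ A₀ A₁ A₂ A₃ : Carrier
        κ  = (c * λ₁) * (c * λ₁)
        X₀ = t + 1#
        X₁ = t + u
        X₂ = t + u * u
        X₃ = t + u * (u * u)
        A₀ = c * X₀
        A₁ = c * λ₁ * X₁
        A₂ = c * (λ₁ * λ₁) * X₂
        A₃ = c * (λ₁ * (λ₁ * λ₁)) * X₃
        a₀≈ : ι (a 0) ≈ A₀
        a₀≈ = trans (binet 0) (*-congʳ (*-identityʳ c))
        a₁≈ : ι (a 1) ≈ A₁
        a₁≈ = trans (binet 1) (*-cong (*-congˡ (*-identityʳ λ₁)) (+-congˡ (*-identityʳ u)))
        a₂≈ : ι (a 2) ≈ A₂
        a₂≈ = trans (binet 2) (*-cong (*-congˡ (*-congˡ (*-identityʳ λ₁))) (+-congˡ (*-congˡ (*-identityʳ u))))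
        a₃≈ : ι (a 3) ≈ A₃
        a₃≈ = trans (binet 3) (*-cong (*-congˡ (*-congˡ (*-congˡ (*-identityʳ λ₁)))) (+-congˡ (*-congˡ (*-congˡ (*-identityʳ u)))))
        step : ∀ n {x y z} → ι (a n) ≈ x → ι (a (1 ℕ.+ n)) ≈ y → ι (a (2 ℕ.+ n)) ≈ z → z ≈ ι r * y + ι s * x
        step n x≈ y≈ z≈ = trans (sym z≈) (trans (ι-cong (recurrence n)) (trans (ι-+ _ _)
          (+-cong (trans (ι-* _ _) (*-congˡ y≈)) (trans (ι-* _ _) (*-congˡ x≈)))))

      -- Cross-multiplied, so that no choice of an inverse enters; a definite valuation of aₙ serves
      -- as the witness that it does not vanish.
      record IsRatio (n : ℕ) (q : K.Carrier) : Set where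
        constructor is-ratio
        field
          {order} : ℤ
          nonzero : a n K.∼π^ order
          ratio   : q K.* a n K.≈ a (suc n)

      Kepler : K.Carrier → Set
      Kepler x = ∀ (m : ℕ) → ∃ λ y → (∃ λ n → IsRatio n y) × x K.- y K.∈π^ + m

      ratio-unique : ∀ {n q q′} → IsRatio n q → IsRatio n q′ → q K.≈ q′
      ratio-unique {n} {q} {q′} (is-ratio a≠0 eq) (is-ratio _ eq′) =
        K.*-cancelˡ a≠0 (K.trans (K.*-comm (a n) q) (K.trans eq (K.trans (K.sym eq′) (K.*-comm q′ (a n)))))

      -- Density is stated in natural steps above a base exponent `M`; this many steps reach any
      -- prescribed exponent `m`, also one below `M`.
      reach : ∀ M m → m ℤ.≤ M ℤ.+ + ℤ.∣ m ℤ.- M ∣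
      reach M m = shift-≤ (cancel M m (+ ℤ.∣ m ℤ.- M ∣)) (i≤+∣i∣ (m ℤ.- M))
        where
        cancel : ∀ M m d → d ℤ.- (m ℤ.- M) ≡ M ℤ.+ d ℤ.- m
        cancel = solve-∀

      N0 : ∀ i → i ℕ.+ l ℕ.* 0 ≡ i
      N0 i = ≡.trans (≡.cong (i ℕ.+_) (ℕₚ.*-zeroʳ l)) (ℕₚ.+-identityʳ i)

      -- Classes in which t + uⁿ has constant valuation below k.

      module Far (i : ℕ) (x : ℤ) (Xᵢ∼ : X i ∼π^ x) (x<k : x ℤ.< k)
        (ρ : ℤ) (ρ≡ : ρ ≡ radius x) where

        -- Within a class X changes only by elements of πᵏ, and these cannot disturb a valuation
        -- below k.
        X∼ : ∀ j → X (i ℕ.+ l ℕ.* j) ∼π^ x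
        X∼ j = ∼-resp-≈ (solve 2 (λ x y → y :+ (x :- y) := x) refl (X (i ℕ.+ l ℕ.* j)) (X i))
          (∼-+ Xᵢ∼ (∈-mono (<⇒+1≤ x<k) (X-periodic i j)))

        aₙ∼ : ∀ j → ι (a (i ℕ.+ l ℕ.* j)) ∼π^ (γ ℤ.+ x) ℤ.+ + (i ℕ.+ l ℕ.* j) ℤ.* ℓ
        aₙ∼ j = a∼ (i ℕ.+ l ℕ.* j) (X∼ j)

        exponent : ∀ g t d x k → ((t ℤ.+ d) ℤ.- + 2 ℤ.* x) ℤ.+ k ≡ (g ℤ.+ g ℤ.+ t ℤ.+ d ℤ.- (g ℤ.+ x) ℤ.- (g ℤ.+ x)) ℤ.+ k
        exponent = solve-∀

        G : ℕ → K.Carrier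
        G j = a (suc (i ℕ.+ l ℕ.* j)) K.* proj₁ (K.invertible (ι-∼⁻¹ (aₙ∼ j)))

        G-ratio : ∀ j → G j K.* a (i ℕ.+ l ℕ.* j) K.≈ a (suc (i ℕ.+ l ℕ.* j))
        G-ratio j = K.trans (K.*-assoc _ _ _) (K.trans (K.*-congˡ (proj₂ (K.invertible (ι-∼⁻¹ (aₙ∼ j))))) (K.*-identityʳ _))

        G-isRatio : ∀ j → IsRatio (i ℕ.+ l ℕ.* j) (G j)
        G-isRatio j = is-ratio (ι-∼⁻¹ (aₙ∼ j)) (G-ratio j)

        -- The denominators have f = γ + x. In e - 2f + k the contribution of c cancels, and -2x is
        -- the source of the term -2ν(t + uⁱ) in the radius.
        open Moebius λ₁ ℓ λ₁∼ (λ n → a (suc n)) a E (γ ℤ.+ γ ℤ.+ τ ℤ.+ δ) (E∼ t∼) determinant i (γ ℤ.+ x) aₙ∼ G G-ratio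
          ρ (≡.trans ρ≡ (exponent γ τ δ x k))

        G-0 : ∀ {q} → IsRatio i q → G 0 K.≈ q
        G-0 = ratio-unique (≡.subst (λ n → IsRatio n (G 0)) (N0 i) (G-isRatio 0))

        ratio-∈ : ∀ {j q q₀} → IsRatio (i ℕ.+ l ℕ.* j) q → IsRatio i q₀ → q K.- q₀ K.∈π^ ρ
        ratio-∈ {j} h h₀ = K.∈-resp-≈ (K.+-cong (ratio-unique (G-isRatio j) h) (K.-‿cong (G-0 h₀))) (G-0∈ j)

        ratio-dense : ∀ {q₀ y} → IsRatio i q₀ → y K.- q₀ K.∈π^ ρ → Kepler y
        ratio-dense {y = y} h₀ y∈ m =
          approximate (G-dense y (K.∈-resp-≈ (K.+-congˡ (K.-‿cong (K.sym (G-0 h₀)))) y∈) ℤ.∣ + m ℤ.- ρ ∣)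
          where
          approximate : (∃ λ j → y K.- G j K.∈π^ ρ ℤ.+ + ℤ.∣ + m ℤ.- ρ ∣) →
            ∃ λ q → (∃ λ n → IsRatio n q) × y K.- q K.∈π^ + m
          approximate (j , y∈′) = G j , (i ℕ.+ l ℕ.* j , G-isRatio j) , K.∈-mono (reach ρ (+ m)) y∈′

      -- The determinant identity divided by aᵢ aⱼ. The contributions of c and of the powers of λ₁
      -- cancel, uⁱ - uʲ is a unit, and the denominators contribute -x and -y.
      ratio-difference : ∀ {i j x y q q′} → X i ∼π^ x → X j ∼π^ y → u ^ i - u ^ j ∼π^ + 0 → IsRatio i q → IsRatio j q′ →
        q K.- q′ K.∼π^ (τ ℤ.+ δ) ℤ.- x ℤ.- y
      ratio-difference {i} {j} {x} {y} {q} {q′} Xᵢ∼ Xⱼ∼ uᵢⱼ∼ (is-ratio _ eq) (is-ratio _ eq′) =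
        ι-∼⁻¹ (∼-cancel (∼-* (a∼ i Xᵢ∼) (a∼ j Xⱼ∼)) (∼-cast (exponent γ τ δ x y (+ i ℤ.* ℓ) (+ j ℤ.* ℓ))
          (∼-resp-≈ (sym (begin
            (ι (a i) * ι (a j)) * ι (q K.- q′)
              ≈⟨ *-congˡ (ι-sub q q′) ⟩
            (ι (a i) * ι (a j)) * (ι q - ι q′)
              ≈⟨ solve 4 (λ x y q q′ → (x :* y) :* (q :- q′) := (q :* x) :* y :- (q′ :* y) :* x) refl (ι (a i)) (ι (a j)) (ι q) (ι q′) ⟩
            (ι q * ι (a i)) * ι (a j) - (ι q′ * ι (a j)) * ι (a i)
              ≈⟨ +-cong (*-congʳ (trans (sym (ι-* _ _)) (ι-cong eq))) (-‿cong (*-congʳ (trans (sym (ι-* _ _)) (ι-cong eq′)))) ⟩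
            ι (a (suc i)) * ι (a j) - ι (a (suc j)) * ι (a i)
              ≈⟨ determinant i j ⟩
            (E * (λ₁ ^ i * λ₁ ^ j)) * (u ^ i - u ^ j) ∎))
            (∼-* (∼-* (E∼ t∼) (∼-* (∼-^ i λ₁∼) (∼-^ j λ₁∼))) uᵢⱼ∼))))
        where
        exponent : ∀ g t d x y m n → (g ℤ.+ g ℤ.+ t ℤ.+ d) ℤ.+ (m ℤ.+ n) ℤ.+ + 0 ≡
          ((g ℤ.+ x ℤ.+ m) ℤ.+ (g ℤ.+ y ℤ.+ n)) ℤ.+ ((t ℤ.+ d) ℤ.- x ℤ.- y)
        exponent = solve-∀

      -- If the balls met, the larger of them would contain both centres, but
      -- these are too far apart.
      balls-disjoint : ∀ {i j x y q q′ z} → X i ∼π^ x → X j ∼π^ y → u ^ i - u ^ j ∼π^ + 0 → IsRatio i q → IsRatio j q′ →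
        y ℤ.< x ℤ.+ k → x ℤ.< y ℤ.+ k →
        z K.- q K.∈π^ radius x → ¬ (z K.- q′ K.∈π^ radius y)
      balls-disjoint {x = x} {y} {q} {q′} Xᵢ∼ Xⱼ∼ uᵢⱼ∼ h h′ y<x+k x<y+k z∈ z∈′ with ℤProps.≤-total x y
      ... | inj₁ x≤y = ℤProps.<⇒≱ y<x+k (shift-≤ (eq τ δ x y k)
        (K.∼⇒≤ (ratio-difference Xᵢ∼ Xⱼ∼ uᵢⱼ∼ h h′) (K.∈-trans (K.∈-swap (K.∈-mono (radius-antitone x≤y) z∈)) z∈′)))
        where
        eq : ∀ t d x y k → ((t ℤ.+ d) ℤ.- x ℤ.- y) ℤ.- (((t ℤ.+ d) ℤ.- + 2 ℤ.* y) ℤ.+ k) ≡ y ℤ.- (x ℤ.+ k)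
        eq = solve-∀
      ... | inj₂ y≤x = ℤProps.<⇒≱ x<y+k (shift-≤ (eq τ δ x y k)
        (K.∼⇒≤ (ratio-difference Xᵢ∼ Xⱼ∼ uᵢⱼ∼ h h′) (K.∈-trans (K.∈-swap z∈) (K.∈-mono (radius-antitone y≤x) z∈′))))
        where
        eq : ∀ t d x y k → ((t ℤ.+ d) ℤ.- x ℤ.- y) ℤ.- (((t ℤ.+ d) ℤ.- + 2 ℤ.* x) ℤ.+ k) ≡ x ℤ.- (y ℤ.+ k)
        eq = solve-∀

      2∼ : 1# + 1# ∼π^ + 0
      2∼ = exactly (LiftingTheExponent.·1∈ F 2)
        (λ 2∈ → ℕₚ.<⇒≱ p≥3 (ℕ∣.∣⇒≤ (LiftingTheExponent.·1∈⇒∣ F p p-prime p≥3 p-uniformizer 2 2∈)))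

      -- Classes in which t + uⁿ vanishes modulo πᵏ.

      module Near (i : ℕ) (Xᵢ∈ : X i ∈π^ k) (h : K.Carrier) (h≈ : ι h * (1# + 1#) ≈ λ₁ * (1# + u)) where

        X∈ : ∀ j → X (i ℕ.+ l ℕ.* j) ∈π^ k
        X∈ j = ∈-near (X-periodic i j) Xᵢ∈

        -- As t - uⁿ = -2uⁿ + (t + uⁿ), it is a unit plus an element of the maximal ideal; this
        -- needs 2 to be a unit.
        t-∼ : ∀ n → X n ∈π^ k → t - u ^ n ∼π^ + 0
        t-∼ n Xₙ∈ = ∼-resp-≈ (solve 2 (λ t x → :- ((con (+ 1) :+ con (+ 1)) :* x) :+ (t :+ x) := t :- x) refl t (u ^ n))
          (∼-+ (∼-neg (∼-* 2∼ (^∼ n))) (∈-mono k≥1 Xₙ∈))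

        t∼0 : t ∼π^ + 0
        t∼0 = ∼-resp-≈ (solve 2 (λ t x → :- x :+ (t :+ x) := t) refl t (u ^ i)) (∼-+ (∼-neg (^∼ i)) (∈-mono k≥1 Xᵢ∈))

        b : ℕ → K.Carrier
        b n = a (suc n) K.- h K.* a n

        -- Rests on 2 (t + u w) - (1 + u)(t + w) = -(u - 1)(t - w): subtracting h moves the zero of
        -- the numerator to w = t. The factor 2 stays because h is known through 2h.
        2b≈ : ∀ n → (1# + 1#) * ι (b n) ≈ c * λ₁ ^ n * (λ₁ * (u - 1#)) * - (t - u ^ n)
        2b≈ n = begin
          (1# + 1#) * ι (b n)
            ≈⟨ *-congˡ (trans (ι-sub _ _) (+-congˡ (-‿cong (ι-* h (a n))))) ⟩
          (1# + 1#) * (ι (a (suc n)) - ι h * ι (a n))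
            ≈⟨ solve 4 (λ d x h y → d :* (x :- h :* y) := d :* x :- (h :* d) :* y) refl (1# + 1#) _ _ _ ⟩
          (1# + 1#) * ι (a (suc n)) - (ι h * (1# + 1#)) * ι (a n)
            ≈⟨ +-cong (*-congˡ (binet (suc n))) (-‿cong (*-cong h≈ (binet n))) ⟩
          (1# + 1#) * (c * (λ₁ * λ₁ ^ n) * (t + u * u ^ n)) - (λ₁ * (1# + u)) * (c * λ₁ ^ n * (t + u ^ n))
            ≈⟨ solve 6 (λ c v x t u y → (con (+ 1) :+ con (+ 1)) :* (c :* (v :* x) :* (t :+ u :* y))
                   :- (v :* (con (+ 1) :+ u)) :* (c :* x :* (t :+ y))
                 := c :* x :* (v :* (u :- con (+ 1))) :* :- (t :- y)) refl c λ₁ (λ₁ ^ n) t u (u ^ n) ⟩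
          c * λ₁ ^ n * (λ₁ * (u - 1#)) * - (t - u ^ n) ∎

        b∼ : ∀ n → X n ∈π^ k → ι (b n) ∼π^ (γ ℤ.+ δ) ℤ.+ + n ℤ.* ℓ
        b∼ n Xₙ∈ = ∼-cancel 2∼ (∼-cast (exponent γ δ (+ n ℤ.* ℓ)) (∼-resp-≈ (sym (2b≈ n))
          (∼-* (∼-* (prefactor∼ n) (∼-* λ₁∼ u-1∼)) (∼-neg (t-∼ n Xₙ∈)))))
          where
          exponent : ∀ g d x → (g ℤ.+ x) ℤ.+ d ℤ.+ + 0 ≡ + 0 ℤ.+ ((g ℤ.+ d) ℤ.+ x)
          exponent = solve-∀

        -- This is 1/(q - h) whenever the ratio q exists, and it remains defined, with value 0,
        -- where aₙ vanishes.
        H : ℕ → K.Carrier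
        H j = a (i ℕ.+ l ℕ.* j) K.* proj₁ (K.invertible (ι-∼⁻¹ (b∼ (i ℕ.+ l ℕ.* j) (X∈ j))))

        H-b : ∀ j → H j K.* b (i ℕ.+ l ℕ.* j) K.≈ a (i ℕ.+ l ℕ.* j)
        H-b j = K.trans (K.*-assoc _ _ _)
          (K.trans (K.*-congˡ (proj₂ (K.invertible (ι-∼⁻¹ (b∼ (i ℕ.+ l ℕ.* j) (X∈ j)))))) (K.*-identityʳ _))

        2X≈ : ∀ j → (1# + 1#) * X (i ℕ.+ l ℕ.* j) ≈ (λ₁ * (u - 1#)) * - (t - u ^ (i ℕ.+ l ℕ.* j)) * ι (H j)
        2X≈ j = *-cancelˡ (prefactor∼ n) (begin
          (c * λ₁ ^ n) * ((1# + 1#) * X n)      ≈⟨ solve 3 (λ f d x → f :* (d :* x) := d :* (f :* x)) refl _ _ _ ⟩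
          (1# + 1#) * ((c * λ₁ ^ n) * X n)      ≈⟨ *-congˡ (trans (ι-cong (H-b j)) (binet n)) ⟨
          (1# + 1#) * ι (H j K.* b n)           ≈⟨ *-congˡ (ι-* _ _) ⟩
          (1# + 1#) * (ι (H j) * ι (b n))       ≈⟨ solve 3 (λ d h b → d :* (h :* b) := (d :* b) :* h) refl _ _ _ ⟩
          (1# + 1#) * ι (b n) * ι (H j)         ≈⟨ *-congʳ (2b≈ n) ⟩
          c * λ₁ ^ n * (λ₁ * (u - 1#)) * - (t - u ^ n) * ι (H j)
            ≈⟨ solve 4 (λ f d x h → f :* d :* x :* h := f :* (d :* x :* h)) refl _ _ _ _ ⟩
          (c * λ₁ ^ n) * ((λ₁ * (u - 1#)) * - (t - u ^ n) * ι (H j)) ∎)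
          where
          n : ℕ
          n = i ℕ.+ l ℕ.* j

        denominator∼ : ∀ j → (λ₁ * (u - 1#)) * - (t - u ^ (i ℕ.+ l ℕ.* j)) ∼π^ δ ℤ.+ + 0
        denominator∼ j = ∼-* (∼-* λ₁∼ u-1∼) (∼-neg (t-∼ (i ℕ.+ l ℕ.* j) (X∈ j)))

        H∈ : ∀ j → H j K.∈π^ k ℤ.- δ
        H∈ j = ι-∈⁻¹ (∈-cancel (denominator∼ j) (∈-cast (exponent k δ) (∈-resp-≈ (2X≈ j) (∈-* (∼⇒∈ 2∼) (X∈ j)))))
          where
          exponent : ∀ k d → + 0 ℤ.+ k ≡ (d ℤ.+ + 0) ℤ.+ (k ℤ.- d)
          exponent = solve-∀

        b-determinant : ∀ n m → ι (a n) * ι (b m) - ι (a m) * ι (b n) ≈ (- E * (λ₁ ^ n * λ₁ ^ m)) * (u ^ n - u ^ m)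
        b-determinant n m = begin
          ι (a n) * ι (b m) - ι (a m) * ι (b n)
            ≈⟨ +-cong (*-congˡ (trans (ι-sub _ _) (+-congˡ (-‿cong (ι-* h (a m))))))
                      (-‿cong (*-congˡ (trans (ι-sub _ _) (+-congˡ (-‿cong (ι-* h (a n))))))) ⟩
          ι (a n) * (ι (a (suc m)) - ι h * ι (a m)) - ι (a m) * (ι (a (suc n)) - ι h * ι (a n))
            ≈⟨ solve 5 (λ x x′ y y′ h → x :* (y′ :- h :* y) :- y :* (x′ :- h :* x) := :- (x′ :* y :- y′ :* x)) refl
                 (ι (a n)) (ι (a (suc n))) (ι (a m)) (ι (a (suc m))) (ι h) ⟩
          - (ι (a (suc n)) * ι (a m) - ι (a (suc m)) * ι (a n))
            ≈⟨ -‿cong (determinant n m) ⟩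
          - ((E * (λ₁ ^ n * λ₁ ^ m)) * (u ^ n - u ^ m))
            ≈⟨ solve 3 (λ e x y → :- ((e :* x) :* y) := (:- e :* x) :* y) refl E _ _ ⟩
          (- E * (λ₁ ^ n * λ₁ ^ m)) * (u ^ n - u ^ m) ∎

        exponent : ∀ g d k → k ℤ.- d ≡ (g ℤ.+ g ℤ.+ + 0 ℤ.+ d ℤ.- (g ℤ.+ d) ℤ.- (g ℤ.+ d)) ℤ.+ k
        exponent = solve-∀

        open Moebius λ₁ ℓ λ₁∼ a b (- E) (γ ℤ.+ γ ℤ.+ + 0 ℤ.+ δ) (∼-neg (E∼ t∼0)) b-determinant i (γ ℤ.+ δ)
          (λ j → b∼ (i ℕ.+ l ℕ.* j) (X∈ j)) H H-b (k ℤ.- δ) (exponent γ δ k)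

        -- By `H∈` the ball around `H 0` that the values fill is the ball around 0.
        H-dense : ∀ {y} → y K.∈π^ k ℤ.- δ → ∀ m → ∃ λ j → y K.- H j K.∈π^ (k ℤ.- δ) ℤ.+ + m
        H-dense {y} y∈ = G-dense y (K.∈-sub y∈ (H∈ 0))

        -- Approximating 0 by values of H makes X small, since by `2X≈` the two differ by a factor
        -- of fixed valuation δ. Thus a single near class already makes -t a limit of powers of u.
        X-dense : ∀ (m : ℕ) → ∃ λ n → X n ∈π^ + m
        X-dense m = approximate (H-dense K.∈-0 m)
          where
          exponent′ : ∀ k d m → (d ℤ.+ + 0) ℤ.+ ((k ℤ.- d) ℤ.+ m) ≡ + 0 ℤ.+ (m ℤ.+ k)
          exponent′ = solve-∀
          approximate : (∃ λ j → K.0# K.- H j K.∈π^ (k ℤ.- δ) ℤ.+ + m) → ∃ λ n → X n ∈π^ + m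
          approximate (j , H∈′) = i ℕ.+ l ℕ.* j , ∈-mono (ℤProps.≤-trans (ℤProps.i≤i+j (+ m) (+ 1)) (ℤProps.+-monoʳ-≤ (+ m) k≥1))
            (∈-cancel 2∼ (∈-cast (exponent′ k δ (+ m)) (∈-resp-≈ (sym (2X≈ j))
              (∈-* (∼⇒∈ (denominator∼ j))
                (ι-∈ (K.∈-resp-≈ (K.solve 1 (λ x → K.:- (K.con (+ 0) K.:- x) K.:= x) K.refl (H j)) (K.∈-neg H∈′)))))))

        inverse : ∀ j {q} → IsRatio (i ℕ.+ l ℕ.* j) q → (q K.- h) K.* H j K.≈ K.1#
        inverse j {q} (is-ratio _ eq) = K.*-cancelˡ (ι-∼⁻¹ (b∼ n (X∈ j))) (K.trans
          (K.solve 3 (λ b d x → b K.:* (d K.:* x) K.:= d K.:* (x K.:* b)) K.refl (b n) (q K.- h) (H j))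
          (K.trans (K.*-congˡ (H-b j)) (K.trans (K.solve 3 (λ q h x → (q K.:- h) K.:* x K.:= q K.:* x K.:- h K.:* x) K.refl q h (a n))
            (K.trans (K.+-congʳ eq) (K.sym (K.*-identityʳ (b n)))))))
          where
          n : ℕ
          n = i ℕ.+ l ℕ.* j

        -- Otherwise (q - h) H = 1 would lie in the maximal ideal.
        ratio-∉ : ∀ j {q} → IsRatio (i ℕ.+ l ℕ.* j) q → ¬ (q K.- h K.∈π^ + 1 ℤ.+ (δ ℤ.- k))
        ratio-∉ j hq q∈ = ∼-∉ K.∼-1 (K.∈-cast (exponent′ δ k) (K.∈-resp-≈ (inverse j hq) (K.∈-* q∈ (H∈ j))))
          where
          exponent′ : ∀ d k → (+ 1 ℤ.+ (d ℤ.- k)) ℤ.+ (k ℤ.- d) ≡ + 0 ℤ.+ + 1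
          exponent′ = solve-∀

        -- With v = x − h and y = 1/v, a good approximation H of y gives the
        -- approximation q − h = 1/H of v, as v − 1/H = v · 1/H · (H − y).
        outside-dense : ∀ {x} → ¬ (x K.- h K.∈π^ + 1 ℤ.+ (δ ℤ.- k)) → Kepler x
        outside-dense {x} x∉ m = located (K.locate v (+ 1 ℤ.+ (δ ℤ.- k)))
          where
          v : K.Carrier
          v = x K.- h
          located : v K.∈π^ + 1 ℤ.+ (δ ℤ.- k) ⊎ (∃ λ e → e ℤ.< + 1 ℤ.+ (δ ℤ.- k) × v K.∼π^ e) →
            ∃ λ q → (∃ λ n → IsRatio n q) × x K.- q K.∈π^ + m
          located (inj₁ v∈) = ⊥-elim (x∉ v∈)
          located (inj₂ (e , e< , v∼)) = inverted (K.invertible v∼)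
            where
            target : ℤ
            -- The first bound forces H to have the valuation -e of y, so that q exists and w = q -
            -- h has valuation e; the second makes up for the factor v w of valuation 2e.
            target = (ℤ.- e ℤ.+ + 1) ℤ.⊔ (+ m ℤ.- e ℤ.- e)
            inverted : (∃ λ y → y K.* v K.≈ K.1#) → ∃ λ q → (∃ λ n → IsRatio n q) × x K.- q K.∈π^ + m
            inverted (y , yv≈1) = approximate
              (H-dense (K.∈-mono (shift-≤ (rearrange e δ k) (<⇒+1≤ e<)) (∼⇒∈ y∼)) ℤ.∣ target ℤ.- (k ℤ.- δ) ∣)
              where
              rearrange : ∀ e d k → + 1 ℤ.+ (d ℤ.- k) ℤ.- (e ℤ.+ + 1) ≡ ℤ.- e ℤ.- (k ℤ.- d)
              rearrange = solve-∀
              rearrange′ : ∀ e m → e ℤ.+ e ℤ.+ (m ℤ.- e ℤ.- e) ≡ m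
              rearrange′ = solve-∀
              y∼ : y K.∼π^ ℤ.- e
              y∼ = K.∼-cancel v∼ (K.∼-cast (≡.sym (ℤProps.+-inverseʳ e)) (K.∼-resp-≈ (K.trans (K.sym yv≈1) (K.*-comm y v)) K.∼-1))
              approximate : (∃ λ j → y K.- H j K.∈π^ (k ℤ.- δ) ℤ.+ + ℤ.∣ target ℤ.- (k ℤ.- δ) ∣) →
                ∃ λ q → (∃ λ n → IsRatio n q) × x K.- q K.∈π^ + m
              approximate (j , y-H∈) = q , (n , q-isRatio) , K.∈-resp-≈ v-w≈ (K.∈-cast (rearrange′ e (+ m))
                (K.∈-* (K.∈-* (∼⇒∈ v∼) (∼⇒∈ w∼)) (K.∈-swap (K.∈-mono (ℤProps.i≤j⊔i (ℤ.- e ℤ.+ + 1) _) y-H∈target))))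
                where
                n : ℕ
                n = i ℕ.+ l ℕ.* j
                y-H∈target : y K.- H j K.∈π^ target
                y-H∈target = K.∈-mono (reach (k ℤ.- δ) target) y-H∈
                H∼ : H j K.∼π^ ℤ.- e
                H∼ = K.∼-resp-≈ (K.solve 2 (λ y x → y K.:+ (x K.:- y) K.:= x) K.refl y (H j))
                  (K.∼-+ y∼ (K.∈-swap (K.∈-mono (ℤProps.i≤i⊔j _ (+ m ℤ.- e ℤ.- e)) y-H∈target)))
                aₙ∼ : a n K.∼π^ _
                aₙ∼ = K.∼-resp-≈ (H-b j) (K.∼-* H∼ (ι-∼⁻¹ (b∼ n (X∈ j))))
                q : K.Carrier
                q = a (suc n) K.* proj₁ (K.invertible aₙ∼)
                q-isRatio : IsRatio n q
                q-isRatio = is-ratio aₙ∼ (K.trans (K.*-assoc _ _ _) (K.trans (K.*-congˡ (proj₂ (K.invertible aₙ∼))) (K.*-identityʳ _)))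
                w : K.Carrier
                w = q K.- h
                w∼ : w K.∼π^ e
                w∼ = K.∼-cancel H∼ (K.∼-cast (≡.sym (ℤProps.+-inverseˡ e))
                  (K.∼-resp-≈ (K.trans (K.sym (inverse j q-isRatio)) (K.*-comm w (H j))) K.∼-1))
                v-w≈ : v K.* w K.* (H j K.- y) K.≈ x K.- q
                v-w≈ = K.trans (K.solve 4 (λ v w z y → v K.:* w K.:* (z K.:- y) K.:= v K.:* (w K.:* z) K.:- w K.:* (y K.:* v)) K.refl
                    v w (H j) y)
                  (K.trans (K.+-cong (K.*-congˡ (inverse j q-isRatio)) (K.-‿cong (K.*-congˡ yv≈1)))
                    (K.solve 3 (λ x q h → (x K.:- h) K.:* K.con (+ 1) K.:- (q K.:- h) K.:* K.con (+ 1) K.:= x K.:- q) K.refl x q h))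

      -- The λᵢ may lie outside K, but their sum is r by `trace`, so the centre h = r/2 is found in
      -- K.
      half-trace : ∃ λ h → ι h * (1# + 1#) ≈ λ₁ * (1# + u)
      half-trace = halve (K.invertible (ι-∼⁻¹ (∼-resp-≈ (sym ι-2) 2∼)))
        where
        ι-2 : ι (K.1# K.+ K.1#) ≈ 1# + 1#
        ι-2 = trans (ι-+ _ _) (+-cong ι-1 ι-1)
        halve : (∃ λ y → y K.* (K.1# K.+ K.1#) K.≈ K.1#) → ∃ λ h → ι h * (1# + 1#) ≈ λ₁ * (1# + u)
        halve (y , y*2≈1) = r K.* y , (begin
          ι (r K.* y) * (1# + 1#)                ≈⟨ *-congˡ ι-2 ⟨
          ι (r K.* y) * ι (K.1# K.+ K.1#)        ≈⟨ ι-* _ _ ⟨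
          ι ((r K.* y) K.* (K.1# K.+ K.1#))      ≈⟨ ι-cong (K.trans (K.*-assoc _ _ _) (K.trans (K.*-congˡ y*2≈1) (K.*-identityʳ r))) ⟩
          ι r                                    ≈⟨ trace ⟩
          λ₁ * (1# + u)                          ∎)

      -- The case -t ∉ Λ.

      -- The condition -t ∈ Λ, written as smallness of t + uⁿ.
      Dense : Set
      Dense = ∀ (m : ℕ) → ∃ λ n → X n ∈π^ + m

      -- `locate` decides whether X i lies in πᵏ; if it does, the class is near and `X-dense`
      -- contradicts the hypothesis.
      far : ¬ Dense → ∀ i → ∃ λ x → x ℤ.< k × X i ∼π^ x
      far ¬dense i = located (locate (X i) k)
        where
        located : X i ∈π^ k ⊎ (∃ λ x → x ℤ.< k × X i ∼π^ x) → ∃ λ x → x ℤ.< k × X i ∼π^ x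
        located (inj₁ Xᵢ∈) = ⊥-elim (¬dense (Near.X-dense i Xᵢ∈ (proj₁ half-trace) (proj₂ half-trace)))
        located (inj₂ h)   = h

      kepler-far⊆ : ¬ Dense → ∀ {y} → Kepler y →
        ∃ λ i → i ℕ.< l × ∃ λ x → X i ∼π^ x × (∀ {q} → IsRatio i q → y K.- q K.∈π^ radius x)
      kepler-far⊆ ¬dense {y} y∈K = approximated (y∈K ℤ.∣ bound ∣)
        where
        -- All t + uⁱ lie in the power `μ` of the ideal, so `bound` is at least every radius: one
        -- approximation of y is fine enough before its class is known.
        μ bound : ℤ
        μ = τ ℤ.⊓ + 0
        bound = radius μ
        X≥μ : ∀ i {x} → X i ∼π^ x → μ ℤ.≤ x
        X≥μ i h = ∼⇒≤ h (∈-+ (∈-mono (ℤProps.i⊓j≤i τ (+ 0)) (∼⇒∈ t∼)) (∈-mono (ℤProps.i⊓j≤j τ (+ 0)) (∼⇒∈ (^∼ i))))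
        approximated : (∃ λ q → (∃ λ n → IsRatio n q) × y K.- q K.∈π^ + ℤ.∣ bound ∣) → _
        approximated (q , (n , q-ratio) , y-q∈) = in-class (class n) (far ¬dense (proj₁ (class n)))
          where
          in-class : ((i , _) : ∃ λ i → i ℕ.< l × ∃ λ j → n ≡ i ℕ.+ l ℕ.* j) → (∃ λ x → x ℤ.< k × X i ∼π^ x) →
            ∃ λ i → i ℕ.< l × ∃ λ x → X i ∼π^ x × (∀ {q} → IsRatio i q → y K.- q K.∈π^ radius x)
          in-class (i , i<l , j , ≡.refl) (x , x<k , Xᵢ∼) = i , i<l , x , Xᵢ∼ , λ q₀-ratio →
            K.∈-trans (K.∈-mono (ℤProps.≤-trans (radius-antitone (X≥μ i Xᵢ∼)) (i≤+∣i∣ bound)) y-q∈)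
              (Far.ratio-∈ i x Xᵢ∼ x<k (radius x) ≡.refl q-ratio q₀-ratio)

      far-< : ¬ Dense → ∀ i {x} → X i ∼π^ x → x ℤ.< k
      far-< ¬dense i Xᵢ∼ = same (far ¬dense i)
        where
        same : (∃ λ x → x ℤ.< k × X i ∼π^ x) → _
        same (x , x<k , Xᵢ∼′) = ≡.subst (ℤ._< k) (∼-unique Xᵢ∼′ Xᵢ∼) x<k

      kepler-far⊇ : ¬ Dense → ∀ {i x q y} → X i ∼π^ x → IsRatio i q → y K.- q K.∈π^ radius x → Kepler y
      kepler-far⊇ ¬dense {i} {x} Xᵢ∼ = Far.ratio-dense i x Xᵢ∼ (far-< ¬dense i Xᵢ∼) (radius x) ≡.refl

      -- Suppose x ≥ y + k. If y ≥ 0, then x ≥ k. If y < 0, then X j is the sum of X i and uʲ - uⁱ,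
      -- both of valuation above y. Either way a contradiction; the bound is what `balls-disjoint`
      -- asks for.
      far-close : ∀ {i j x y} → x ℤ.< k → u ^ j - u ^ i ∼π^ + 0 → X i ∼π^ x → X j ∼π^ y → x ℤ.< y ℤ.+ k
      far-close {i} {j} {x} {y} x<k uᵢⱼ∼ Xᵢ∼ Xⱼ∼ with x ℤProps.<? y ℤ.+ k
      ... | yes h = h
      ... | no  h = ⊥-elim (contradict (ℤProps.≤-total (+ 0) y))
        where
        y+k≤x : y ℤ.+ k ℤ.≤ x
        y+k≤x = ℤProps.≮⇒≥ h
        contradict : + 0 ℤ.≤ y ⊎ y ℤ.≤ + 0 → _
        contradict (inj₁ 0≤y) = ℤProps.<⇒≱ x<k (ℤProps.≤-trans (≡.subst (ℤ._≤ y ℤ.+ k) (ℤProps.+-identityˡ k) (ℤProps.+-monoˡ-≤ k 0≤y)) y+k≤x)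
        contradict (inj₂ y≤0) with y ℤProps.≟ + 0
        ... | yes ≡.refl = ℤProps.<⇒≱ x<k (≡.subst (ℤ._≤ x) (ℤProps.+-identityˡ k) y+k≤x)
        ... | no  y≢0    = ∼-∉ Xⱼ∼ (∈-resp-≈ (solve 3 (λ t x y → (t :+ x) :+ (y :- x) := t :+ y) refl t (u ^ i) (u ^ j))
          (∈-+ (∈-mono (ℤProps.≤-trans (ℤProps.+-monoʳ-≤ y k≥1) y+k≤x) (∼⇒∈ Xᵢ∼)) (∈-mono (<⇒+1≤ (ℤProps.≤∧≢⇒< y≤0 y≢0)) (∼⇒∈ uᵢⱼ∼))))

      kepler-far-disjoint : ¬ Dense → ∀ {i j x x′ q q′ y} → i ℕ.< l → j ℕ.< l → i ≢ j → X i ∼π^ x → X j ∼π^ x′ →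
        IsRatio i q → IsRatio j q′ → y K.- q K.∈π^ radius x → ¬ (y K.- q′ K.∈π^ radius x′)
      kepler-far-disjoint ¬dense {i} {j} {x} {x′} i<l j<l i≢j Xᵢ∼ Xⱼ∼ h h′ =
        balls-disjoint Xᵢ∼ Xⱼ∼ (distinct j<l i<l (λ j≡i → i≢j (≡.sym j≡i))) h h′
          (far-close {j} {i} (far-< ¬dense j Xⱼ∼) (distinct j<l i<l (λ j≡i → i≢j (≡.sym j≡i))) Xⱼ∼ Xᵢ∼)
          (far-close {i} {j} (far-< ¬dense i Xᵢ∼) (distinct i<l j<l i≢j) Xᵢ∼ Xⱼ∼)

      -- The case -t ∈ Λ.

      near-class : ∀ {n} → X n ∈π^ k → ∀ {i j} → n ≡ i ℕ.+ l ℕ.* j → X i ∈π^ k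
      near-class Xₙ∈ {i} {j} ≡.refl = ∈-near (∈-swap (X-periodic i j)) Xₙ∈

      near-index : Dense → ∃ λ σ → σ ℕ.< l × X σ ∈π^ k
      near-index dense = in-class (dense ℤ.∣ k ∣)
        where
        in-class : (∃ λ n → X n ∈π^ + ℤ.∣ k ∣) → ∃ λ σ → σ ℕ.< l × X σ ∈π^ k
        in-class (n , Xₙ∈) = proj₁ (class n) , proj₁ (proj₂ (class n)) ,
          near-class (∈-mono (i≤+∣i∣ k) Xₙ∈) (proj₂ (proj₂ (proj₂ (class n))))

      -- Here t + uⁱ is the sum of uⁱ - u^σ, a unit, and t + u^σ, which lies in the maximal ideal.
      near-far : ∀ {σ i} → σ ℕ.< l → X σ ∈π^ k → i ℕ.< l → i ≢ σ → X i ∼π^ + 0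
      near-far {σ} {i} σ<l Xσ∈ i<l i≢σ = ∼-resp-≈ (solve 3 (λ t x y → (y :- x) :+ (t :+ x) := t :+ y) refl t (u ^ σ) (u ^ i))
        (∼-+ (distinct σ<l i<l (λ σ≡i → i≢σ (≡.sym σ≡i))) (∈-mono k≥1 Xσ∈))

      near-unique : ∀ {σ i} → σ ℕ.< l → X σ ∈π^ k → i ℕ.< l → X i ∈π^ k → σ ≡ i
      near-unique {σ} {i} σ<l Xσ∈ i<l Xᵢ∈ with i ℕₚ.≟ σ
      ... | yes i≡σ = ≡.sym i≡σ
      ... | no  i≢σ = ⊥-elim (∼-∉ (near-far σ<l Xσ∈ i<l i≢σ) (∈-mono k≥1 Xᵢ∈))

      -- A single class, l = 1.

      module _ (h : K.Carrier) (h≈ : ι h * (1# + 1#) ≈ λ₁ * (1# + u)) where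

        kepler-single⊆ : l ≡ 1 → Dense → ∀ {y} → Kepler y → ¬ (y K.- h K.∈π^ + 1 ℤ.+ (δ ℤ.- k))
        kepler-single⊆ l≡1 dense {y} y∈K y∈ = approximated (near-index dense) (y∈K ℤ.∣ + 1 ℤ.+ (δ ℤ.- k) ∣)
          where
          approximated : (∃ λ σ → σ ℕ.< l × X σ ∈π^ k) →
            (∃ λ q → (∃ λ n → IsRatio n q) × y K.- q K.∈π^ + ℤ.∣ + 1 ℤ.+ (δ ℤ.- k) ∣) → _
          approximated (σ , σ<l , Xσ∈) (q , (n , q-ratio) , y-q∈) = in-class (class n)
            where
            <1 : ∀ {i} → i ℕ.< l → i ≡ 0
            <1 {i} i<l = ℕₚ.n<1⇒n≡0 (≡.subst (i ℕ.<_) l≡1 i<l)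
            in-class : (∃ λ i → i ℕ.< l × ∃ λ j → n ≡ i ℕ.+ l ℕ.* j) → _
            in-class (i , i<l , j , ≡.refl) = Near.ratio-∉ i
              (≡.subst (λ i → X i ∈π^ k) (≡.trans (<1 σ<l) (≡.sym (<1 i<l))) Xσ∈) h h≈ j q-ratio
              (K.∈-trans (K.∈-swap (K.∈-mono (i≤+∣i∣ _) y-q∈)) y∈)

        kepler-single⊇ : Dense → ∀ {y} → ¬ (y K.- h K.∈π^ + 1 ℤ.+ (δ ℤ.- k)) → Kepler y
        kepler-single⊇ dense y∉ = at-index (near-index dense)
          where
          at-index : (∃ λ σ → σ ℕ.< l × X σ ∈π^ k) → Kepler _
          at-index (σ , _ , Xσ∈) = Near.outside-dense σ Xσ∈ h h≈ y∉

      -- Hence δ - k = ℓ, and the excluded ball gets the exponent 1 + ℓ, free of k.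
      ε-single : l ≡ 1 → ε ≡ k
      ε-single ≡.refl = ∼-unique u-1∼ (∼-resp-≈ (+-congʳ (*-identityʳ u)) uˡ-1∼)

      -- Several classes, exactly one of them near.

      module Several (2≤l : 2 ℕ.≤ l) (σ : ℕ) (σ<l : σ ℕ.< l) (Xσ∈ : X σ ∈π^ k) where

        private
          h : K.Carrier
          h = proj₁ half-trace
          h≈ : ι h * (1# + 1#) ≈ λ₁ * (1# + u)
          h≈ = proj₂ half-trace

        -- As l ≥ 2, the exponent 1 falls under minimality, so u - 1 is a unit.
        ε≡0 : ε ≡ + 0
        ε≡0 = ∼-unique u-1∼ (exactly (∈-sub (∼⇒∈ u∼) (∼⇒∈ ∼-1))
          (λ u-1∈ → minimal 1 (ℕ.s≤s ℕ.z≤n) 2≤l (∈-resp-≈ (+-congʳ (sym (*-identityʳ u))) u-1∈)))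

        δ≡ℓ : δ ≡ ℓ
        δ≡ℓ = ≡.trans (≡.cong (λ ε → ℓ ℤ.+ ε) ε≡0) (ℤProps.+-identityʳ ℓ)

        τ≡0 : τ ≡ + 0
        τ≡0 = ∼-unique t∼ (Near.t∼0 σ Xσ∈ h h≈)

        X∼0 : ∀ {i} → i ℕ.< l → i ≢ σ → X i ∼π^ + 0
        X∼0 = near-far σ<l Xσ∈

        radius≡ : δ ℤ.+ k ≡ radius (+ 0)
        radius≡ = ≡.cong (ℤ._+ k) (≡.trans (≡.sym (ℤProps.+-identityˡ δ))
          (≡.trans (≡.cong (ℤ._+ δ) (≡.sym τ≡0)) (≡.sym (ℤProps.+-identityʳ (τ ℤ.+ δ)))))

        outer : ℤ
        outer = (ℓ ℤ.+ + 1) ℤ.- k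

        outer≡ : outer ≡ + 1 ℤ.+ (δ ℤ.- k)
        outer≡ = ≡.trans (rearrange ℓ k) (≡.cong (λ δ → + 1 ℤ.+ (δ ℤ.- k)) (≡.sym δ≡ℓ))
          where
          rearrange : ∀ x k → (x ℤ.+ + 1) ℤ.- k ≡ + 1 ℤ.+ (x ℤ.- k)
          rearrange = solve-∀

        outer≤ℓ : outer ℤ.≤ ℓ
        outer≤ℓ = shift-≤ (rearrange ℓ k) k≥1
          where
          rearrange : ∀ x k → k ℤ.- + 1 ≡ x ℤ.- ((x ℤ.+ + 1) ℤ.- k)
          rearrange = solve-∀

        outer≤radius : outer ℤ.≤ δ ℤ.+ k
        outer≤radius = ℤProps.≤-trans outer≤ℓ (≡.subst (ℤ._≤ δ ℤ.+ k) (≡.trans (ℤProps.+-identityʳ δ) δ≡ℓ)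
          (ℤProps.+-monoʳ-≤ δ (ℤProps.≤-trans (ℤ.+≤+ ℕ.z≤n) k≥1)))

        -- Therefore the excluded ball around h equals the one around 0, and the complement can be
        -- centred at 0.
        h∈ : h K.∈π^ outer
        h∈ = K.∈-mono outer≤ℓ (ι-∈⁻¹ (∈-cancel 2∼ (∈-cast (ℤProps.+-comm ℓ (+ 0)) (∈-resp-≈ (trans (sym h≈) (*-comm _ _))
          (∈-* (∼⇒∈ λ₁∼) (∈-+ (∼⇒∈ ∼-1) (∼⇒∈ u∼)))))))

        -- Puts the remaining balls inside the excluded one. There is only a lower bound, because
        -- the index i + 1 may fall into the near class, where t + uⁱ⁺¹ is not a unit.
        ratio-∈ℓ : ∀ {i q} → i ℕ.< l → i ≢ σ → IsRatio i q → q K.∈π^ ℓ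
        ratio-∈ℓ {i} {q} i<l i≢σ (is-ratio _ eq) = ι-∈⁻¹ (∈-cancel (a∼ i (X∼0 i<l i≢σ)) (∈-cast (exponent γ ℓ (+ i))
          (∈-resp-≈ (trans (sym (binet (suc i))) (trans (ι-cong (K.trans (K.sym eq) (K.*-comm q (a i)))) (ι-* _ _)))
            (∈-* (∼⇒∈ (prefactor∼ (suc i))) (∈-+ (∈-cast τ≡0 (∼⇒∈ t∼)) (∼⇒∈ (^∼ (suc i))))))))
          where
          exponent : ∀ g x n → g ℤ.+ (+ 1 ℤ.+ n) ℤ.* x ℤ.+ + 0 ≡ (g ℤ.+ + 0 ℤ.+ n ℤ.* x) ℤ.+ x
          exponent = solve-∀

        kepler⊆ : ∀ {y} → Kepler y →
          (∃ λ i → (i ℕ.< l × i ≢ σ) × (∀ {q} → IsRatio i q → y K.- q K.∈π^ δ ℤ.+ k)) ⊎ ¬ (y K.∈π^ outer)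
        kepler⊆ {y} y∈K = approximated (y∈K ℤ.∣ δ ℤ.+ k ∣)
          where
          Result : Set
          Result = (∃ λ i → (i ℕ.< l × i ≢ σ) × (∀ {q} → IsRatio i q → y K.- q K.∈π^ δ ℤ.+ k)) ⊎ ¬ (y K.∈π^ outer)
          approximated : (∃ λ q → (∃ λ n → IsRatio n q) × y K.- q K.∈π^ + ℤ.∣ δ ℤ.+ k ∣) → Result
          approximated (q , (n , q-ratio) , y-q∈) = in-class (class n)
            where
            y-q∈′ : y K.- q K.∈π^ δ ℤ.+ k
            y-q∈′ = K.∈-mono (i≤+∣i∣ _) y-q∈
            in-class : (∃ λ i → i ℕ.< l × ∃ λ j → n ≡ i ℕ.+ l ℕ.* j) → Result
            in-class (i , i<l , j , ≡.refl) with i ℕₚ.≟ σ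
            ... | no  i≢σ = inj₁ (i , (i<l , i≢σ) , λ q₀-ratio → K.∈-trans y-q∈′
              (Far.ratio-∈ i (+ 0) (X∼0 i<l i≢σ) (ℤProps.<-≤-trans (ℤ.+<+ (ℕ.s≤s ℕ.z≤n)) k≥1) (δ ℤ.+ k) radius≡ q-ratio q₀-ratio))
            ... | yes ≡.refl = inj₂ λ y∈ → Near.ratio-∉ i Xσ∈ h h≈ j q-ratio (K.∈-cast outer≡
              (K.∈-sub (K.∈-near (K.∈-swap (K.∈-mono outer≤radius y-q∈′)) y∈) h∈))

        kepler-piece : ∀ {i q y} → i ℕ.< l → i ≢ σ → IsRatio i q → y K.- q K.∈π^ δ ℤ.+ k → Kepler y
        kepler-piece {i} i<l i≢σ =
          Far.ratio-dense i (+ 0) (X∼0 i<l i≢σ) (ℤProps.<-≤-trans (ℤ.+<+ (ℕ.s≤s ℕ.z≤n)) k≥1) (δ ℤ.+ k) radius≡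

        kepler-outer : ∀ {y} → ¬ (y K.∈π^ outer) → Kepler y
        kepler-outer y∉ = Near.outside-dense σ Xσ∈ h h≈ (λ y-h∈ → y∉ (K.∈-near (K.∈-cast (≡.sym outer≡) y-h∈) h∈))

        pieces-disjoint : ∀ {i j q q′ y} → i ℕ.< l × i ≢ σ → j ℕ.< l × j ≢ σ → i ≢ j → IsRatio i q → IsRatio j q′ →
          y K.- q K.∈π^ δ ℤ.+ k → ¬ (y K.- q′ K.∈π^ δ ℤ.+ k)
        pieces-disjoint (i<l , i≢σ) (j<l , j≢σ) i≢j hq hq′ y∈ y∈′ =
          balls-disjoint (X∼0 i<l i≢σ) (X∼0 j<l j≢σ) (distinct j<l i<l (λ j≡i → i≢j (≡.sym j≡i))) hq hq′ 0<k 0<k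
            (K.∈-cast radius≡ y∈) (K.∈-cast radius≡ y∈′)
          where
          0<k : + 0 ℤ.< + 0 ℤ.+ k
          0<k = ≡.subst (+ 0 ℤ.<_) (≡.sym (ℤProps.+-identityˡ k)) (ℤProps.<-≤-trans (ℤ.+<+ (ℕ.s≤s ℕ.z≤n)) k≥1)

        piece⊆ball : ∀ {i q y} → i ℕ.< l × i ≢ σ → IsRatio i q → y K.- q K.∈π^ δ ℤ.+ k → y K.∈π^ outer
        piece⊆ball (i<l , i≢σ) hq y∈ = K.∈-near (K.∈-mono outer≤radius y∈) (K.∈-mono outer≤ℓ (ratio-∈ℓ i<l i≢σ hq))

-- The valuation on a field of fractions and its residues.

module FractionValuation (O : DVR) where
  private module O = DVR O
  open ValuedField O
  open CommutativeRing commutativeRing using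
    ( reflexive; refl; sym; trans; +-cong; *-cong; *-congˡ; *-congʳ; -‿cong; *-comm; *-assoc; *-identityˡ; *-identityʳ; zeroʳ )
  open IntegerCoefficients commutativeRing using (solve; _:=_; _:+_; _:*_; :-_)
  open RawMagmaDefs (Semiring.*-rawMagma O.semiring) using (_,_)
  private module OS = IntegerCoefficients O.commutativeRing

  infix 4 _∈π^_

  -- A record instead of a Σ-type, so that `x` and `m` can be inferred from the type.
  record _∈π^_ (x : Frac) (m : ℤ) : Set where
    constructor multiple
    field
      {quotient} : O.Carrier
      equality   : x ≈ π^ m * fromO quotient

  fromO-cong : ∀ {a b} → a O.≈ b → fromO a ≈ fromO b
  fromO-cong a≈b = cross (O.*-congʳ a≈b)

  fromO-injective : ∀ {a b} → fromO a ≈ fromO b → a O.≈ b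
  fromO-injective (cross eq) = O.trans (O.sym (O.*-identityʳ _)) (O.trans eq (O.*-identityʳ _))

  fromO-+ : ∀ a b → fromO (a O.+ b) ≈ fromO a + fromO b
  fromO-+ a b = fromO-cong (O.sym (O.+-cong (O.*-identityʳ a) (O.*-identityʳ b)))

  π^-⊖ : ∀ m n → π^ (m ℤ.⊖ n) ≈ (O.π O.^ m) /π^ n
  π^-⊖ m zero = refl
  π^-⊖ zero (suc n) = refl
  π^-⊖ (suc m) (suc n) rewrite ℤProps.[1+m]⊖[1+n]≡m⊖n m n = trans (π^-⊖ m n)
    (cross (OS.solve 3 (λ p a b → a OS.:* (p OS.:* b) OS.:= p OS.:* a OS.:* b) O.refl O.π (O.π O.^ m) (O.π O.^ n)))

  π^-+ : ∀ m n → π^ (m ℤ.+ n) ≈ π^ m * π^ n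
  π^-+ (+ m)    (+ n)    = cross (O.*-congʳ (^-split m n))
  π^-+ (+ m)    -[1+ n ] = trans (π^-⊖ m (suc n)) (cross (O.*-congʳ (O.sym (O.*-identityʳ _))))
  π^-+ -[1+ m ] (+ n)    = trans (π^-⊖ n (suc m))
    (cross (O.*-cong (O.sym (O.*-identityˡ _)) (O.reflexive (≡.cong (O.π O.^_) (ℕₚ.+-identityʳ (suc m))))))
  π^-+ -[1+ m ] -[1+ n ] = cross (O.*-cong (O.sym (O.*-identityˡ _))
    (O.reflexive (≡.cong (λ k → O.π O.^ suc k) (ℕₚ.+-suc m n))))

  π^-cancel : ∀ m {x y} → π^ m * x ≈ π^ m * y → x ≈ y
  π^-cancel m {x} {y} eq = trans (sym (inverse x)) (trans (*-congˡ eq) (inverse y))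
    where
    inverse : ∀ x → π^ (ℤ.- m) * (π^ m * x) ≈ x
    inverse x = trans (sym (*-assoc _ _ _)) (trans (*-congʳ
      (trans (sym (π^-+ (ℤ.- m) m)) (reflexive (≡.cong π^_ (ℤProps.+-inverseˡ m))))) (*-identityˡ x))

  π^-split : ∀ m d a → π^ m * fromO (O.π O.^ d O.* a) ≈ π^ (m ℤ.+ + d) * fromO a
  π^-split m d a = trans (sym (*-assoc _ _ _)) (*-congʳ (sym (π^-+ m (+ d))))

  π^-*-* : ∀ m n a b → (π^ m * fromO a) * (π^ n * fromO b) ≈ π^ (m ℤ.+ n) * fromO (a O.* b)
  π^-*-* m n a b = trans
    (solve 4 (λ p q a b → (p :* a) :* (q :* b) := (p :* q) :* (a :* b)) refl (π^ m) (π^ n) (fromO a) (fromO b))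
    (*-congʳ (sym (π^-+ m n)))

  π∣π^1* : ∀ a → O.π O.∣ O.π O.^ 1 O.* a
  π∣π^1* a = a , OS.solve 2 (λ p a → a OS.:* p OS.:= p OS.:* OS.con (+ 1) OS.:* a) O.refl O.π a

  ∈-resp-≈ : ∀ {x y m} → x ≈ y → x ∈π^ m → y ∈π^ m
  ∈-resp-≈ x≈y (multiple eq) = multiple (trans (sym x≈y) eq)

  ∈-mono : ∀ {x m n} → n ℤ.≤ m → x ∈π^ m → x ∈π^ n
  ∈-mono {x} {m} {n} n≤m (multiple {q} eq) = weaken (≤⇒+ n≤m)
    where
    weaken : (∃ λ d → m ≡ n ℤ.+ + d) → x ∈π^ n
    weaken (d , ≡.refl) = multiple (trans eq (sym (π^-split n d q)))

  ∈-0 : ∀ {m} → 0# ∈π^ m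
  ∈-0 {m} = multiple {quotient = O.0#} (sym (zeroʳ (π^ m)))

  ∈-+ : ∀ {x y m} → x ∈π^ m → y ∈π^ m → x + y ∈π^ m
  ∈-+ {m = m} (multiple {a} eq) (multiple {b} eq′) = multiple (trans (+-cong eq eq′)
    (trans (solve 3 (λ p a b → p :* a :+ p :* b := p :* (a :+ b)) refl (π^ m) (fromO a) (fromO b))
      (*-congˡ (sym (fromO-+ a b)))))

  ∈-neg : ∀ {x m} → x ∈π^ m → - x ∈π^ m
  ∈-neg {m = m} (multiple {a} eq) = multiple (trans (-‿cong eq)
    (solve 2 (λ p a → :- (p :* a) := p :* :- a) refl (π^ m) (fromO a)))

  ∈-* : ∀ {x y m n} → x ∈π^ m → y ∈π^ n → x * y ∈π^ m ℤ.+ n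
  ∈-* {m = m} {n} (multiple {a} eq) (multiple {b} eq′) = multiple (trans (*-cong eq eq′) (π^-*-* m n a b))

  unit⇒∼ : ∀ {x m a} → ¬ (O.π O.∣ a) → x ≈ π^ m * fromO a → Exactly _∈π^_ x m
  unit⇒∼ {x} {m} {a} unit eq = exactly (multiple eq) λ { (multiple {b} eq′) →
    unit (∣-resp (fromO-injective (π^-cancel m (trans (π^-split m 1 b) (trans (sym eq′) eq)))) (π∣π^1* b)) }

  ∼⇒unit : ∀ {x m} → Exactly _∈π^_ x m → ∃ λ a → ¬ (O.π O.∣ a) × x ≈ π^ m * fromO a
  ∼⇒unit {m = m} (exactly (multiple {a} eq) x∉) = a , (λ { (b , bπ≈a) → x∉ (multiple (trans eq
    (trans (*-congˡ (fromO-cong (O.trans (O.sym bπ≈a) (OS.solve 2 (λ b p → b OS.:* p OS.:= p OS.:* OS.con (+ 1) OS.:* b) O.refl b O.π))))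
      (π^-split m 1 b)))) }) , eq

  -- Primality of π, obtained by inverting `a`.
  unit-* : ∀ {a b} → ¬ (O.π O.∣ a) → ¬ (O.π O.∣ b) → ¬ (O.π O.∣ a O.* b)
  unit-* {a} {b} h k (q , eq) =
    let (a⁻¹ , inv) = O.π∤⇒unit a h in
    k (a⁻¹ O.* q , O.trans (O.*-assoc _ _ _) (O.trans (O.*-congˡ eq)
      (O.trans (O.sym (O.*-assoc _ _ _)) (O.trans (O.*-congʳ inv) (O.*-identityˡ b)))))

  ∼-* : ∀ {x y m n} → Exactly _∈π^_ x m → Exactly _∈π^_ y n → Exactly _∈π^_ (x * y) (m ℤ.+ n)
  ∼-* {m = m} {n} h k with ∼⇒unit h | ∼⇒unit k
  ... | a , a-unit , eq | b , b-unit , eq′ = unit⇒∼ (unit-* a-unit b-unit) (trans (*-cong eq eq′) (π^-*-* m n a b))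

  ν-∼ : ∀ x (x#0 : x # 0#) → Exactly _∈π^_ x (ν x x#0)
  ν-∼ (a /π^ e) x#0 = unit⇒∼ isUnit (trans
    (cross (O.*-cong (O.trans (O.sym factorise) (O.*-comm unit _)) (O.reflexive (≡.cong (O.π O.^_) (ℕₚ.+-identityʳ e)))))
    (*-congʳ (trans (sym (π^-⊖ order e)) (reflexive (≡.cong π^_ (≡.sym (ℤProps.m-n≡m⊖n order e)))))))
    where open Factorisation (factorisation a (num-nonZero (a /π^ e) x#0))

  -- Vanishing of x cannot be decided, but one test of the numerator can: if the power of π with
  -- exponent ∣m + e∣ divides it, then x lies in πᵐ, and if not, x is apart from 0.
  ∈⊎#0 : ∀ x m → x ∈π^ m ⊎ x # 0#
  ∈⊎#0 (a /π^ e) m with π^∣? ℤ.∣ m ℤ.+ + e ∣ a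
  ... | no  h        = inj₂ (#0-intro (ℤ.∣ m ℤ.+ + e ∣ , h))
  ... | yes (q , eq) = inj₁ (∈-mono m≤ (multiple {m = N ℤ.⊖ e} {quotient = q}
    (sym (trans (*-congʳ (π^-⊖ N e)) (cross (O.*-cong (O.trans (O.*-comm _ q) eq)
      (O.reflexive (≡.cong (O.π O.^_) (≡.sym (ℕₚ.+-identityʳ e))))))))))
    where
    N : ℕ
    N = ℤ.∣ m ℤ.+ + e ∣
    m≤ : m ℤ.≤ N ℤ.⊖ e
    m≤ = ≡.subst (m ℤ.≤_) (ℤProps.m-n≡m⊖n N e) (shift-≤ (cancel m (+ e) (+ N)) (i≤+∣i∣ (m ℤ.+ + e)))
      where
      cancel : ∀ m e n → n ℤ.- (m ℤ.+ e) ≡ n ℤ.- e ℤ.- m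
      cancel = solve-∀

  ∼⇒#0 : ∀ {x m} → Exactly _∈π^_ x m → x # 0#
  ∼⇒#0 {x} {m} h with ∈⊎#0 x (m ℤ.+ + 1)
  ... | inj₁ k   = ⊥-elim (∼-∉ h k)
  ... | inj₂ x#0 = x#0

  locate : ∀ x m → x ∈π^ m ⊎ ∃ λ n → n ℤ.< m × Exactly _∈π^_ x n
  locate x m with ∈⊎#0 x m
  ... | inj₁ h = inj₁ h
  ... | inj₂ x#0 with m ℤProps.≤? ν x x#0
  ...   | yes m≤ν = inj₁ (∈-mono m≤ν (∼⇒∈ (ν-∼ x x#0)))
  ...   | no  m≰ν = inj₂ (ν x x#0 , ℤProps.≰⇒> m≰ν , ν-∼ x x#0)

  discretelyValuedField : DiscretelyValuedField
  discretelyValuedField = record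
    { commutativeRing = commutativeRing
    ; _∈π^_ = _∈π^_ ; ∈-resp-≈ = ∈-resp-≈ ; ∈-mono = ∈-mono ; ∈-0 = ∈-0 ; ∈-+ = ∈-+ ; ∈-neg = ∈-neg ; ∈-* = ∈-*
    ; ∼-1 = unit⇒∼ O.π∤1 (sym (*-identityˡ 1#)) ; ∼-* = ∼-* ; locate = locate
    ; invertible = λ h → _ , ⁻¹-inverseˡ (∼⇒#0 h) }

-- D m z stands for πᵐ ∣ z, in a form suited to the class map, such as a
-- condition on the mth residue.
module FractionResidues (O : DVR) (p : ℕ) (class : ∀ m → DVR.Carrier O → Fin (p ℕ.^ m))
  (D : ℕ → DVR.Carrier O → Set)
  (D-step : ∀ m z → D (suc m) z → ∃ λ q → DVR._≈_ O (DVR._*_ O q (DVR.π O)) z × D m q)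
  (class-injective : ∀ m z w → class m z ≡ class m w → D m (DVR._-_ O z w)) where
  private module O = DVR O
  open FractionValuation O
  open DiscretelyValuedField discretelyValuedField using
    (_-_; _*_; sym; trans; refl; +-cong; -‿cong; *-congˡ; solve; _:=_; _:*_; _:-_)
  open ValuedField O using (π^_; fromO)
  open RawMagmaDefs (Semiring.*-rawMagma O.semiring) using (_,_)

  D⇒π^∣ : ∀ m z → D m z → (O.π O.^ m) O.∣ z
  D⇒π^∣ zero    z d = z , O.*-identityʳ z
  D⇒π^∣ (suc m) z d with D-step m z d
  ... | q , eq , d′ with D⇒π^∣ m q d′
  ...   | r , eq′ = r , O.trans (O.*-congˡ (O.*-comm O.π (O.π O.^ m)))
    (O.trans (O.sym (O.*-assoc r (O.π O.^ m) O.π)) (O.trans (O.*-congʳ eq′) eq))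

  residues : FiniteResidues discretelyValuedField p
  residues M m = (λ x x∈ → class m (_∈π^_.quotient x∈)) , λ x∈ y∈ → separate x∈ y∈
    where
    separate : ∀ {x y} (x∈ : x ∈π^ M) (y∈ : y ∈π^ M) →
      class m (_∈π^_.quotient x∈) ≡ class m (_∈π^_.quotient y∈) → x - y ∈π^ M ℤ.+ + m
    separate {x} {y} (multiple {z} eq) (multiple {w} eq′) same = combine (D⇒π^∣ m (z O.- w) (class-injective m z w same))
      where
      combine : (O.π O.^ m) O.∣ (z O.- w) → x - y ∈π^ M ℤ.+ + m
      combine (r , rπᵐ≈) = multiple {quotient = r} (trans (+-cong eq (-‿cong eq′))
        (trans (solve 3 (λ c z w → c :* z :- c :* w := c :* (z :- w)) refl (π^ M) (fromO z) (fromO w))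
          (trans (*-congˡ (trans (sym (fromO-+ z (O.- w))) (fromO-cong (O.trans (O.sym rπᵐ≈) (O.*-comm r (O.π O.^ m))))))
            (π^-split M m r))))

-- Embeddings of discrete valuation rings and of their fraction fields.

-- `embed-π` and `embed-reflect` express that the extension is unramified: the uniformizer is kept
-- and no unit becomes divisible by it, so valuations are preserved.
record DVREmbedding (O₀ O : DVR) : Set where
  private
    module O₀ = DVR O₀
    module O  = DVR O
  field
    embed         : O₀.Carrier → O.Carrier
    embed-cong    : ∀ {x y} → x O₀.≈ y → embed x O.≈ embed y
    embed-+       : ∀ x y → embed (x O₀.+ y) O.≈ embed x O.+ embed y
    embed-*       : ∀ x y → embed (x O₀.* y) O.≈ embed x O.* embed y
    embed-neg     : ∀ x → embed (O₀.- x) O.≈ O.- embed x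
    embed-1       : embed O₀.1# O.≈ O.1#
    embed-π       : embed O₀.π O.≈ O.π
    embed-reflect : ∀ {x} → O.π O.∣ embed x → O₀.π O₀.∣ x

identityEmbedding : ∀ O → DVREmbedding O O
identityEmbedding O = record
  { embed = λ x → x ; embed-cong = λ x≈y → x≈y ; embed-+ = λ _ _ → refl ; embed-* = λ _ _ → refl
  ; embed-neg = λ _ → refl ; embed-1 = refl ; embed-π = refl ; embed-reflect = λ h → h }
  where open DVR O

quadraticEmbedding : ∀ O d (inert : Inert O d) → DVREmbedding O (quadraticDVR O d inert)
quadraticEmbedding O d inert = record
  { embed = λ x → x +√d 0#
  ; embed-cong = λ x≈y → mk≈ x≈y refl
  ; embed-+ = λ x y → mk≈ refl (sym (+-identityˡ 0#))
  ; embed-* = λ x y → mk≈ (sym (trans (+-congˡ (trans (*-congˡ (zeroˡ 0#)) (zeroʳ d))) (+-identityʳ (x * y))))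
      (sym (trans (+-cong (zeroʳ x) (zeroˡ y)) (+-identityˡ 0#)))
  ; embed-neg = λ x → mk≈ refl (trans (sym (-‿inverseʳ 0#)) (+-identityˡ (- 0#)))
  ; embed-1 = mk≈ refl refl
  ; embed-π = mk≈ refl refl
  ; embed-reflect = π∣⇒π∣re O d inert }
  where
  open DVR O
  open QuadraticExtension commutativeRing d using (_+√d_; mk≈)

module FractionMultiples (O : DVR) where
  private
    module O = DVR O
    module OM = UnoptimisedMult O.semiring
  open FractionValuation O
  open DiscretelyValuedField discretelyValuedField
  open ValuedField O using (fromO)
  open Mult semiring using (1+×) renaming (_×_ to _·_)

  ×1≈fromO : ∀ n → n · 1# ≈ fromO (n OM.× O.1#)
  ×1≈fromO zero    = refl
  ×1≈fromO (suc n) = trans (1+× n 1#) (trans (+-congˡ (×1≈fromO n)) (sym (fromO-+ O.1# (n OM.× O.1#))))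

  uniformizer : ∀ n → (n OM.× O.1#) O.≈ O.π → n · 1# ∼π^ + 1
  uniformizer n n≈π = unit⇒∼ {a = O.1#} O.π∤1 (trans (×1≈fromO n) (fromO-cong
    (O.trans n≈π (O.sym (O.trans (O.*-identityʳ (O.π O.^ 1)) (O.*-identityʳ O.π))))))

-- The map ι is given together with its defining equation, so that the result applies to the very ι
-- of the theorem.
module FractionEmbedding (O₀ O : DVR) (embedding : DVREmbedding O₀ O)
  (ι : FractionField.Frac O₀ → FractionField.Frac O)
  (ι-/π≡ : ∀ a e → ι (FractionField._/π^_ a e) ≡ FractionField._/π^_ (DVREmbedding.embed embedding a) e)
  where
  open DVREmbedding embedding
  private
    module O₀ = DVR O₀
    module O  = DVR O
    module K  = ValuedField O₀
    module F  = ValuedField O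
    module KV = FractionValuation O₀
    module FV = FractionValuation O
    module Kᶠ = DiscretelyValuedField KV.discretelyValuedField
    module Fᶠ = DiscretelyValuedField FV.discretelyValuedField
  open FractionField O₀ using (_/π^_; cross)

  embed-^ : ∀ n → embed (O₀.π O₀.^ n) O.≈ O.π O.^ n
  embed-^ zero    = embed-1
  embed-^ (suc n) = O.trans (embed-* _ _) (O.*-cong embed-π (embed-^ n))

  private
    mk : O.Carrier → ℕ → F.Frac
    mk a e = F._/π^_ a e

    mk-cong : ∀ {a b} e → a O.≈ b → mk a e F.≈ mk b e
    mk-cong e a≈b = F.cross (O.*-congʳ a≈b)

    ι-/π : ∀ a e → ι (a /π^ e) F.≈ mk (embed a) e
    ι-/π a e = Fᶠ.reflexive (ι-/π≡ a e)

  ι-cong : ∀ {x y} → x K.≈ y → ι x F.≈ ι y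
  ι-cong {a /π^ e} {b /π^ f} (cross eq) = Fᶠ.trans (ι-/π a e) (Fᶠ.trans (F.cross
    (O.trans (O.*-congˡ (O.sym (embed-^ f))) (O.trans (O.sym (embed-* a _)) (O.trans (embed-cong eq)
      (O.trans (embed-* b _) (O.*-congˡ (embed-^ e))))))) (Fᶠ.sym (ι-/π b f)))

  ι-+ : ∀ x y → ι (x K.+ y) F.≈ ι x F.+ ι y
  ι-+ (a /π^ e) (b /π^ f) = Fᶠ.trans (ι-/π _ (e ℕ.+ f)) (Fᶠ.trans
    (mk-cong (e ℕ.+ f) (O.trans (embed-+ _ _) (O.+-cong
      (O.trans (embed-* a _) (O.*-congˡ (embed-^ f))) (O.trans (embed-* b _) (O.*-congˡ (embed-^ e))))))
    (Fᶠ.sym (Fᶠ.+-cong (ι-/π a e) (ι-/π b f))))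

  ι-* : ∀ x y → ι (x K.* y) F.≈ ι x F.* ι y
  ι-* (a /π^ e) (b /π^ f) = Fᶠ.trans (ι-/π _ (e ℕ.+ f)) (Fᶠ.trans (mk-cong (e ℕ.+ f) (embed-* a b))
    (Fᶠ.sym (Fᶠ.*-cong (ι-/π a e) (ι-/π b f))))

  ι-neg : ∀ x → ι (K.- x) F.≈ F.- ι x
  ι-neg (a /π^ e) = Fᶠ.trans (ι-/π _ e) (Fᶠ.trans (mk-cong e (embed-neg a)) (Fᶠ.sym (Fᶠ.-‿cong (ι-/π a e))))

  ι-1 : ι K.1# F.≈ F.1#
  ι-1 = Fᶠ.trans (ι-/π _ 0) (mk-cong 0 embed-1)

  ι-π^ : ∀ m → ι (K.π^ m) F.≈ F.π^ m
  ι-π^ (+ n)    = Fᶠ.trans (ι-/π _ 0) (mk-cong 0 (embed-^ n))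
  ι-π^ -[1+ n ] = Fᶠ.trans (ι-/π _ (suc n)) (mk-cong (suc n) embed-1)

  ι-π^* : ∀ {x} m a → x K.≈ K.π^ m K.* K.fromO a → ι x F.≈ F.π^ m F.* F.fromO (embed a)
  ι-π^* m a eq = Fᶠ.trans (ι-cong eq) (Fᶠ.trans (ι-* _ _) (Fᶠ.*-cong (ι-π^ m) (ι-/π a 0)))

  ι-∈ : ∀ {x m} → x KV.∈π^ m → ι x FV.∈π^ m
  ι-∈ {m = m} (KV.multiple {a} eq) = FV.multiple (ι-π^* m a eq)

  ι-∼ : ∀ {x m} → x Kᶠ.∼π^ m → ι x Fᶠ.∼π^ m
  ι-∼ {x} {m} h = embedded (KV.∼⇒unit h)
    where
    embedded : (∃ λ a → ¬ (O₀.π O₀.∣ a) × x K.≈ K.π^ m K.* K.fromO a) → ι x Fᶠ.∼π^ m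
    embedded (a , unit , eq) = FV.unit⇒∼ (λ d → unit (embed-reflect d)) (ι-π^* m a eq)

  -- If x had an exact valuation below m, then ι x would have the same one.
  ι-∈⁻¹ : ∀ {x m} → ι x FV.∈π^ m → x KV.∈π^ m
  ι-∈⁻¹ {x} {m} ιx∈ = located (KV.locate x m)
    where
    located : x KV.∈π^ m ⊎ (∃ λ n → n ℤ.< m × x Kᶠ.∼π^ n) → x KV.∈π^ m
    located (inj₁ x∈)             = x∈
    located (inj₂ (n , n<m , x∼)) = ⊥-elim (ℤProps.<⇒≱ n<m (Fᶠ.∼⇒≤ (ι-∼ x∼) ιx∈))

  valuedEmbedding : ValuedEmbedding KV.discretelyValuedField FV.discretelyValuedField
  valuedEmbedding = record
    { ι = ι ; ι-cong = ι-cong ; ι-+ = ι-+ ; ι-* = ι-* ; ι-neg = ι-neg ; ι-1 = ι-1 ; ι-∈ = ι-∈ ; ι-∈⁻¹ = ι-∈⁻¹ }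

module _ (K F : DiscretelyValuedField) (embedding : ValuedEmbedding K F) where
  private
    module K = DiscretelyValuedField K
    module F = DiscretelyValuedField F
    module KM = Mult K.semiring
    module FM = Mult F.semiring
  open ValuedEmbedding embedding

  ι-0 : ι K.0# F.≈ F.0#
  ι-0 = F.trans (ι-cong (K.sym (K.-‿inverseʳ K.0#))) (F.trans (ι-sub K.0# K.0#) (F.-‿inverseʳ (ι K.0#)))

  ι-× : ∀ n → ι (n KM.× K.1#) F.≈ n FM.× F.1#
  ι-× zero    = ι-0
  ι-× (suc n) = F.trans (ι-cong (KM.1+× n K.1#)) (F.trans (ι-+ _ _) (F.trans (F.+-cong ι-1 (ι-× n)) (F.sym (FM.1+× n F.1#))))

IsUniformizer : DiscretelyValuedField → ℕ → Set
IsUniformizer V n = (n · 1#) ∼π^ + 1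
  where
  open DiscretelyValuedField V
  open Mult semiring using () renaming (_×_ to _·_)

%ℕ-cong⇒∣ : ∀ a b d .{{_ : ℕ.NonZero d}} → a ℤDivMod.%ℕ d ≡ b ℤDivMod.%ℕ d → + d ℤ∣.∣ a ℤ.- b
%ℕ-cong⇒∣ a b d eq = divides (a ℤDivMod./ℕ d ℤ.- b ℤDivMod./ℕ d) (≡.trans
  (≡.cong₂ ℤ._-_ (ℤDivMod.a≡a%ℕn+[a/ℕn]*n a d) (≡.trans (ℤDivMod.a≡a%ℕn+[a/ℕn]*n b d) (≡.cong (λ r → + r ℤ.+ (b ℤDivMod./ℕ d) ℤ.* + d) (≡.sym eq))))
  (cancel (+ (a ℤDivMod.%ℕ d)) (a ℤDivMod./ℕ d) (b ℤDivMod./ℕ d) (+ d)))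
  where
  cancel : ∀ r x y d → r ℤ.+ x ℤ.* d ℤ.- (r ℤ.+ y ℤ.* d) ≡ (x ℤ.- y) ℤ.* d
  cancel = solve-∀

-- The field ℚₚ and its unramified quadratic extensions.

module PAdicFields (p : ℕ) (p-prime : Prime p) (p≥3 : 3 ℕ.≤ p) where
  open PAdic p p-prime p≥3
  open PAdicInteger
  open RawMagmaDefs (CommutativeRing.*-rawMagma ℤₚ-ring) using (_,_)
  open UnoptimisedMult (DVR.semiring ℤₚ) using () renaming (_×_ to _×ᵤ_)

  Vanishes : ℕ → PAdicInteger → Set
  Vanishes m z = P ℤ.^ m ℤ∣.∣ residue z m

  -- Residue m + 1 of z is congruent to p times that of the quotient q modulo pᵐ⁺¹. Hence pᵐ divides
  -- residue m + 1 of q, and by coherence residue m.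
  Vanishes-step : ∀ m z → Vanishes (suc m) z → ∃ λ q → DVR._≈_ ℤₚ (DVR._*_ ℤₚ q (DVR.π ℤₚ)) z × Vanishes m q
  Vanishes-step m z d = divided (P∣⇒ϖ∣ (cancel-sub′ {a = residue z (suc m)} {residue z 1} (mod-p z m) (P^⇒P m d)))
    where
    divided : ϖ Z.∣ z → ∃ λ q → DVR._≈_ ℤₚ (DVR._*_ ℤₚ q (DVR.π ℤₚ)) z × Vanishes m q
    divided (q , congruent h) = q , congruent h , cancel-sub′ {a = residue q (suc m)} {residue q m} (coherent q m)
      (ℤ∣.*-cancelˡ-∣ P {P ℤ.^ m} (∣-subst (ℤProps.*-comm (residue q (suc m)) P)
        (cancel-sub {a = residue q (suc m) ℤ.* P} {residue z (suc m)} (h (suc m)) d)))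

  pos-^ : ∀ m → + (p ℕ.^ m) ≡ P ℤ.^ m
  pos-^ zero    = ≡.refl
  pos-^ (suc m) = ≡.trans (ℤProps.pos-* p (p ℕ.^ m)) (≡.cong (P ℤ.*_) (pos-^ m))

  p^≢0 : ∀ m → ℕ.NonZero (p ℕ.^ m)
  p^≢0 m = ℕₚ.m^n≢0 p m {{prime⇒nonZero p-prime}}

  residueClass : ∀ m → PAdicInteger → Fin (p ℕ.^ m)
  residueClass m z = Fin.fromℕ< (ℤDivMod.n%ℕd<d (residue z m) (p ℕ.^ m) {{p^≢0 m}})

  residueClass-injective : ∀ m z w → residueClass m z ≡ residueClass m w → Vanishes m (DVR._-_ ℤₚ z w)
  residueClass-injective m z w eq = ≡.subst (ℤ∣._∣ (residue z m ℤ.- residue w m)) (pos-^ m)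
    (%ℕ-cong⇒∣ (residue z m) (residue w m) (p ℕ.^ m) {{p^≢0 m}}
      (≡.trans (≡.sym (Finₚ.toℕ-fromℕ< _)) (≡.trans (≡.cong Fin.toℕ eq) (Finₚ.toℕ-fromℕ< _))))

  ℚₚ-field : DiscretelyValuedField
  ℚₚ-field = FractionValuation.discretelyValuedField ℤₚ

  ℚₚ-residues : FiniteResidues ℚₚ-field p
  ℚₚ-residues = FractionResidues.residues ℤₚ p residueClass Vanishes Vanishes-step residueClass-injective

  extension : Ambient → DiscretelyValuedField
  extension A = FractionValuation.discretelyValuedField (integers A)

  ℤₚ-embedding : ∀ A → DVREmbedding ℤₚ (integers A)
  ℤₚ-embedding base                           = identityEmbedding ℤₚ
  ℤₚ-embedding (quadratic d d-unit d-nonSquare) = quadraticEmbedding ℤₚ d (inert d d-unit d-nonSquare)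

  -- The two descriptions of the embedding of ℤₚ agree by computation only once `A` is known.
  ι-/π : ∀ A a e → Field.ι A (FractionField._/π^_ a e) ≡ FractionField._/π^_ (DVREmbedding.embed (ℤₚ-embedding A) a) e
  ι-/π base              a e = ≡.refl
  ι-/π (quadratic _ _ _) a e = ≡.refl

  ℚₚ-embedding : ∀ A → ValuedEmbedding ℚₚ-field (extension A)
  ℚₚ-embedding A = FractionEmbedding.valuedEmbedding ℤₚ (integers A) (ℤₚ-embedding A) (Field.ι A) (ι-/π A)

  ×1≈ϖ : ∀ n k → residue (n ×ᵤ DVR.1# ℤₚ) k ≡ + n
  ×1≈ϖ zero    k = ≡.refl
  ×1≈ϖ (suc n) k = ≡.cong (λ z → + 1 ℤ.+ z) (×1≈ϖ n k)

  ℚₚ-uniformizer : IsUniformizer ℚₚ-field p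
  ℚₚ-uniformizer = FractionMultiples.uniformizer ℤₚ p (congruent λ k → self {P ℤ.^ k} (×1≈ϖ p k))

  p-uniformizer : ∀ A → IsUniformizer (extension A) p
  p-uniformizer A = DiscretelyValuedField.∼-resp-≈ (extension A) (ι-× ℚₚ-field (extension A) (ℚₚ-embedding A) p)
    (ValuedEmbedding.ι-∼ (ℚₚ-embedding A) ℚₚ-uniformizer)

-- From the abstract results to the theorem.

module FieldLemmas (V : DiscretelyValuedField) where
  open DiscretelyValuedField V

  -- The power xˡ has valuation 0, being congruent to 1, and also valuation l m; as l ≥ 1, m = 0.
  root-of-1-mod-π : ∀ {x m} l → 1 ≤ l → x ∼π^ m → x ^ l - 1# ∈π^ + 1 → x ∼π^ + 0
  root-of-1-mod-π {x} {m} (suc l) _ x∼ h = ∼-cast (zero-factor (ℤProps.i*j≡0⇒i≡0∨j≡0 (+ suc l) (∼-unique (∼-^ (suc l) x∼) power∼))) x∼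
    where
    power∼ : x ^ suc l ∼π^ + 0
    power∼ = ∼-resp-≈ (solve 1 (λ y → con (+ 1) :+ (y :- con (+ 1)) := y) refl (x ^ suc l)) (∼-+ ∼-1 h)
    zero-factor : + suc l ≡ + 0 ⊎ m ≡ + 0 → m ≡ + 0
    zero-factor (inj₂ eq) = eq

  factor-binet : ∀ {c₁ c₂ λ₁ λ₂ t u x} → t * c₂ ≈ c₁ → u * λ₁ ≈ λ₂ → ∀ n →
    x ≈ c₁ * λ₁ ^ n + c₂ * λ₂ ^ n → x ≈ c₂ * λ₁ ^ n * (t + u ^ n)
  factor-binet {c₁} {c₂} {λ₁} {λ₂} {t} {u} tc₂≈c₁ uλ₁≈λ₂ n eq = trans eq (trans
    (+-cong (*-congʳ (sym tc₂≈c₁)) (*-congˡ (trans (^-congˡ n (sym uλ₁≈λ₂)) (CommutativeExp.^-distrib-* commutativeSemiring u λ₁ n))))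
    (solve 4 (λ t c v w → t :* c :* v :+ c :* (w :* v) := c :* v :* (t :+ w)) refl t c₂ (λ₁ ^ n) (u ^ n)))

  difference : ∀ {λ₁ λ₂ u} → u * λ₁ ≈ λ₂ → λ₂ - λ₁ ≈ λ₁ * (u - 1#)
  difference {λ₁} {λ₂} {u} uλ₁≈λ₂ = trans (+-congʳ (sym uλ₁≈λ₂))
    (solve 2 (λ u v → u :* v :- v := v :* (u :- con (+ 1))) refl u λ₁)

  neg-sub : ∀ t y → - t - y ≈ - (t + y)
  neg-sub = solve 2 (λ t y → :- t :- y := :- (t :+ y)) refl

  sub-neg : ∀ t y → y - - t ≈ t + y
  sub-neg = solve 2 (λ t y → y :- :- t := t :+ y) refl

  minus-zero : ∀ x → x - 0# ≈ x
  minus-zero = solve 1 (λ x → x :- con (+ 0) := x) refl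

  sum-of-roots : ∀ {λ₁ λ₂ u} → u * λ₁ ≈ λ₂ → λ₁ * (1# + u) ≈ λ₁ + λ₂
  sum-of-roots {λ₁} {λ₂} {u} uλ₁≈λ₂ = trans (solve 2 (λ u v → v :* (con (+ 1) :+ u) := v :+ u :* v) refl u λ₁) (+-congˡ uλ₁≈λ₂)

  shift-right : ∀ {x c y} → x ≈ c + y → x - c ≈ y
  shift-right {x} {c} {y} eq = trans (+-congʳ eq) (solve 2 (λ c y → c :+ y :- c := y) refl c y)

  shift-left : ∀ {x c y} → x - c ≈ y → x ≈ c + y
  shift-left {x} {c} {y} eq = trans (solve 2 (λ x c → x := c :+ (x :- c)) refl x c) (+-congˡ eq)

module CosetConversions (O : DVR) where
  open ValuedField O
  open FractionValuation O
  open FieldLemmas discretelyValuedField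

  modπ⇒∈ : ∀ {x y m} → x ≡ y [modπ^ m ] → x - y ∈π^ m
  modπ⇒∈ (z , eq) = multiple eq

  ∈⇒modπ : ∀ {x y m} → x - y ∈π^ m → x ≡ y [modπ^ m ]
  ∈⇒modπ (multiple {z} eq) = z , eq

  coset⇒∈ : ∀ {c m x} → Coset c m x → x - c ∈π^ m
  coset⇒∈ (z , eq) = multiple (shift-right eq)

  ∈⇒coset : ∀ {c m x} → x - c ∈π^ m → Coset c m x
  ∈⇒coset (multiple {z} eq) = z , shift-left eq

-- The three cases for Kepler sets over fields of fractions.

module KeplerSets
  (O₀ O : DVR)
  (embedding : ValuedEmbedding (FractionValuation.discretelyValuedField O₀) (FractionValuation.discretelyValuedField O))
  (p : ℕ) (p-prime : Prime p) (p≥3 : 3 ≤ p)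
  (residues : FiniteResidues (FractionValuation.discretelyValuedField O₀) p)
  where

  private
    module K  = ValuedField O₀
    module KV = FractionValuation O₀
    module Kᶠ = DiscretelyValuedField KV.discretelyValuedField
    module KC = CosetConversions O₀
  open ValuedField O
  open FractionValuation O using (discretelyValuedField; ν-∼; ∼⇒#0; multiple)
  open CosetConversions O
  open ValuedEmbedding embedding
  private module F = DiscretelyValuedField discretelyValuedField
  open F using (_∈π^_; _∼π^_)
  open FieldLemmas discretelyValuedField
  open Mult F.semiring using () renaming (_×_ to _·_)

  ν-unique : ∀ {x m} (x#0 : x # 0#) → x ∼π^ m → ν x x#0 ≡ m
  ν-unique x#0 = F.∼-unique (ν-∼ _ x#0)

  module Theorem
    (p-uniformizer : p · 1# ∼π^ + 1) (2≠0 : 2# # 0#)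
    (a : ℕ → K.Frac) (r s : K.Frac)
    (recurrence : ∀ n → a (2 ℕ.+ n) K.≈ ((r K.* a (1 ℕ.+ n)) K.+ (s K.* a n)))
    (c₁ c₂ λ₁ λ₂ : Frac) (c₁≠0 : c₁ # 0#) (c₂≠0 : c₂ # 0#) (λ₁≠0 : λ₁ # 0#) (λ₂≠0 : λ₂ # 0#)
    (binet : ∀ n → ι (a n) ≈ (c₁ * λ₁ ^ n) + (c₂ * λ₂ ^ n))
    (u-nonTorsion : NotRootOfUnity (λ₂ / λ₁ ⟨ λ₁≠0 ⟩))
    (l : ℕ) (l-order : OrderModπ (λ₂ / λ₁ ⟨ λ₁≠0 ⟩) l)
    where

    u t : Frac
    u = λ₂ / λ₁ ⟨ λ₁≠0 ⟩
    t = c₁ / c₂ ⟨ c₂≠0 ⟩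

    uˡ-1≠0 : u ^ l - 1# # 0#
    uˡ-1≠0 = #⇒-#0 (u-nonTorsion l (OrderModπ.positive l-order))

    k νt νΔ : ℤ
    k  = ν ((u ^ l) - 1#) uˡ-1≠0
    νt = ν t (/-#0 c₁≠0 c₂≠0)
    νΔ = ν (λ₂ - λ₁) (ratio⇒-#0 λ₁≠0 u-nonTorsion)

    uˡ-1∈ : u ^ l - 1# ∈π^ + 1
    uˡ-1∈ = modπ⇒∈ (OrderModπ.power l-order)

    u∼ : u ∼π^ + 0
    u∼ = root-of-1-mod-π l (OrderModπ.positive l-order) (ν-∼ u (/-#0 λ₂≠0 λ₁≠0)) uˡ-1∈

    -- ε is defined by subtraction, so that δ = ℓ + ε agrees with ν(λ₂ - λ₁) by integer arithmetic;
    -- that it is the valuation of u - 1 then follows from λ₂ - λ₁ = λ₁ (u - 1).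
    ℓ ε : ℤ
    ℓ = ν λ₁ λ₁≠0
    ε = νΔ ℤ.- ℓ

    λ₁∼ : λ₁ ∼π^ ℓ
    λ₁∼ = ν-∼ λ₁ λ₁≠0

    ℓ+ε≡νΔ : ℓ ℤ.+ ε ≡ νΔ
    ℓ+ε≡νΔ = cancel ℓ νΔ
      where
      cancel : ∀ x y → x ℤ.+ (y ℤ.- x) ≡ y
      cancel = solve-∀

    u-1∼ : u - 1# ∼π^ ε
    u-1∼ = F.∼-cancel λ₁∼ (F.∼-cast (≡.sym ℓ+ε≡νΔ) (F.∼-resp-≈ (difference (/-*-cancel λ₂ λ₁≠0)) (ν-∼ _ (ratio⇒-#0 λ₁≠0 u-nonTorsion))))

    open LinearRecurrence KV.discretelyValuedField discretelyValuedField embedding p p-prime p≥3 residues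
    open Orbit p-uniformizer u u∼ l (OrderModπ.positive l-order) uˡ-1∈
      (λ j 1≤j j<l h → OrderModπ.minimal l-order j 1≤j j<l (∈⇒modπ h)) k (ν-∼ _ uˡ-1≠0)
    open Sequence λ₁ ℓ λ₁∼ c₂ (ν c₂ c₂≠0) (ν-∼ c₂ c₂≠0) t νt (ν-∼ t (/-#0 c₁≠0 c₂≠0)) ε u-1∼ a
      (λ n → factor-binet (/-*-cancel c₁ c₂≠0) (/-*-cancel λ₂ λ₁≠0) n (binet n)) r s recurrence

    νλ₂≡ℓ : ν λ₂ λ₂≠0 ≡ ℓ
    νλ₂≡ℓ = ν-unique λ₂≠0 (F.∼-cast (ℤProps.+-identityˡ ℓ) (F.∼-resp-≈ (/-*-cancel λ₂ λ₁≠0) (F.∼-* u∼ λ₁∼)))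

    quotient-isRatio : ∀ {n} (aₙ≠0 : a n K.# K.0#) → IsRatio n (a (suc n) K./ a n ⟨ aₙ≠0 ⟩)
    quotient-isRatio {n} aₙ≠0 = is-ratio (KV.ν-∼ (a n) aₙ≠0) (K./-*-cancel (a (suc n)) aₙ≠0)

    ratios⇒isRatio : ∀ {y} → K.Ratios a y → ∃ λ n → IsRatio n y
    ratios⇒isRatio (n , aₙ≠0 , y≈) = n , is-ratio (KV.ν-∼ (a n) aₙ≠0) (Kᶠ.trans (Kᶠ.*-congʳ y≈) (K./-*-cancel (a (suc n)) aₙ≠0))

    isRatio⇒ratios : ∀ {y} → (∃ λ n → IsRatio n y) → K.Ratios a y
    isRatio⇒ratios (n , h) = n , aₙ≠0 , ratio-unique h (quotient-isRatio aₙ≠0)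
      where
      aₙ≠0 : a n K.# K.0#
      aₙ≠0 = KV.∼⇒#0 (IsRatio.nonzero h)

    kepler⇒ : ∀ {x} → x ∈ K.KeplerSet a → Kepler x
    kepler⇒ {x} h m = convert (h m)
      where
      convert : (∃ λ y → K.Ratios a y × x K.≡ y [modπ^ + m ]) → ∃ λ y → (∃ λ n → IsRatio n y) × x Kᶠ.- y Kᶠ.∈π^ + m
      convert (y , y-ratio , near) = y , ratios⇒isRatio y-ratio , KC.modπ⇒∈ near

    ⇒kepler : ∀ {x} → Kepler x → x ∈ K.KeplerSet a
    ⇒kepler {x} h m = convert (h m)
      where
      convert : (∃ λ y → (∃ λ n → IsRatio n y) × x Kᶠ.- y Kᶠ.∈π^ + m) → ∃ λ y → K.Ratios a y × x K.≡ y [modπ^ + m ]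
      convert (y , y-ratio , near) = y , isRatio⇒ratios y-ratio , KC.∈⇒modπ near

    Λ⇒dense : (- t) ∈ Closure (Powers u) → Dense
    Λ⇒dense h m = convert (h m)
      where
      convert : (∃ λ y → Powers u y × (- t) ≡ y [modπ^ + m ]) → ∃ λ n → X n ∈π^ + m
      convert (y , (n , y≈uⁿ) , near) = n , F.∈-resp-≈ (F.-‿involutive _) (F.∈-neg (F.∈-resp-≈
        (F.trans (F.+-congˡ (F.-‿cong y≈uⁿ)) (neg-sub t (u ^ n))) (modπ⇒∈ near)))

    dense⇒Λ : Dense → (- t) ∈ Closure (Powers u)
    dense⇒Λ h m = convert (h m)
      where
      convert : (∃ λ n → X n ∈π^ + m) → ∃ λ y → Powers u y × (- t) ≡ y [modπ^ + m ]
      convert (n , near) = u ^ n , (n , F.refl) , ∈⇒modπ (F.∈-resp-≈ (F.sym (neg-sub t (u ^ n))) (F.∈-neg near))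

    part₁ : (- t) ∉ Closure (Powers u) →
      Σ (∀ i → i < l → a i K.# K.0#) λ a≠0 →
      Σ (∀ i → i < l → (t + (u ^ i)) # 0#) λ t+uⁱ≠0 →
      let piece : Σ ℕ (_< l) → K.Frac → Set
          piece = λ (i , i<l) → K.Coset (a (suc i) K./ a i ⟨ a≠0 i i<l ⟩)
            (((νt ℤ.+ νΔ) ℤ.- (+ 2 ℤ.* ν (t + (u ^ i)) (t+uⁱ≠0 i i<l))) ℤ.+ k)
      in
      (K.KeplerSet a ≐ ⋃ (Σ ℕ (_< l)) piece) × DisjointFamily piece
    part₁ -t∉Λ = a≠0 , X≠0 , (included , includes) , disjoint
      where
      ¬dense : ¬ Dense
      ¬dense dense = -t∉Λ (dense⇒Λ dense)
      X≠0 : ∀ i → i < l → X i # 0#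
      X≠0 i _ = ∼⇒#0 (proj₂ (proj₂ (far ¬dense i)))
      a≠0 : ∀ i → i < l → a i K.# K.0#
      a≠0 i i<l = KV.∼⇒#0 (ι-∼⁻¹ (a∼ i (ν-∼ (X i) (X≠0 i i<l))))
      x : ∀ i → i < l → ℤ
      x i i<l = ν (X i) (X≠0 i i<l)
      q : ∀ i → i < l → K.Frac
      q i i<l = a (suc i) K./ a i ⟨ a≠0 i i<l ⟩
      piece : Σ ℕ (_< l) → K.Frac → Set
      piece = λ (i , i<l) → K.Coset (q i i<l) (((νt ℤ.+ νΔ) ℤ.- (+ 2 ℤ.* x i i<l)) ℤ.+ k)
      radius≡ : ∀ x → radius x ≡ ((νt ℤ.+ νΔ) ℤ.- (+ 2 ℤ.* x)) ℤ.+ k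
      radius≡ x = ≡.cong (λ δ → ((νt ℤ.+ δ) ℤ.- + 2 ℤ.* x) ℤ.+ k) ℓ+ε≡νΔ
      included : ∀ {y} → y ∈ K.KeplerSet a → y ∈ ⋃ (Σ ℕ (_< l)) piece
      included {y} y∈K = convert (kepler-far⊆ ¬dense (kepler⇒ y∈K))
        where
        convert : (∃ λ i → i < l × ∃ λ x → X i ∼π^ x × (∀ {q} → IsRatio i q → y Kᶠ.- q Kᶠ.∈π^ radius x)) → y ∈ ⋃ (Σ ℕ (_< l)) piece
        convert (i , i<l , x , Xᵢ∼ , h) = (i , i<l) , KC.∈⇒coset (Kᶠ.∈-cast
          (≡.trans (≡.cong radius (≡.sym (ν-unique (X≠0 i i<l) Xᵢ∼))) (radius≡ _)) (h (quotient-isRatio (a≠0 i i<l))))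
      includes : ∀ {y} → y ∈ ⋃ (Σ ℕ (_< l)) piece → y ∈ K.KeplerSet a
      includes ((i , i<l) , y∈) = ⇒kepler (kepler-far⊇ ¬dense (ν-∼ (X i) (X≠0 i i<l)) (quotient-isRatio (a≠0 i i<l))
        (Kᶠ.∈-cast (≡.sym (radius≡ _)) (KC.coset⇒∈ y∈)))
      disjoint : DisjointFamily piece
      disjoint (i , i<l) (j , j<l) i≢j (y∈ , y∈′) = kepler-far-disjoint ¬dense i<l j<l i≢j
        (ν-∼ (X i) (X≠0 i i<l)) (ν-∼ (X j) (X≠0 j j<l)) (quotient-isRatio (a≠0 i i<l)) (quotient-isRatio (a≠0 j j<l))
        (Kᶠ.∈-cast (≡.sym (radius≡ _)) (KC.coset⇒∈ y∈)) (Kᶠ.∈-cast (≡.sym (radius≡ _)) (KC.coset⇒∈ y∈′))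

    part₂ : (- t) ∈ Closure (Powers u) → l ≡ 1 →
      ∃ λ h → (ι h ≈ ((λ₁ + λ₂) / 2# ⟨ 2≠0 ⟩)) × (K.KeplerSet a ≐ ∁ (K.Coset h (+ 1 ℤ.+ ν λ₂ λ₂≠0)))
    part₂ -t∈Λ l≡1 = half half-trace
      where
      exponent : + 1 ℤ.+ (ℓ ℤ.+ ε ℤ.- k) ≡ + 1 ℤ.+ ν λ₂ λ₂≠0
      exponent = ≡.cong (λ x → + 1 ℤ.+ x) (≡.trans (≡.cong (λ ε → ℓ ℤ.+ ε ℤ.- k) (ε-single l≡1)) (≡.trans (cancel ℓ k) (≡.sym νλ₂≡ℓ)))
        where
        cancel : ∀ x k → x ℤ.+ k ℤ.- k ≡ x
        cancel = solve-∀
      half : (∃ λ h → ι h * 2# ≈ λ₁ * (1# + u)) →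
        ∃ λ h → (ι h ≈ ((λ₁ + λ₂) / 2# ⟨ 2≠0 ⟩)) × (K.KeplerSet a ≐ ∁ (K.Coset h (+ 1 ℤ.+ ν λ₂ λ₂≠0)))
      half (h , h≈) = h , ιh≈ ,
        (λ y∈K y∈ → kepler-single⊆ h h≈ l≡1 dense (kepler⇒ y∈K) (Kᶠ.∈-cast (≡.sym exponent) (KC.coset⇒∈ y∈))) ,
        (λ y∉ → ⇒kepler (kepler-single⊇ h h≈ dense (λ y∈ → y∉ (KC.∈⇒coset (Kᶠ.∈-cast exponent y∈)))))
        where
        dense : Dense
        dense = Λ⇒dense -t∈Λ
        ιh≈ : ι h ≈ ((λ₁ + λ₂) / 2# ⟨ 2≠0 ⟩)
        ιh≈ = F.*-cancelˡ 2∼ (F.trans (F.*-comm _ _) (F.trans h≈ (F.trans (sum-of-roots (/-*-cancel λ₂ λ₁≠0))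
          (F.trans (F.sym (/-*-cancel (λ₁ + λ₂) 2≠0)) (F.*-comm _ _)))))

    part₃ : (- t) ∈ Closure (Powers u) → 2 ≤ l →
      let IsIndex = λ σ → σ < l × ((u ^ σ) ≡ (- t) [modπ^ k ]) in
      ∃! _≡_ IsIndex ×
      (∀ σ → IsIndex σ →
        Σ (∀ i → i < l × i ≢ σ → a i K.# K.0#) λ a≠0 →
        let Index = Σ ℕ (λ i → i < l × i ≢ σ)
            piece : Index → K.Frac → Set
            piece = λ (i , i∈) → K.Coset (a (suc i) K./ a i ⟨ a≠0 i i∈ ⟩) (νΔ ℤ.+ k)
            outer = ∁ (K.Coset K.0# ((ν λ₂ λ₂≠0 ℤ.+ + 1) ℤ.- k))
        in
        (K.KeplerSet a ≐ (⋃ Index piece ∪ outer)) × DisjointFamily piece × (⋃ Index piece ⊥ outer))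
    part₃ -t∈Λ 2≤l = index (near-index (Λ⇒dense -t∈Λ)) , λ σ (σ<l , h) → pieces σ σ<l (index⇒near σ h)
      where
      index⇒near : ∀ σ → (u ^ σ) ≡ (- t) [modπ^ k ] → X σ ∈π^ k
      index⇒near σ h = F.∈-resp-≈ (sub-neg t (u ^ σ)) (modπ⇒∈ h)
      index : (∃ λ σ → σ < l × X σ ∈π^ k) → ∃! _≡_ (λ σ → σ < l × ((u ^ σ) ≡ (- t) [modπ^ k ]))
      index (σ , σ<l , Xσ∈) = σ , (σ<l , ∈⇒modπ (F.∈-resp-≈ (F.sym (sub-neg t (u ^ σ))) Xσ∈)) ,
        λ {i} (i<l , h) → near-unique σ<l Xσ∈ i<l (index⇒near i h)
      pieces : ∀ σ → σ < l → X σ ∈π^ k →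
        Σ (∀ i → i < l × i ≢ σ → a i K.# K.0#) λ a≠0 →
        let Index = Σ ℕ (λ i → i < l × i ≢ σ)
            piece : Index → K.Frac → Set
            piece = λ (i , i∈) → K.Coset (a (suc i) K./ a i ⟨ a≠0 i i∈ ⟩) (νΔ ℤ.+ k)
            outer = ∁ (K.Coset K.0# ((ν λ₂ λ₂≠0 ℤ.+ + 1) ℤ.- k))
        in
        (K.KeplerSet a ≐ (⋃ Index piece ∪ outer)) × DisjointFamily piece × (⋃ Index piece ⊥ outer)
      pieces σ σ<l Xσ∈ = a≠0 , (included , includes) , disjoint , separated
        where
        module S = Several 2≤l σ σ<l Xσ∈
        Index : Set
        Index = Σ ℕ (λ i → i < l × i ≢ σ)
        a≠0 : ∀ i → i < l × i ≢ σ → a i K.# K.0#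
        a≠0 i (i<l , i≢σ) = KV.∼⇒#0 (ι-∼⁻¹ (a∼ i (S.X∼0 i<l i≢σ)))
        piece : Index → K.Frac → Set
        piece = λ (i , i∈) → K.Coset (a (suc i) K./ a i ⟨ a≠0 i i∈ ⟩) (νΔ ℤ.+ k)
        ball outer : K.Frac → Set
        ball  = K.Coset K.0# ((ν λ₂ λ₂≠0 ℤ.+ + 1) ℤ.- k)
        outer = ∁ ball
        radius≡ : ℓ ℤ.+ ε ℤ.+ k ≡ νΔ ℤ.+ k
        radius≡ = ≡.cong (ℤ._+ k) ℓ+ε≡νΔ
        outer≡ : S.outer ≡ (ν λ₂ λ₂≠0 ℤ.+ + 1) ℤ.- k
        outer≡ = ≡.cong (λ x → (x ℤ.+ + 1) ℤ.- k) (≡.sym νλ₂≡ℓ)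
        ball⇒∈ : ∀ {y} → ball y → y Kᶠ.∈π^ S.outer
        ball⇒∈ {y} y∈ = Kᶠ.∈-resp-≈ (FieldLemmas.minus-zero KV.discretelyValuedField y) (Kᶠ.∈-cast (≡.sym outer≡) (KC.coset⇒∈ y∈))
        ∈⇒ball : ∀ {y} → y Kᶠ.∈π^ S.outer → ball y
        ∈⇒ball {y} y∈ = KC.∈⇒coset (Kᶠ.∈-cast outer≡ (Kᶠ.∈-resp-≈ (Kᶠ.sym (FieldLemmas.minus-zero KV.discretelyValuedField y)) y∈))
        piece⇒∈ : ∀ {y} ((i , i∈) : Index) → piece (i , i∈) y → y Kᶠ.- (a (suc i) K./ a i ⟨ a≠0 i i∈ ⟩) Kᶠ.∈π^ ℓ ℤ.+ ε ℤ.+ k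
        piece⇒∈ _ y∈ = Kᶠ.∈-cast (≡.sym radius≡) (KC.coset⇒∈ y∈)
        included : ∀ {y} → y ∈ K.KeplerSet a → y ∈ (⋃ Index piece ∪ outer)
        included {y} y∈K = convert (S.kepler⊆ (kepler⇒ y∈K))
          where
          convert : (∃ λ i → (i < l × i ≢ σ) × (∀ {q} → IsRatio i q → y Kᶠ.- q Kᶠ.∈π^ ℓ ℤ.+ ε ℤ.+ k)) ⊎ ¬ (y Kᶠ.∈π^ S.outer) →
            y ∈ (⋃ Index piece ∪ outer)
          convert (inj₁ (i , i∈ , h)) = inj₁ ((i , i∈) , KC.∈⇒coset (Kᶠ.∈-cast radius≡ (h (quotient-isRatio (a≠0 i i∈)))))
          convert (inj₂ y∉)           = inj₂ λ y∈ → y∉ (ball⇒∈ y∈)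
        includes : ∀ {y} → y ∈ (⋃ Index piece ∪ outer) → y ∈ K.KeplerSet a
        includes (inj₁ ((i , i∈@(i<l , i≢σ)) , y∈)) =
          ⇒kepler (S.kepler-piece i<l i≢σ (quotient-isRatio (a≠0 i i∈)) (piece⇒∈ (i , i∈) y∈))
        includes (inj₂ y∉) = ⇒kepler (S.kepler-outer λ y∈ → y∉ (∈⇒ball y∈))
        disjoint : DisjointFamily piece
        disjoint (i , i∈) (j , j∈) i≢j (y∈ , y∈′) = S.pieces-disjoint i∈ j∈ i≢j
          (quotient-isRatio (a≠0 i i∈)) (quotient-isRatio (a≠0 j j∈)) (piece⇒∈ (i , i∈) y∈) (piece⇒∈ (j , j∈) y∈′)
        separated : ⋃ Index piece ⊥ outer
        separated (((i , i∈) , y∈) , y∉) = y∉ (∈⇒ball (S.piece⊆ball i∈ (quotient-isRatio (a≠0 i i∈)) (piece⇒∈ (i , i∈) y∈)))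

theorem2 :
  (p : ℕ) (p-prime : Prime p) (p≥3 : 3 ≤ p) →
  let open PAdic p p-prime p≥3 in
  (A : Ambient) →
  let open Field A in
  (a : ℕ → ℚₚ.Frac) (r s : ℚₚ.Frac) →
  (∀ n → a (2 ℕ.+ n) ℚₚ.≈ ((r ℚₚ.* a (1 ℕ.+ n)) ℚₚ.+ (s ℚₚ.* a n))) →
  (c₁ c₂ λ₁ λ₂ : Frac) (c₁≠0 : c₁ # 0#) (c₂≠0 : c₂ # 0#) (λ₁≠0 : λ₁ # 0#) (λ₂≠0 : λ₂ # 0#) →
  (∀ n → ι (a n) ≈ (c₁ * λ₁ ^ n) + (c₂ * λ₂ ^ n)) →
  ∣ λ₁ ∣⟨ λ₁≠0 ⟩ ≡ ∣ λ₂ ∣⟨ λ₂≠0 ⟩ → 0ℚ ℚ.< ∣ λ₂ ∣⟨ λ₂≠0 ⟩ →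
  let u = λ₂ / λ₁ ⟨ λ₁≠0 ⟩
      t = c₁ / c₂ ⟨ c₂≠0 ⟩
  in
  (u-nonTorsion : NotRootOfUnity u) →
  (l : ℕ) (l-order : OrderModπ u l) →
  let k  = ν ((u ^ l) - 1#) (#⇒-#0 (u-nonTorsion l (OrderModπ.positive l-order)))
      νt = ν t (/-#0 c₁≠0 c₂≠0)
      νΔ = ν (λ₂ - λ₁) (ratio⇒-#0 λ₁≠0 u-nonTorsion)
      K  = ℚₚ.KeplerSet a
      Λ  = Closure (Powers u)
  in
  ( (- t) ∉ Λ →
    Σ (∀ i → i < l → a i ℚₚ.# ℚₚ.0#) λ a≠0 →
    Σ (∀ i → i < l → (t + (u ^ i)) # 0#) λ t+uⁱ≠0 →
    let piece : Σ ℕ (_< l) → ℚₚ.Frac → Set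
        piece = λ (i , i<l) → ℚₚ.Coset (a (suc i) ℚₚ./ a i ⟨ a≠0 i i<l ⟩)
          (((νt ℤ.+ νΔ) ℤ.- (+ 2 ℤ.* ν (t + (u ^ i)) (t+uⁱ≠0 i i<l))) ℤ.+ k)
    in
    (K ≐ ⋃ (Σ ℕ (_< l)) piece) × DisjointFamily piece )
  ×
  ( (- t) ∈ Λ → l ≡ 1 →
    ∃ λ h → (ι h ≈ ((λ₁ + λ₂) / 2# ⟨ 2≠0 ⟩)) ×
            (K ≐ ∁ (ℚₚ.Coset h (+ 1 ℤ.+ ν λ₂ λ₂≠0))) )
  ×
  ( (- t) ∈ Λ → 2 ≤ l →
    let IsIndex = λ σ → σ < l × ((u ^ σ) ≡ (- t) [modπ^ k ]) in
    ∃! _≡_ IsIndex ×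
    (∀ σ → IsIndex σ →
      Σ (∀ i → i < l × i ≢ σ → a i ℚₚ.# ℚₚ.0#) λ a≠0 →
      let Index = Σ ℕ (λ i → i < l × i ≢ σ)
          piece : Index → ℚₚ.Frac → Set
          piece = λ (i , i∈) → ℚₚ.Coset (a (suc i) ℚₚ./ a i ⟨ a≠0 i i∈ ⟩) (νΔ ℤ.+ k)
          outer = ∁ (ℚₚ.Coset ℚₚ.0# ((ν λ₂ λ₂≠0 ℤ.+ + 1) ℤ.- k))
      in
      (K ≐ (⋃ Index piece ∪ outer)) × DisjointFamily piece × (⋃ Index piece ⊥ outer)) )
theorem2 p p-prime p≥3 A a r s recurrence c₁ c₂ λ₁ λ₂ c₁≠0 c₂≠0 λ₁≠0 λ₂≠0 binet _ _ u-nonTorsion l l-order =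
  part₁ , part₂ , part₃
  where
  open PAdic p p-prime p≥3
  open PAdicFields p p-prime p≥3
  open KeplerSets.Theorem ℤₚ (integers A) (ℚₚ-embedding A) p p-prime p≥3 ℚₚ-residues (p-uniformizer A) (Field.2≠0 A)
    a r s recurrence c₁ c₂ λ₁ λ₂ c₁≠0 c₂≠0 λ₁≠0 λ₂≠0 binet u-nonTorsion l l-order
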